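{- Let $U:\mathbb{Z}\to\mathbb{Q}$ be a linear recurrence sequence, let $a\in\mathbb{Q}$, and let $p$ be a regular prime for $U$. Assume that there exists a sequence of integers $(n_k)$ such that $\nu_p(U(n_k))\to+\infty$ and $\nu_p(n_k-a)\to+\infty$. Then $a$ is a twisted rational zero of $U$.
   Context: A $\mathbb{Q}$-valued linear recurrence sequence (LRS) is a map $U:\mathbb{Z}\to\mathbb{Q}$ with $U(n+m)=a_{m-1}U(n+m-1)+\dots+a_0U(n)$ for all $n\in\mathbb{Z}$, with $a_i\in\mathbb{Q}$, $a_0\ne0$, $m$ minimal. Let $\lambda_1,\dots,\lambda_s\in\overline{\mathbb{Q}}$ be the distinct roots of $X^m-a_{m-1}X^{m-1}-\dots-a_0$; then $U(n)=f_1(n)\lambda_1^n+\dots+f_s(n)\lambda_s^n$ with nonzero polynomials $f_i$ (Binet expansion). For $a=k/\ell\in\mathbb{Q}$ ($\gcd(k,\ell)=1$, $\ell>0$), a determination of the rational power $\lambda_i^a$ means $\mu^k$ for some $\mu\in\overline{\mathbb{Q}}$ with $\mu^\ell=\lambda_i$ (chosen independently for each $i$). The rational number $a$ is a twisted rational zero (TRZ) of $U$ if for some determinations of $\lambda_1^a,\dots,\lambda_s^a$ and some roots of unity $\xi_1,\dots,\xi_s$ we have $\xi_1f_1(a)\lambda_1^a+\dots+\xi_sf_s(a)\lambda_s^a=0$. A prime $p$ is regular for $U$ if $p$ divides neither the denominators of $a_0,\dots,a_{m-1}$ nor the numerator of $a_0$. $\nu_p$ is the $p$-adic valuation on $\mathbb{Q}$,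 $\nu_p(0)=+\infty$. -}

module Defs where

open import Level using (Level; _⊔_) renaming (suc to lsuc)
open import Algebra.Structures using (IsCommutativeRing)
open import Data.Nat as ℕ using (ℕ; zero; suc; _<_; _≤_)
open import Data.Nat.Divisibility using (_∣_; _∣?_)
open import Data.Nat.DivMod using (_/_)
open import Data.Integer as ℤ using (ℤ; +_; ∣_∣)
open import Data.Rational as ℚ using (ℚ; ↥_; ↧ₙ_; 0ℚ)
open import Data.Fin using (Fin; zero; suc; toℕ)
open import Data.List using (List; []; _∷_; _++_; [_])
open import Data.List.Relation.Unary.Any using (Any)
open import Data.Product using (Σ; ∃; ∃-syntax; _×_; _,_)
open import Data.Unit using (⊤)
open import Relation.Nullary using (¬_; yes; no)
open import Relation.Binary.PropositionalEquality using (_≡_; _≢_)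

-- ν_p on positive naturals (with fuel = n, which always suffices for p ≥ 2).
νℕ-fuel : ℕ → ℕ → ℕ → ℕ
νℕ-fuel zero p n = 0
νℕ-fuel (suc f) (suc (suc q)) (suc n) with suc (suc q) ∣? suc n
... | yes _ = suc (νℕ-fuel f (suc (suc q)) (suc n / suc (suc q)))
... | no  _ = 0
νℕ-fuel (suc f) _ _ = 0

νℕ : ℕ → ℕ → ℕ
νℕ p n = νℕ-fuel n p n

data ℤ∞ : Set where
  fin : ℤ → ℤ∞
  ∞   : ℤ∞

_≤∞_ : ℤ → ℤ∞ → Set
M ≤∞ fin z = M ℤ.≤ z
M ≤∞ ∞     = ⊤

νₚ : ℕ → ℚ → ℤ∞
νₚ p q with ∣ ↥ q ∣ ℕ.≟ 0
... | yes _ = ∞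
... | no  _ = fin (+ νℕ p ∣ ↥ q ∣ ℤ.- + νℕ p (↧ₙ q))

TendsTo∞ : (ℕ → ℤ∞) → Set
TendsTo∞ x = ∀ (M : ℤ) → ∃[ K ] (∀ k → K ≤ k → M ≤∞ x k)

fromℤ : ℤ → ℚ
fromℤ z = z ℚ./ 1

∑ℚ : (n : ℕ) → (Fin n → ℚ) → ℚ
∑ℚ zero    f = 0ℚ
∑ℚ (suc n) f = f zero ℚ.+ ∑ℚ n (λ i → f (suc i))

SatisfiesRec : (U : ℤ → ℚ) (m : ℕ) (a : Fin m → ℚ) → Set
SatisfiesRec U m a =
  ∀ (n : ℤ) → U (n ℤ.+ + m) ≡ ∑ℚ m (λ i → a i ℚ.* U (n ℤ.+ + toℕ i))

-- a_0 ≠ 0 (vacuous for the order-0 recurrence of the zero sequence)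
LeadNZ : (m : ℕ) → (Fin m → ℚ) → Set
LeadNZ zero    a = ⊤
LeadNZ (suc m) a = a zero ≢ 0ℚ

IsMinimalRec : (U : ℤ → ℚ) (m : ℕ) (a : Fin m → ℚ) → Set
IsMinimalRec U m a =
  LeadNZ m a × SatisfiesRec U m a ×
  (∀ (m' : ℕ) → m' < m → (b : Fin m' → ℚ) → LeadNZ m' b → ¬ SatisfiesRec U m' b)

RegularPrime : (p m : ℕ) → (Fin m → ℚ) → Set
RegularPrime p m a = (∀ i → ¬ (p ∣ ↧ₙ (a i))) × NumCond m a
  where
  NumCond : (m : ℕ) → (Fin m → ℚ) → Set
  NumCond zero    a = ⊤
  NumCond (suc m) a = ¬ (p ∣ ∣ ↥ (a zero) ∣)

-- Algebraically closed fields of characteristic 0 (stand-in for ℚ̄)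

evalPoly : ∀ {c} {A : Set c} → (A → A → A) → (A → A → A) → A → List A → A → A
evalPoly _+_ _*_ 0# []       x = 0#
evalPoly _+_ _*_ 0# (c ∷ cs) x = c + (x * evalPoly _+_ _*_ 0# cs x)

record AlgClosedField c ℓ : Set (lsuc (c ⊔ ℓ)) where
  field
    Carrier : Set c
    _≈_     : Carrier → Carrier → Set ℓ
    _+_ _*_ : Carrier → Carrier → Carrier
    -_      : Carrier → Carrier
    0# 1#   : Carrier
    isCommutativeRing : IsCommutativeRing _≈_ _+_ _*_ -_ 0# 1#
    _⁻¹     : Carrier → Carrier
    ⁻¹-inverse : ∀ x → ¬ (x ≈ 0#) → (x * (x ⁻¹)) ≈ 1#
    1≉0     : ¬ (1# ≈ 0#)


    algClosed : ∀ (cs : List Carrier) → cs ≢ [] →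
                ∃[ r ] (evalPoly _+_ _*_ 0# (cs ++ [ 1# ]) r ≈ 0#)

  eval : List Carrier → Carrier → Carrier
  eval = evalPoly _+_ _*_ 0#

  NonZeroPoly : List Carrier → Set (c ⊔ ℓ)
  NonZeroPoly cs = Any (λ c → ¬ (c ≈ 0#)) cs

  _^_ : Carrier → ℕ → Carrier
  x ^ zero  = 1#
  x ^ suc n = x * (x ^ n)

  _^ℤ_ : Carrier → ℤ → Carrier
  x ^ℤ (+ n)       = x ^ n
  x ^ℤ ℤ.-[1+ n ]  = (x ⁻¹) ^ suc n

  ∑ : (n : ℕ) → (Fin n → Carrier) → Carrier
  ∑ zero    f = 0#
  ∑ (suc n) f = f zero + ∑ n (λ i → f (suc i))

  IsRootOfUnity : Carrier → Set ℓ
  IsRootOfUnity ξ = ∃[ N ] ((N ≢ 0) × ((ξ ^ N) ≈ 1#))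

-- a ring homomorphism ℚ → K (necessarily injective, so K has characteristic 0)
record QEmbedding {c ℓ} (K : AlgClosedField c ℓ) : Set (c ⊔ ℓ) where
  open AlgClosedField K
  field
    ι     : ℚ → Carrier
    ι-0   : ι 0ℚ ≈ 0#
    ι-1   : ι ℚ.1ℚ ≈ 1#
    ι-+   : ∀ x y → ι (x ℚ.+ y) ≈ (ι x + ι y)
    ι-*   : ∀ x y → ι (x ℚ.* y) ≈ (ι x * ι y)

module _ {c ℓ} (K : AlgClosedField c ℓ) (E : QEmbedding K) where
  open AlgClosedField K
  open QEmbedding E

  charPoly : (m : ℕ) → (Fin m → ℚ) → List Carrier
  charPoly zero    a = [ 1# ]
  charPoly (suc m) a = (- ι (a zero)) ∷ charPoly m (λ i → a (suc i))

  IsBinetExpansion : (U : ℤ → ℚ) (m : ℕ) (a : Fin m → ℚ)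
                     (s : ℕ) (lam : Fin s → Carrier) (f : Fin s → List Carrier) → Set (c ⊔ ℓ)
  IsBinetExpansion U m a s lam f =
    (∀ i j → lam i ≈ lam j → i ≡ j) ×
    (∀ i → eval (charPoly m a) (lam i) ≈ 0#) ×
    (∀ x → eval (charPoly m a) x ≈ 0# → ∃[ i ] (x ≈ lam i)) ×
    (∀ i → NonZeroPoly (f i)) ×
    (∀ (n : ℤ) → ι (U n) ≈ ∑ s (λ i → eval (f i) (ι (fromℤ n)) * (lam i ^ℤ n)))

  -- a = k/ℓ (lowest terms, ℓ > 0) is a twisted rational zero w.r.t. the Binet data:
  -- there are determinations μᵢ^k of λᵢ^a (μᵢ^ℓ = λᵢ) and roots of unity ξᵢ with
  -- Σ ξᵢ fᵢ(a) λᵢ^a = 0.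
  IsTRZ : (s : ℕ) (lam : Fin s → Carrier) (f : Fin s → List Carrier) (q : ℚ) → Set (c ⊔ ℓ)
  IsTRZ s lam f q =
    Σ (Fin s → Carrier) λ μ → Σ (Fin s → Carrier) λ ξ →
      ((∀ i → (μ i ^ (↧ₙ q)) ≈ lam i) ×
       (∀ i → IsRootOfUnity (ξ i)) ×
       (∑ s (λ i → ξ i * (eval (f i) (ι q) * (μ i ^ℤ (↥ q)))) ≈ 0#))

{-# OPTIONS --safe #-}
-- No completion is needed: the p-adic argument is carried out in K.  Write a = k/d in lowest terms and let A ⊆ K be
-- a ring, finitely generated as a module over the p-integral rationals, containing λᵢ^±1, roots μᵢ with μᵢ^d = λᵢ,
-- and the N-th roots of unity, where N is chosen by the pigeonhole principle with μᵢ^N ≡ 1 mod p.  If n is close to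
-- a, then λᵢ^n = μᵢ^k wᵢ with wᵢ^N ≡ 1 modulo a high power p^M, and Σ κᵢ wᵢ ≡ U(n) ≡ 0 for κᵢ = fᵢ(a) μᵢ^k.
--
-- For an s-tuple σ of N-th roots of unity put S(σ) = Σ κᵢ σᵢ and y(σ) = ∏ᵢ wᵢ^-(N-1) ∏_{τ ≠ σᵢ} (wᵢ - τ).  The
-- derivative of X^N - 1 = ∏ (X - τ) gives Σ y(σ) = N^s, while y(σ)(wᵢ - σᵢ) is a multiple of wᵢ^N - 1, so that
-- y(σ) S(σ) ≡ 0.  Finitely generated modules are p-adically separated, so these approximate solutions for all M
-- yield an exact one: algebraic y(σ) with Σ y(σ) = N^s and y(σ) S(σ) = 0.
--
-- It remains to find a σ for which y(σ) can be cancelled, although equality in K is not decidable.  If s ≥ 2, an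
-- idempotent ε makes ε λ₁ + (1 - ε) λ₂ a root of the characteristic polynomial, hence some λᵢ, so ε is 0 or 1, and
-- therefore each algebraic y(σ) is nilpotent or nonzero; not all of them are nilpotent.  If s = 1, every S(σ) is a
-- unit times κ₁, and κ₁ = 0 follows from the sum.

module Submission where

open import Defs
open import Level using (_⊔_; 0ℓ; Lift; lift) renaming (suc to lsuc)
open import Algebra.Bundles using (CommutativeRing)
import Algebra.Properties.Ring as RingProperties
import Algebra.Solver.Ring as RingSolver
import Algebra.Solver.Ring.AlmostCommutativeRing as ACR
open import Data.Empty using (⊥-elim)
open import Data.Fin as Fin using (Fin; zero; suc; toℕ)
import Data.Fin.Properties as Finₚ
open import Data.Integer as ℤ using (ℤ; +_; -[1+_]; ∣_∣)
import Data.Integer.Divisibility.Signed as ℤ∣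
import Data.Integer.DivMod as ℤD
import Data.Integer.Properties as ℤₚ
import Data.Integer.Solver as ℤSolver
open import Data.List as List using (List; []; _∷_; [_]; length)
import Data.List.Properties as Listₚ
open import Data.List.Relation.Unary.All as All using (All; []; _∷_)
import Data.List.Relation.Unary.All.Properties as Allₚ
open import Data.Maybe using (Maybe; just; nothing)
open import Data.Nat as ℕ using (ℕ; zero; suc; z≤n; s≤s)
open import Data.Nat.Coprimality as Coprime using (Coprime)
open import Data.Nat.Divisibility using (_∣_; _∣?_; divides; ∣-trans; m∣m*n; *-monoʳ-∣; ∣⇒≤; *-cancelˡ-∣; 1∣_; ∣1⇒≡1; ∣-refl; m*n∣⇒m∣)
open import Data.Nat.DivMod using (_/_; m*[n/m]≡n)
open import Data.Nat.GCD using (module Bézout)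
open import Data.Nat.Primality using (Prime; euclidsLemma; prime⇒nonZero; prime⇒nonTrivial; prime⇒irreducible)
import Data.Nat.Properties as ℕₚ
open import Data.Product using (∃-syntax; _×_; _,_; proj₁; proj₂)
open import Data.Rational as ℚ using (ℚ; ↥_; ↧_; ↧ₙ_; 0ℚ; 1ℚ; toℚᵘ)
import Data.Rational.Properties as ℚₚ
open import Data.Rational.Solver using (module +-*-Solver)
import Data.Rational.Unnormalised as ℚᵘ
import Data.Rational.Unnormalised.Properties as ℚᵘₚ
open import Data.Sum using (_⊎_; inj₁; inj₂; [_,_]′)
open import Data.Unit using (⊤; tt)
open import Data.Vec as Vec using (Vec; []; _∷_)
import Data.Vec.Properties as Vecₚ
open import Data.Vec.Relation.Unary.All as VAll using ([]; _∷_)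
import Data.Vec.Relation.Unary.All.Properties as VAllₚ
open import Function using (_∘_; const)
open import Relation.Binary.PropositionalEquality as ≡ using (_≡_; _≢_; cong; cong₂; subst)
import Relation.Binary.Reasoning.Setoid as SetoidReasoning
open import Relation.Nullary using (¬_; yes; no)
open import Relation.Unary using (Pred)

-- The obstacle is that no prime above `p` can be singled out. After such a choice each wᵢ would be
-- close to one definite root of unity; in `A` itself wᵢ may be close to different ones at different
-- primes, so all tuples σ are carried along and y(σ) replaces the choice. Its formula is an
-- indicator function: at exact N-th roots of unity wᵢ, the factor wᵢ^-(N-1) ∏_{τ ≠ σᵢ} (wᵢ - τ) is
-- N if wᵢ = σᵢ and 0 otherwise. Since N may be divisible by p, it is not divided out, and the total
-- is N^s instead of 1. The passage to an exact solution involves no convergence: the y(σ) for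
-- different M need not approach each other. Only the vectors y(σ) S(σ) tend to 0, and any two of
-- them differ by a vector of the same form whose weights sum to 0. That is a condition over ℚ, so
-- the exact weights acquire denominators.

module Rationals where
  open ≡ using (refl; sym; trans; module ≡-Reasoning)

  -- Integers in ℚ, lowest terms and the p-adic valuation.

  fromℤᵘ : ∀ z → toℚᵘ (fromℤ z) ℚᵘ.≃ ℚᵘ.mkℚᵘ z 0
  fromℤᵘ z = ℚₚ.toℚᵘ-fromℚᵘ (ℚᵘ.mkℚᵘ z 0)

  fromℤ-+ : ∀ x y → fromℤ (x ℤ.+ y) ≡ fromℤ x ℚ.+ fromℤ y
  fromℤ-+ x y = ℚₚ.toℚᵘ-injective (begin
    toℚᵘ (fromℤ (x ℤ.+ y))                    ≈⟨ fromℤᵘ (x ℤ.+ y) ⟩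
    ℚᵘ.mkℚᵘ (x ℤ.+ y) 0                       ≈⟨ ℚᵘ.*≡* (cong (ℤ._* + 1) (sym (cong₂ ℤ._+_ (ℤₚ.*-identityʳ x) (ℤₚ.*-identityʳ y)))) ⟩
    ℚᵘ.mkℚᵘ x 0 ℚᵘ.+ ℚᵘ.mkℚᵘ y 0              ≈⟨ ℚᵘₚ.+-cong (fromℤᵘ x) (fromℤᵘ y) ⟨
    toℚᵘ (fromℤ x) ℚᵘ.+ toℚᵘ (fromℤ y)        ≈⟨ ℚₚ.toℚᵘ-homo-+ (fromℤ x) (fromℤ y) ⟨
    toℚᵘ (fromℤ x ℚ.+ fromℤ y)                ∎)
    where open ℚᵘₚ.≃-Reasoning

  fromℤ-* : ∀ x y → fromℤ (x ℤ.* y) ≡ fromℤ x ℚ.* fromℤ y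
  fromℤ-* x y = ℚₚ.toℚᵘ-injective (begin
    toℚᵘ (fromℤ (x ℤ.* y))                    ≈⟨ fromℤᵘ (x ℤ.* y) ⟩
    ℚᵘ.mkℚᵘ x 0 ℚᵘ.* ℚᵘ.mkℚᵘ y 0              ≈⟨ ℚᵘₚ.*-cong (fromℤᵘ x) (fromℤᵘ y) ⟨
    toℚᵘ (fromℤ x) ℚᵘ.* toℚᵘ (fromℤ y)        ≈⟨ ℚₚ.toℚᵘ-homo-* (fromℤ x) (fromℤ y) ⟨
    toℚᵘ (fromℤ x ℚ.* fromℤ y)                ∎)
    where open ℚᵘₚ.≃-Reasoning

  fromℤ-neg : ∀ x → fromℤ (ℤ.- x) ≡ ℚ.- fromℤ x
  fromℤ-neg (+ 0)     = refl
  fromℤ-neg (+ suc n) = refl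
  fromℤ-neg -[1+ n ]  = solve 1 (λ x → x := :- (:- x)) refl (fromℤ (+ suc n))
    where open +-*-Solver

  fromℤ-injective : ∀ {x y} → fromℤ x ≡ fromℤ y → x ≡ y
  fromℤ-injective {x} {y} eq with ℚₚ.fromℚᵘ-injective {ℚᵘ.mkℚᵘ x 0} {ℚᵘ.mkℚᵘ y 0} eq
  ... | ℚᵘ.*≡* e = trans (sym (ℤₚ.*-identityʳ x)) (trans e (ℤₚ.*-identityʳ y))

  clear-denominator : ∀ q → fromℤ (↧ q) ℚ.* q ≡ fromℤ (↥ q)
  clear-denominator q@record{} = ℚₚ.toℚᵘ-injective (begin
    toℚᵘ (fromℤ (↧ q) ℚ.* q)           ≈⟨ ℚₚ.toℚᵘ-homo-* (fromℤ (↧ q)) q ⟩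
    toℚᵘ (fromℤ (↧ q)) ℚᵘ.* toℚᵘ q     ≈⟨ ℚᵘₚ.*-congʳ {toℚᵘ q} (fromℤᵘ (↧ q)) ⟩
    ℚᵘ.mkℚᵘ (↧ q) 0 ℚᵘ.* toℚᵘ q        ≈⟨ ℚᵘ.*≡* (trans (ℤₚ.*-identityʳ _) (trans (ℤₚ.*-comm (↧ q) (↥ q)) (cong (λ d → ↥ q ℤ.* + d) (sym (ℕₚ.+-identityʳ (↧ₙ q)))))) ⟩
    ℚᵘ.mkℚᵘ (↥ q) 0                    ≈⟨ fromℤᵘ (↥ q) ⟨
    toℚᵘ (fromℤ (↥ q))                 ∎)
    where open ℚᵘₚ.≃-Reasoning

  fromℤ-nonZero : ∀ {z} → fromℤ z ≡ 0ℚ → z ≡ + 0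
  fromℤ-nonZero = fromℤ-injective {y = + 0}

  inverse : ∀ q → q ≢ 0ℚ → ∃[ r ] (r ℚ.* q ≡ 1ℚ)
  inverse q q≢0 = ℚ.1/_ q ⦃ ℚ.≢-nonZero q≢0 ⦄ , ℚₚ.*-inverseˡ q ⦃ ℚ.≢-nonZero q≢0 ⦄

  prime-power-cancel : ∀ {p} → Prime p → ∀ M {u x} → ¬ (p ∣ u) → p ℕ.^ M ∣ u ℕ.* x → p ℕ.^ M ∣ x
  prime-power-cancel pp zero p∤u d = 1∣ _
  prime-power-cancel {p} pp (suc M) {u} {x} p∤u d with euclidsLemma u x pp (m*n∣⇒m∣ p (p ℕ.^ M) d)
  ... | inj₁ p∣u = ⊥-elim (p∤u p∣u)
  ... | inj₂ (divides y refl) = subst (p ℕ.^ suc M ∣_) (ℕₚ.*-comm p y) (*-monoʳ-∣ p (prime-power-cancel pp M p∤u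
          (*-cancelˡ-∣ p ⦃ prime⇒nonZero pp ⦄ (subst (p ℕ.^ suc M ∣_) swap d))))
    where
    swap : u ℕ.* (y ℕ.* p) ≡ p ℕ.* (u ℕ.* y)
    swap = trans (sym (ℕₚ.*-assoc u y p)) (ℕₚ.*-comm (u ℕ.* y) p)

  n<b^n : ∀ {b} → 1 ℕ.< b → ∀ n → n ℕ.< b ℕ.^ n
  n<b^n 1<b zero = s≤s z≤n
  n<b^n {b} 1<b (suc n) = ℕₚ.≤-<-trans (n<b^n 1<b n) (ℕₚ.^-monoʳ-< b 1<b (ℕₚ.n<1+n n))

  -- Holds for any fuel and any `p`: stopping early only lowers the exponent.
  p^νℕ∣n : ∀ f p n → p ℕ.^ νℕ-fuel f p n ∣ n
  p^νℕ∣n zero p n = 1∣ n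
  p^νℕ∣n (suc f) zero n = 1∣ n
  p^νℕ∣n (suc f) (suc zero) n = 1∣ n
  p^νℕ∣n (suc f) (suc (suc q)) zero = 1∣ 0
  p^νℕ∣n (suc f) (suc (suc q)) (suc n) with suc (suc q) ∣? suc n
  ... | yes d = subst (suc (suc q) ℕ.^ suc (νℕ-fuel f (suc (suc q)) (suc n / suc (suc q))) ∣_) (m*[n/m]≡n d)
                  (*-monoʳ-∣ (suc (suc q)) (p^νℕ∣n f (suc (suc q)) (suc n / suc (suc q))))
  ... | no _ = 1∣ _

  -- The denominator can only lower `νₚ`, so the bound passes to the exponent of the numerator.
  νₚ≥⇒∣numerator : ∀ p q M → (+ M) ≤∞ νₚ p q → p ℕ.^ M ∣ ∣ ↥ q ∣
  νₚ≥⇒∣numerator p q M le with ∣ ↥ q ∣ ℕ.≟ 0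
  ... | yes eq = subst (p ℕ.^ M ∣_) (sym eq) (divides 0 refl)
  ... | no _ = ∣-trans (pow-mono M≤ν) (p^νℕ∣n (∣ ↥ q ∣) p (∣ ↥ q ∣))
    where
    M≤ν : M ℕ.≤ νℕ p (∣ ↥ q ∣)
    M≤ν = ℤₚ.drop‿+≤+ (ℤₚ.≤-trans le (ℤₚ.i≤j⇒i-k≤j (+ νℕ p (↧ₙ q)) ℤₚ.≤-refl))
    pow-mono : ∀ {m n} → m ℕ.≤ n → p ℕ.^ m ∣ p ℕ.^ n
    pow-mono {m} {n} m≤n = subst (p ℕ.^ m ∣_) (trans (sym (ℕₚ.^-distribˡ-+-* p m (n ℕ.∸ m))) (cong (p ℕ.^_) (ℕₚ.m+[n∸m]≡n m≤n))) (m∣m*n _)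

  pℚ : ℕ → ℕ → ℚ
  pℚ p M = fromℤ (+ (p ℕ.^ M))

  -- The localisation of ℤ at p.

  module PIntegral {p : ℕ} (pp : Prime p) where

    -- Any multiplier `u` prime to `p` will do, not just the reduced denominator, so sums and
    -- products need no normalisation.
    record Integral (q : ℚ) : Set where
      constructor integral
      field
        {u}  : ℤ
        p∤u  : ¬ (p ∣ ∣ u ∣)
        z    : ℤ
        uq≡z : fromℤ u ℚ.* q ≡ fromℤ z

    1<p : 1 ℕ.< p
    1<p = ℕ.nonTrivial⇒n>1 p ⦃ prime⇒nonTrivial pp ⦄

    p∤1 : ¬ (p ∣ 1)
    p∤1 d = ℕₚ.<⇒≢ 1<p (sym (∣1⇒≡1 d))

    p∤* : ∀ u v → ¬ (p ∣ ∣ u ∣) → ¬ (p ∣ ∣ v ∣) → ¬ (p ∣ ∣ u ℤ.* v ∣)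
    p∤* u v p∤u p∤v d = [ p∤u , p∤v ]′ (euclidsLemma (∣ u ∣) (∣ v ∣) pp (subst (p ∣_) (ℤₚ.abs-* u v) d))

    p∤⇒≢0 : ∀ {u} → ¬ (p ∣ ∣ u ∣) → fromℤ u ≢ 0ℚ
    p∤⇒≢0 {u} p∤u eq with fromℤ-nonZero {u} eq
    ... | refl = p∤u (divides 0 refl)

    integral-fromℤ : ∀ z → Integral (fromℤ z)
    integral-fromℤ z = integral {u = + 1} p∤1 z (ℚₚ.*-identityˡ (fromℤ z))

    integral-+ : ∀ {q r} → Integral q → Integral r → Integral (q ℚ.+ r)
    integral-+ {q} {r} (integral {u} p∤u x ex) (integral {v} p∤v y ey) =
      integral {u = u ℤ.* v} (p∤* u v p∤u p∤v) (v ℤ.* x ℤ.+ u ℤ.* y) (begin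
        fromℤ (u ℤ.* v) ℚ.* (q ℚ.+ r)                                  ≡⟨ cong (ℚ._* (q ℚ.+ r)) (fromℤ-* u v) ⟩
        fromℤ u ℚ.* fromℤ v ℚ.* (q ℚ.+ r)                              ≡⟨ solve 4 (λ u v q r → u :* v :* (q :+ r) := v :* (u :* q) :+ u :* (v :* r)) refl (fromℤ u) (fromℤ v) q r ⟩
        fromℤ v ℚ.* (fromℤ u ℚ.* q) ℚ.+ fromℤ u ℚ.* (fromℤ v ℚ.* r)    ≡⟨ cong₂ (λ a b → fromℤ v ℚ.* a ℚ.+ fromℤ u ℚ.* b) ex ey ⟩
        fromℤ v ℚ.* fromℤ x ℚ.+ fromℤ u ℚ.* fromℤ y                    ≡⟨ cong₂ ℚ._+_ (fromℤ-* v x) (fromℤ-* u y) ⟨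
        fromℤ (v ℤ.* x) ℚ.+ fromℤ (u ℤ.* y)                            ≡⟨ fromℤ-+ (v ℤ.* x) (u ℤ.* y) ⟨
        fromℤ (v ℤ.* x ℤ.+ u ℤ.* y)                                    ∎)
      where open ≡-Reasoning
            open +-*-Solver

    integral-* : ∀ {q r} → Integral q → Integral r → Integral (q ℚ.* r)
    integral-* {q} {r} (integral {u} p∤u x ex) (integral {v} p∤v y ey) =
      integral {u = u ℤ.* v} (p∤* u v p∤u p∤v) (x ℤ.* y) (begin
        fromℤ (u ℤ.* v) ℚ.* (q ℚ.* r)             ≡⟨ cong (ℚ._* (q ℚ.* r)) (fromℤ-* u v) ⟩
        fromℤ u ℚ.* fromℤ v ℚ.* (q ℚ.* r)         ≡⟨ solve 4 (λ u v q r → u :* v :* (q :* r) := u :* q :* (v :* r)) refl (fromℤ u) (fromℤ v) q r ⟩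
        fromℤ u ℚ.* q ℚ.* (fromℤ v ℚ.* r)         ≡⟨ cong₂ ℚ._*_ ex ey ⟩
        fromℤ x ℚ.* fromℤ y                       ≡⟨ fromℤ-* x y ⟨
        fromℤ (x ℤ.* y)                           ∎)
      where open ≡-Reasoning
            open +-*-Solver

    integral-neg : ∀ {q} → Integral q → Integral (ℚ.- q)
    integral-neg {q} h = subst Integral (solve 1 (λ q → con (ℚ.- 1ℚ) :* q := :- q) refl q) (integral-* (integral-fromℤ -[1+ 0 ]) h)
      where open +-*-Solver

    integral-denominator : ∀ q → ¬ (p ∣ ↧ₙ q) → Integral q
    integral-denominator q p∤d = integral {u = ↧ q} p∤d (↥ q) (clear-denominator q)

    p∤denominator : ∀ q → p ∣ ∣ ↥ q ∣ → ¬ (p ∣ ↧ₙ q)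
    p∤denominator (ℚ.mkℚ _ _ coprime) d d' = p∤1 (subst (p ∣_) (Coprime.recompute coprime (d , d')) ∣-refl)

    integral-recip : ∀ q → ¬ (p ∣ ∣ ↥ q ∣) → ∃[ r ] (Integral r × r ℚ.* q ≡ 1ℚ)
    integral-recip q p∤n with inverse (fromℤ (↥ q)) (p∤⇒≢0 {↥ q} p∤n)
    ... | n⁻¹ , inv = n⁻¹ ℚ.* fromℤ (↧ q) , integral {u = ↥ q} p∤n (↧ q) eq₁ , eq₂
      where
      open ≡-Reasoning
      open +-*-Solver
      eq₁ : fromℤ (↥ q) ℚ.* (n⁻¹ ℚ.* fromℤ (↧ q)) ≡ fromℤ (↧ q)
      eq₁ = begin
        fromℤ (↥ q) ℚ.* (n⁻¹ ℚ.* fromℤ (↧ q))   ≡⟨ solve 3 (λ a b c → a :* (b :* c) := (b :* a) :* c) refl (fromℤ (↥ q)) n⁻¹ (fromℤ (↧ q)) ⟩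
        (n⁻¹ ℚ.* fromℤ (↥ q)) ℚ.* fromℤ (↧ q)   ≡⟨ cong (ℚ._* fromℤ (↧ q)) inv ⟩
        1ℚ ℚ.* fromℤ (↧ q)                      ≡⟨ ℚₚ.*-identityˡ _ ⟩
        fromℤ (↧ q)                             ∎
      eq₂ : n⁻¹ ℚ.* fromℤ (↧ q) ℚ.* q ≡ 1ℚ
      eq₂ = trans (ℚₚ.*-assoc n⁻¹ (fromℤ (↧ q)) q) (trans (cong (n⁻¹ ℚ.*_) (clear-denominator q)) inv)

    -- If `p` divides the denominator of `q`, it does not divide the numerator, because the fraction
    -- is in lowest terms; then the reciprocal of `q` is p-integral.
    integral-ratio : ∀ q b c → q ℚ.* c ≡ b → (∃[ q ] (Integral q × b ≡ q ℚ.* c)) ⊎ (∃[ q ] (Integral q × c ≡ q ℚ.* b))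
    integral-ratio q b c qc≡b with p ∣? ↧ₙ q
    ... | no p∤d = inj₁ (q , integral-denominator q p∤d , sym qc≡b)
    ... | yes p∣d = let r , int , rq≡1 = integral-recip q (λ p∣n → p∤denominator q p∣n p∣d) in
      inj₂ (r , int , (begin
        c                     ≡⟨ ℚₚ.*-identityˡ c ⟨
        1ℚ ℚ.* c              ≡⟨ cong (ℚ._* c) rq≡1 ⟨
        r ℚ.* q ℚ.* c         ≡⟨ ℚₚ.*-assoc r q c ⟩
        r ℚ.* (q ℚ.* c)       ≡⟨ cong (r ℚ.*_) qc≡b ⟩
        r ℚ.* b               ∎))
      where open ≡-Reasoning

    integral-total : ∀ b c → (∃[ q ] (Integral q × b ≡ q ℚ.* c)) ⊎ (∃[ q ] (Integral q × c ≡ q ℚ.* b))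
    integral-total b c with c ℚₚ.≟ 0ℚ
    ... | yes refl = inj₂ (0ℚ , integral-fromℤ (+ 0) , sym (ℚₚ.*-zeroˡ b))
    ... | no c≢0 = let c⁻¹ , inv = inverse c c≢0 in
      integral-ratio (b ℚ.* c⁻¹) b c (trans (ℚₚ.*-assoc b c⁻¹ c) (trans (cong (b ℚ.*_) inv) (ℚₚ.*-identityʳ b)))

    not-infinitely-divisible : ∀ q → q ≢ 0ℚ → ∃[ M ] (∀ r → Integral r → q ≢ pℚ p (suc M) ℚ.* r)
    -- The power p^(n+1) exceeds n, so with n = `∣ ↥ q ∣` it cannot divide the nonzero numerator.
    not-infinitely-divisible q q≢0 = (∣ ↥ q ∣) , contra
      where
      n = ↥ q
      M = suc (∣ n ∣)
      n≢0 : n ≢ + 0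
      n≢0 eq = q≢0 (ℚₚ.↥p≡0⇒p≡0 q eq)
      contra : ∀ r → Integral r → q ≢ pℚ p M ℚ.* r
      contra r (integral {u} p∤u z e) q≡ = ℕₚ.<⇒≱ (ℕₚ.<-trans (ℕₚ.n<1+n _) (n<b^n 1<p M)) (∣⇒≤ ⦃ ℕ.≢-nonZero (λ e → n≢0 (ℤₚ.∣i∣≡0⇒i≡0 e)) ⦄ (prime-power-cancel pp M p∤u
         (subst (p ℕ.^ M ∣_) (trans (cong ∣_∣ key) (ℤₚ.abs-* u n)) (subst (p ℕ.^ M ∣_) (sym (ℤₚ.abs-* (+ (p ℕ.^ M)) (↧ q ℤ.* z))) (m∣m*n _)))))
        where
        open ≡-Reasoning
        open +-*-Solver
        key : + (p ℕ.^ M) ℤ.* (↧ q ℤ.* z) ≡ u ℤ.* n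
        key = fromℤ-injective (sym (begin
          fromℤ (u ℤ.* n)                                    ≡⟨ fromℤ-* u n ⟩
          fromℤ u ℚ.* fromℤ n                                ≡⟨ cong (fromℤ u ℚ.*_) (clear-denominator q) ⟨
          fromℤ u ℚ.* (fromℤ (↧ q) ℚ.* q)                    ≡⟨ cong (λ x → fromℤ u ℚ.* (fromℤ (↧ q) ℚ.* x)) q≡ ⟩
          fromℤ u ℚ.* (fromℤ (↧ q) ℚ.* (pℚ p M ℚ.* r))       ≡⟨ solve 4 (λ u d P r → u :* (d :* (P :* r)) := P :* (d :* (u :* r))) refl (fromℤ u) (fromℤ (↧ q)) (pℚ p M) r ⟩
          pℚ p M ℚ.* (fromℤ (↧ q) ℚ.* (fromℤ u ℚ.* r))       ≡⟨ cong (λ x → pℚ p M ℚ.* (fromℤ (↧ q) ℚ.* x)) e ⟩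
          pℚ p M ℚ.* (fromℤ (↧ q) ℚ.* fromℤ z)               ≡⟨ cong (pℚ p M ℚ.*_) (fromℤ-* (↧ q) z) ⟨
          pℚ p M ℚ.* fromℤ (↧ q ℤ.* z)                       ≡⟨ fromℤ-* (+ (p ℕ.^ M)) (↧ q ℤ.* z) ⟨
          fromℤ (+ (p ℕ.^ M) ℤ.* (↧ q ℤ.* z))                ∎))

    inverse-mod-p : ∀ u → ¬ (p ∣ ∣ u ∣) → ∃[ v ] ∃[ k ] (u ℤ.* v ≡ + 1 ℤ.+ + p ℤ.* k)
    inverse-mod-p (+ n) p∤n with Coprime.coprime-Bézout (Coprime.sym {n} {p} coprime)
      where
      coprime : Coprime n p
      coprime (d∣n , d∣p) with prime⇒irreducible pp d∣p
      ... | inj₁ d≡1 = d≡1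
      ... | inj₂ refl = ⊥-elim (p∤n d∣n)
    ... | Bézout.-+ x y eq = + y , + x , (begin
        + n ℤ.* + y               ≡⟨ ℤₚ.pos-* n y ⟨
        + (n ℕ.* y)               ≡⟨ cong +_ (trans (ℕₚ.*-comm n y) (sym eq)) ⟩
        + (1 ℕ.+ x ℕ.* p)         ≡⟨ cong (λ t → + (1 ℕ.+ t)) (ℕₚ.*-comm x p) ⟩
        + 1 ℤ.+ + (p ℕ.* x)       ≡⟨ cong (ℤ._+_ (+ 1)) (ℤₚ.pos-* p x) ⟩
        + 1 ℤ.+ + p ℤ.* + x       ∎)
      where open ≡-Reasoning
    ... | Bézout.+- x y eq = ℤ.- (+ y) , ℤ.- (+ x) , (begin
        + n ℤ.* (ℤ.- (+ y))                                  ≡⟨ solve 2 (λ n y → n :* (:- y) := con (+ 1) :+ :- (con (+ 1) :+ y :* n)) refl (+ n) (+ y) ⟩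
        + 1 ℤ.+ ℤ.- (+ 1 ℤ.+ + y ℤ.* + n)                    ≡⟨ cong (λ t → + 1 ℤ.+ ℤ.- (+ 1 ℤ.+ t)) (ℤₚ.pos-* y n) ⟨
        + 1 ℤ.+ ℤ.- (+ (1 ℕ.+ y ℕ.* n))                      ≡⟨ cong (λ t → + 1 ℤ.+ ℤ.- (+ t)) eq ⟩
        + 1 ℤ.+ ℤ.- (+ (x ℕ.* p))                            ≡⟨ cong (λ t → + 1 ℤ.+ ℤ.- t) (ℤₚ.pos-* x p) ⟩
        + 1 ℤ.+ ℤ.- (+ x ℤ.* + p)                            ≡⟨ solve 2 (λ x p → con (+ 1) :+ :- (x :* p) := con (+ 1) :+ p :* (:- x)) refl (+ x) (+ p) ⟩
        + 1 ℤ.+ + p ℤ.* (ℤ.- (+ x))                          ∎)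
      where open ≡-Reasoning
            open ℤSolver.+-*-Solver
    inverse-mod-p u@(-[1+ n ]) p∤n with inverse-mod-p (+ suc n) p∤n
    ... | v , k , eq = ℤ.- v , k , trans (solve 2 (λ n v → (:- n) :* (:- v) := n :* v) refl (+ suc n) v) eq
      where open ℤSolver.+-*-Solver

    private
      divide-with-remainder : ∀ q P κ ρ τ → (1ℚ ℚ.+ P ℚ.* κ) ℚ.* q ≡ ρ ℚ.+ τ ℚ.* P → q ≡ ρ ℚ.+ P ℚ.* (τ ℚ.- κ ℚ.* q)
      divide-with-remainder q P κ ρ τ eq = begin
        q                                                  ≡⟨ solve 4 (λ q P k i → q := (q :+ P :* k :* q) :- P :* (k :* q)) refl q P κ 1ℚ ⟩
        (q ℚ.+ P ℚ.* κ ℚ.* q) ℚ.- P ℚ.* (κ ℚ.* q)          ≡⟨ cong (λ x → (x ℚ.+ P ℚ.* κ ℚ.* q) ℚ.- P ℚ.* (κ ℚ.* q)) (ℚₚ.*-identityˡ q) ⟨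
        (1ℚ ℚ.* q ℚ.+ P ℚ.* κ ℚ.* q) ℚ.- P ℚ.* (κ ℚ.* q)   ≡⟨ cong (ℚ._- P ℚ.* (κ ℚ.* q)) (ℚₚ.*-distribʳ-+ q 1ℚ (P ℚ.* κ)) ⟨
        (1ℚ ℚ.+ P ℚ.* κ) ℚ.* q ℚ.- P ℚ.* (κ ℚ.* q)         ≡⟨ cong (ℚ._- P ℚ.* (κ ℚ.* q)) eq ⟩
        (ρ ℚ.+ τ ℚ.* P) ℚ.- P ℚ.* (κ ℚ.* q)                ≡⟨ solve 4 (λ r t P kq → r :+ t :* P :- P :* kq := r :+ P :* (t :- kq)) refl ρ τ P (κ ℚ.* q) ⟩
        ρ ℚ.+ P ℚ.* (τ ℚ.- κ ℚ.* q)                        ∎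
        where open ≡-Reasoning
              open +-*-Solver

      inverse-mod-p-acts : ∀ {q u v z k r t} → u ℤ.* v ≡ + 1 ℤ.+ + p ℤ.* k → fromℤ u ℚ.* q ≡ fromℤ z → v ℤ.* z ≡ r ℤ.+ t ℤ.* + p →
        (1ℚ ℚ.+ fromℤ (+ p) ℚ.* fromℤ k) ℚ.* q ≡ fromℤ r ℚ.+ fromℤ t ℚ.* fromℤ (+ p)
      inverse-mod-p-acts {q} {u} {v} {z} {k} {r} {t} uv≡ uq≡z vz≡ = begin
        (1ℚ ℚ.+ fromℤ (+ p) ℚ.* fromℤ k) ℚ.* q         ≡⟨ cong (λ x → (1ℚ ℚ.+ x) ℚ.* q) (fromℤ-* (+ p) k) ⟨
        (fromℤ (+ 1) ℚ.+ fromℤ (+ p ℤ.* k)) ℚ.* q      ≡⟨ cong (ℚ._* q) (fromℤ-+ (+ 1) (+ p ℤ.* k)) ⟨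
        fromℤ (+ 1 ℤ.+ + p ℤ.* k) ℚ.* q                ≡⟨ cong (λ x → fromℤ x ℚ.* q) uv≡ ⟨
        fromℤ (u ℤ.* v) ℚ.* q                          ≡⟨ cong (ℚ._* q) (fromℤ-* u v) ⟩
        fromℤ u ℚ.* fromℤ v ℚ.* q                      ≡⟨ solve 3 (λ u v q → u :* v :* q := v :* (u :* q)) refl (fromℤ u) (fromℤ v) q ⟩
        fromℤ v ℚ.* (fromℤ u ℚ.* q)                    ≡⟨ cong (fromℤ v ℚ.*_) uq≡z ⟩
        fromℤ v ℚ.* fromℤ z                            ≡⟨ fromℤ-* v z ⟨
        fromℤ (v ℤ.* z)                                ≡⟨ cong fromℤ vz≡ ⟩
        fromℤ (r ℤ.+ t ℤ.* + p)                        ≡⟨ fromℤ-+ r (t ℤ.* + p) ⟩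
        fromℤ r ℚ.+ fromℤ (t ℤ.* + p)                  ≡⟨ cong (fromℤ r ℚ.+_) (fromℤ-* t (+ p)) ⟩
        fromℤ r ℚ.+ fromℤ t ℚ.* fromℤ (+ p)            ∎
        where open ≡-Reasoning
              open +-*-Solver

      remainder-as-Fin : ∀ z → ∃[ r ] ∃[ t ] (z ≡ + toℕ {p} r ℤ.+ t ℤ.* + p)
      remainder-as-Fin z = Fin.fromℕ< r<p , ℤD._/ℕ_ z p ⦃ nz ⦄ ,
        trans (ℤD.a≡a%ℕn+[a/ℕn]*n z p ⦃ nz ⦄) (cong (λ r → + r ℤ.+ (ℤD._/ℕ_ z p ⦃ nz ⦄) ℤ.* + p) (sym (Finₚ.toℕ-fromℕ< r<p)))
        where
        nz = prime⇒nonZero pp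
        r<p = ℤD.n%ℕd<d z p ⦃ nz ⦄

    -- With u v = 1 + p k and v z = r + t p, the equation u q = z becomes (1 + p k) q = r + t p, so
    -- that q = r + p (t - k q). That the cofactor of p involves `q` itself does no harm, as `q` is
    -- p-integral.
    residue : ∀ {q} → Integral q → ∃[ r ] ∃[ q′ ] (Integral q′ × q ≡ fromℤ (+ toℕ {p} r) ℚ.+ fromℤ (+ p) ℚ.* q′)
    residue {q} int@(integral {u} p∤u z uq≡z) =
      let v , k , uv≡ = inverse-mod-p u p∤u
          r , t , vz≡ = remainder-as-Fin (v ℤ.* z)
      in r , fromℤ t ℚ.- fromℤ k ℚ.* q ,
         integral-+ (integral-fromℤ t) (integral-neg (integral-* (integral-fromℤ k) int)) ,
         divide-with-remainder q (fromℤ (+ p)) (fromℤ k) (fromℤ (+ toℕ r)) (fromℤ t)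
           (inverse-mod-p-acts {u = u} {v} {z} {k} {+ toℕ r} {t} uv≡ uq≡z vz≡)

    same-residue : ∀ {q r} (Iq : Integral q) (Ir : Integral r) → proj₁ (residue Iq) ≡ proj₁ (residue Ir) →
      ∃[ d ] (Integral d × q ℚ.- r ≡ fromℤ (+ p) ℚ.* d)
    same-residue Iq Ir eq = same (proj₂ (residue Iq)) (proj₂ (residue Ir)) eq
      where
      difference : ∀ {q r} x P q′ r′ → q ≡ x ℚ.+ P ℚ.* q′ → r ≡ x ℚ.+ P ℚ.* r′ → q ℚ.- r ≡ P ℚ.* (q′ ℚ.- r′)
      difference x P q′ r′ refl refl = solve 4 (λ x P q r → (x :+ P :* q) :- (x :+ P :* r) := P :* (q :- r)) refl x P q′ r′
        where open +-*-Solver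
      Expansion : ℚ → Fin p → Set
      Expansion q ρ = ∃[ q′ ] (Integral q′ × q ≡ fromℤ (+ toℕ ρ) ℚ.+ fromℤ (+ p) ℚ.* q′)
      same : ∀ {q r ρ σ} → Expansion q ρ → Expansion r σ → ρ ≡ σ → ∃[ d ] (Integral d × q ℚ.- r ≡ fromℤ (+ p) ℚ.* d)
      same {ρ = ρ} (q′ , Iq′ , e) (r′ , Ir′ , e′) refl =
        q′ ℚ.- r′ , integral-+ Iq′ (integral-neg Ir′) , difference (fromℤ (+ toℕ ρ)) (fromℤ (+ p)) q′ r′ e e′

    pℚ≢0 : ∀ M → pℚ p M ≢ 0ℚ
    pℚ≢0 M eq with fromℤ-nonZero {+ (p ℕ.^ M)} eq
    ... | e = ℕ.≢-nonZero⁻¹ (p ℕ.^ M) ⦃ ℕₚ.m^n≢0 p M ⦃ prime⇒nonZero pp ⦄ ⦄ (ℤₚ.+-injective e)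

    divide-by : ∀ P q t → P ≢ 0ℚ → ¬ (p ∣ ↧ₙ q) → fromℤ (↥ q) ≡ fromℤ t ℚ.* P → ∃[ r ] (Integral r × q ≡ P ℚ.* r)
    divide-by P q t P≢0 p∤d eq = let P⁻¹ , inv = inverse P P≢0 in P⁻¹ ℚ.* q , integral {u = ↧ q} p∤d t (begin
        fromℤ (↧ q) ℚ.* (P⁻¹ ℚ.* q)      ≡⟨ solve 3 (λ a b c → a :* (b :* c) := b :* (a :* c)) refl (fromℤ (↧ q)) P⁻¹ q ⟩
        P⁻¹ ℚ.* (fromℤ (↧ q) ℚ.* q)      ≡⟨ cong (P⁻¹ ℚ.*_) (trans (clear-denominator q) eq) ⟩
        P⁻¹ ℚ.* (fromℤ t ℚ.* P)          ≡⟨ solve 3 (λ i t P → i :* (t :* P) := (i :* P) :* t) refl P⁻¹ (fromℤ t) P ⟩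
        P⁻¹ ℚ.* P ℚ.* fromℤ t            ≡⟨ cong (ℚ._* fromℤ t) inv ⟩
        1ℚ ℚ.* fromℤ t                   ≡⟨ ℚₚ.*-identityˡ _ ⟩
        fromℤ t                          ∎) , (begin
        q                                ≡⟨ ℚₚ.*-identityˡ q ⟨
        1ℚ ℚ.* q                         ≡⟨ cong (ℚ._* q) inv ⟨
        P⁻¹ ℚ.* P ℚ.* q                  ≡⟨ solve 3 (λ i P q → i :* P :* q := P :* (i :* q)) refl P⁻¹ P q ⟩
        P ℚ.* (P⁻¹ ℚ.* q)                ∎)
      where
      open ≡-Reasoning
      open +-*-Solver

    -- The exponent is positive on purpose: then `p` divides the numerator, hence not the
    -- denominator, and the quotient by the power of `p` is p-integral. This is the origin of the
    -- shift by one in `CloseInteger U a (suc M)`.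
    divisible-numerator : ∀ q M → p ℕ.^ suc M ∣ ∣ ↥ q ∣ → ∃[ r ] (Integral r × q ≡ pℚ p (suc M) ℚ.* r)
    divisible-numerator q M d = let ℤ∣.divides t eq = ℤ∣.∣ᵤ⇒∣ {+ (p ℕ.^ suc M)} {↥ q} d in
      divide-by (pℚ p (suc M)) q t (pℚ≢0 (suc M)) (p∤denominator q (m*n∣⇒m∣ p (p ℕ.^ M) d))
        (trans (cong fromℤ eq) (fromℤ-* t (+ (p ℕ.^ suc M))))

    divisible-integer : ∀ N M r → Integral r → fromℤ N ≡ pℚ p M ℚ.* r → ∃[ t ] (N ≡ + (p ℕ.^ M) ℤ.* t)
    divisible-integer N M r (integral {u} p∤u z e) eq =
      let ℤ∣.divides t e' = ℤ∣.∣ᵤ⇒∣ {+ (p ℕ.^ M)} {N} (prime-power-cancel pp M p∤u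
             (subst (p ℕ.^ M ∣_) (trans (cong ∣_∣ key) (ℤₚ.abs-* u N)) (subst (p ℕ.^ M ∣_) (sym (ℤₚ.abs-* (+ (p ℕ.^ M)) z)) (m∣m*n _))))
      in t , trans e' (ℤₚ.*-comm t (+ (p ℕ.^ M)))
      where
      open ≡-Reasoning
      open +-*-Solver
      key : + (p ℕ.^ M) ℤ.* z ≡ u ℤ.* N
      key = fromℤ-injective (begin
        fromℤ (+ (p ℕ.^ M) ℤ.* z)           ≡⟨ fromℤ-* (+ (p ℕ.^ M)) z ⟩
        pℚ p M ℚ.* fromℤ z                  ≡⟨ cong (pℚ p M ℚ.*_) e ⟨
        pℚ p M ℚ.* (fromℤ u ℚ.* r)          ≡⟨ solve 3 (λ P u r → P :* (u :* r) := u :* (P :* r)) refl (pℚ p M) (fromℤ u) r ⟩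
        fromℤ u ℚ.* (pℚ p M ℚ.* r)          ≡⟨ cong (fromℤ u ℚ.*_) eq ⟨
        fromℤ u ℚ.* fromℤ N                 ≡⟨ fromℤ-* u N ⟨
        fromℤ (u ℤ.* N)                     ∎)

    νₚ≥⇒divisible : ∀ q M → (+ suc M) ≤∞ νₚ p q → ∃[ r ] (Integral r × q ≡ pℚ p (suc M) ℚ.* r)
    νₚ≥⇒divisible q M le = divisible-numerator q M (νₚ≥⇒∣numerator p q (suc M) le)

open Rationals

-- Integers p-adically close to a.

module _ {p} (pp : Prime p) where
  open PIntegral pp

  record CloseInteger (U : ℤ → ℚ) (a : ℚ) (M : ℕ) : Set where
    field
      N           : ℤ
      {u d}       : ℚ
      u-integral  : Integral u
      d-integral  : Integral d
      UN≡         : U N ≡ pℚ p M ℚ.* u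
      N-a≡        : fromℤ N ℚ.- a ≡ pℚ p M ℚ.* d

    a-integral : Integral a
    a-integral = subst Integral (a≡ (fromℤ N) N-a≡)
      (integral-+ (integral-fromℤ N) (integral-neg (integral-* (integral-fromℤ (+ (p ℕ.^ M))) d-integral)))
      where
      a≡ : ∀ N {P} → N ℚ.- a ≡ P → N ℚ.- P ≡ a
      a≡ N ≡.refl = solve 2 (λ N a → N :- (N :- a) := a) ≡.refl N a
        where open +-*-Solver

    -- With a = k/d, the integer d N - k = d (N - a) is p^M times a p-integral number, hence a
    -- multiple of p^M in ℤ. This turns closeness to `a` into a congruence between exponents.
    exponent-difference : ∃[ t ] (↧ a ℤ.* N ≡ ↥ a ℤ.+ + (p ℕ.^ M) ℤ.* t)
    exponent-difference = let t , eq = divisible-integer (↧ a ℤ.* N ℤ.- ↥ a) M (fromℤ (↧ a) ℚ.* d) (integral-* (integral-fromℤ (↧ a)) d-integral) scaled in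
      t , ≡.trans (x≡y+[x-y] (↧ a ℤ.* N) (↥ a)) (cong (ℤ._+_ (↥ a)) eq)
      where
      x≡y+[x-y] : ∀ x y → x ≡ y ℤ.+ (x ℤ.- y)
      x≡y+[x-y] = ℤSolver.+-*-Solver.solve 2 (λ x y → x ℤSolver.+-*-Solver.:= y ℤSolver.+-*-Solver.:+ (x ℤSolver.+-*-Solver.:- y)) ≡.refl
      rearrange : ∀ l N a {P d} → N ℚ.- a ≡ P ℚ.* d → l ℚ.* N ℚ.- l ℚ.* a ≡ P ℚ.* (l ℚ.* d)
      rearrange l N a {P} {d} eq = ≡.trans (solve 3 (λ l N a → l :* N :- l :* a := l :* (N :- a)) ≡.refl l N a)
        (≡.trans (cong (l ℚ.*_) eq) (solve 3 (λ l P d → l :* (P :* d) := P :* (l :* d)) ≡.refl l P d))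
        where open +-*-Solver
      scaled : fromℤ (↧ a ℤ.* N ℤ.- ↥ a) ≡ pℚ p M ℚ.* (fromℤ (↧ a) ℚ.* d)
      scaled = ≡.trans (fromℤ-+ (↧ a ℤ.* N) (ℤ.- ↥ a)) (≡.trans (cong₂ ℚ._+_ (fromℤ-* (↧ a) N) (fromℤ-neg (↥ a)))
        (≡.trans (cong (λ x → fromℤ (↧ a) ℚ.* fromℤ N ℚ.- x) (≡.sym (clear-denominator a))) (rearrange (fromℤ (↧ a)) (fromℤ N) a {pℚ p M} {d} N-a≡)))

  close-integers : ∀ {U a} (n : ℕ → ℤ) → TendsTo∞ (λ k → νₚ p (U (n k))) → TendsTo∞ (λ k → νₚ p (fromℤ (n k) ℚ.- a)) → ∀ M → CloseInteger U a (suc M)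
  close-integers {U} {a} n U→0 n→a M =
    let k₁ , h₁ = U→0 (+ suc M)
        k₂ , h₂ = n→a (+ suc M)
        k = k₁ ℕ.⊔ k₂
        u , Iu , eu = νₚ≥⇒divisible (U (n k)) M (h₁ k (ℕₚ.m≤m⊔n k₁ k₂))
        d , Id , ed = νₚ≥⇒divisible (fromℤ (n k) ℚ.- a) M (h₂ k (ℕₚ.m≤n⊔m k₁ k₂))
    in record { N = n k ; u-integral = Iu ; d-integral = Id ; UN≡ = eu ; N-a≡ = ed }

-- Abstract because elimination runs over two rings: the p-integral rationals, to preserve the
-- divisibility of coefficients, and ℚ itself, to bound the length of a chain of subspaces.
record IsValuationRing (O : Pred ℚ 0ℓ) : Set where
  field
    neg-closed : ∀ {q} → O q → O (ℚ.- q)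
    total      : ∀ b c → (∃[ q ] (O q × b ≡ q ℚ.* c)) ⊎ (∃[ q ] (O q × c ≡ q ℚ.* b))

record IsSubmodule (O I : Pred ℚ 0ℓ) : Set where
  field
    +-closed : ∀ {q r} → I q → I r → I (q ℚ.+ r)
    absorbs  : ∀ {q r} → O q → I r → I (q ℚ.* r)

module Theory {c ℓ} (K : AlgClosedField c ℓ) (E : QEmbedding K) where
  open AlgClosedField K using (1≉0; ⁻¹-inverse; algClosed; _⁻¹; eval; _^_; _^ℤ_; ∑; IsRootOfUnity)
  open QEmbedding E

  K-ring : CommutativeRing c ℓ
  K-ring = record { isCommutativeRing = AlgClosedField.isCommutativeRing K }

  open CommutativeRing K-ring hiding (zero) renaming (refl to ≈-refl; sym to ≈-sym; trans to ≈-trans; reflexive to ≈-reflexive)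
  open SetoidReasoning setoid

  ι-cong : ∀ {q r} → q ≡ r → ι q ≈ ι r
  ι-cong ≡.refl = ≈-refl

  ι-neg : ∀ q → ι (ℚ.- q) ≈ - ι q
  ι-neg q = (RingProperties.+-inverseʳ-unique ring (ι q) (ι (ℚ.- q)) (begin
    ι q + ι (ℚ.- q)   ≈⟨ ι-+ q (ℚ.- q) ⟨
    ι (q ℚ.- q)       ≈⟨ ι-cong (ℚₚ.+-inverseʳ q) ⟩
    ι 0ℚ              ≈⟨ ι-0 ⟩
    0#                ∎)) 

  -- ι on integers, except that 0 and 1 go to 0# and 1# definitionally, so that the solver's constants match them.
  private
    φ : ℤ → Carrier
    φ (+ 0) = 0#
    φ (+ 1) = 1#
    φ z     = ι (fromℤ z)

    φ≈ι : ∀ z → φ z ≈ ι (fromℤ z)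
    φ≈ι (+ 0)             = ≈-sym ι-0
    φ≈ι (+ 1)             = ≈-sym ι-1
    φ≈ι (+ suc (suc n))   = ≈-refl
    φ≈ι -[1+ n ]          = ≈-refl

    φ-homo : (ℤ.+-*-rawRing) ACR.-Raw-AlmostCommutative⟶ ACR.fromCommutativeRing K-ring
    φ-homo = record
      { ⟦_⟧ = φ
      ; +-homo = λ x y → begin
          φ (x ℤ.+ y)                ≈⟨ φ≈ι (x ℤ.+ y) ⟩
          ι (fromℤ (x ℤ.+ y))        ≈⟨ ι-cong (fromℤ-+ x y) ⟩
          ι (fromℤ x ℚ.+ fromℤ y)    ≈⟨ ι-+ (fromℤ x) (fromℤ y) ⟩
          ι (fromℤ x) + ι (fromℤ y)  ≈⟨ +-cong (φ≈ι x) (φ≈ι y) ⟨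
          φ x + φ y                  ∎
      ; *-homo = λ x y → begin
          φ (x ℤ.* y)                ≈⟨ φ≈ι (x ℤ.* y) ⟩
          ι (fromℤ (x ℤ.* y))        ≈⟨ ι-cong (fromℤ-* x y) ⟩
          ι (fromℤ x ℚ.* fromℤ y)    ≈⟨ ι-* (fromℤ x) (fromℤ y) ⟩
          ι (fromℤ x) * ι (fromℤ y)  ≈⟨ *-cong (φ≈ι x) (φ≈ι y) ⟨
          φ x * φ y                  ∎
      ; -‿homo = λ x → begin
          φ (ℤ.- x)                  ≈⟨ φ≈ι (ℤ.- x) ⟩
          ι (fromℤ (ℤ.- x))          ≈⟨ ι-cong (fromℤ-neg x) ⟩
          ι (ℚ.- fromℤ x)            ≈⟨ ι-neg (fromℤ x) ⟩
          - ι (fromℤ x)              ≈⟨ -‿cong (φ≈ι x) ⟨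
          - φ x                      ∎
      ; 0-homo = ≈-refl
      ; 1-homo = ≈-refl
      }

    weak-dec : ∀ x y → Maybe (φ x ≈ φ y)
    weak-dec x y with x ℤ.≟ y
    ... | yes ≡.refl = just ≈-refl
    ... | no _ = nothing

  open RingSolver ℤ.+-*-rawRing (ACR.fromCommutativeRing K-ring) φ-homo weak-dec
    using (solve; _:=_; _:+_; _:*_; :-_; _:-_; con)

  -- Rational linear combinations and elimination over valuation rings.

  comb : ∀ {n} → Vec ℚ n → Vec Carrier n → Carrier
  comb []       []       = 0#
  comb (c ∷ cs) (g ∷ gs) = ι c * g + comb cs gs

  comb-zero : ∀ {n} {cs : Vec ℚ n} gs → VAll.All (_≡ 0ℚ) cs → comb cs gs ≈ 0#
  comb-zero []       []              = ≈-refl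
  comb-zero {cs = _ ∷ cs} (g ∷ gs) (≡.refl ∷ zs) = begin
    ι 0ℚ * g + comb cs gs  ≈⟨ +-cong (*-congʳ ι-0) (comb-zero gs zs) ⟩
    0# * g + 0#            ≈⟨ solve 1 (λ g → con (+ 0) :* g :+ con (+ 0) := con (+ 0)) ≈-refl g ⟩
    0#                     ∎

  ι-sub : ∀ q r → ι (q ℚ.- r) ≈ ι q - ι r
  ι-sub q r = ≈-trans (ι-+ q (ℚ.- r)) (+-congˡ (ι-neg r))

  ι-+-* : ∀ x q y → ι (x ℚ.+ (ℚ.- q) ℚ.* y) ≈ ι x + (- ι q) * ι y
  ι-+-* x q y = ≈-trans (ι-+ x _) (+-congˡ (≈-trans (ι-* (ℚ.- q) y) (*-congʳ (ι-neg q))))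

  comb-sub : ∀ {n} (cs ds : Vec ℚ n) gs → comb (Vec.zipWith ℚ._-_ cs ds) gs ≈ comb cs gs - comb ds gs
  comb-sub []       []       []       = ≈-sym (-‿inverseʳ 0#)
  comb-sub (c ∷ cs) (d ∷ ds) (g ∷ gs) = begin
    ι (c ℚ.- d) * g + comb (Vec.zipWith ℚ._-_ cs ds) gs   ≈⟨ +-cong (*-congʳ (ι-sub c d)) (comb-sub cs ds gs) ⟩
    (ι c - ι d) * g + (comb cs gs - comb ds gs)           ≈⟨ solve 5 (λ c d g x y → (c :- d) :* g :+ (x :- y) := c :* g :+ x :- (d :* g :+ y)) ≈-refl (ι c) (ι d) g (comb cs gs) (comb ds gs) ⟩
    ι c * g + comb cs gs - (ι d * g + comb ds gs)         ∎

  module Functions (T : Set) where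

    V : Set c
    V = T → Carrier

    combV : ∀ {n} → Vec ℚ n → Vec V n → V
    combV cs gs t = comb cs (Vec.map (λ g → g t) gs)

    record Subspace w : Set (c ⊔ ℓ ⊔ lsuc w) where
      field
        _∋_     : V → Set w
        resp    : ∀ {u v} → (∀ t → u t ≈ v t) → _∋_ u → _∋_ v
        +-mem   : ∀ {u v} → _∋_ u → _∋_ v → _∋_ (λ t → u t + v t)
        scale   : ∀ {v} q → _∋_ v → _∋_ (λ t → ι q * v t)

      neg-mem : ∀ {v} → _∋_ v → _∋_ (λ t → - v t)
      neg-mem {v} h = resp (λ t → begin
        ι (ℚ.- 1ℚ) * v t    ≈⟨ *-congʳ (ι-neg 1ℚ) ⟩
        (- ι 1ℚ) * v t      ≈⟨ *-congʳ (-‿cong ι-1) ⟩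
        (- 1#) * v t        ≈⟨ solve 1 (λ v → :- con (+ 1) :* v := :- v) ≈-refl (v t) ⟩
        - v t               ∎) (scale (ℚ.- 1ℚ) h)

      unscale : ∀ {v} q → q ≢ 0ℚ → _∋_ (λ t → ι q * v t) → _∋_ v
      unscale {v} q q≢0 h = let r , rq≡1 = inverse q q≢0 in resp (λ t → begin
        ι r * (ι q * v t)   ≈⟨ *-assoc (ι r) (ι q) (v t) ⟨
        ι r * ι q * v t     ≈⟨ *-congʳ (ι-* r q) ⟨
        ι (r ℚ.* q) * v t   ≈⟨ *-congʳ (≈-trans (ι-cong rq≡1) ι-1) ⟩
        1# * v t            ≈⟨ *-identityˡ (v t) ⟩
        v t                 ∎) (scale r h)

    module Elimination {O : Pred ℚ 0ℓ} (isValuationRing : IsValuationRing O) where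
      open IsValuationRing isValuationRing

      -- A change of generators over `O` that turns the combination with coefficients `bs` into a
      -- multiple of one generator. In `respan` the submodule `I` is arbitrary, so that coefficients
      -- divisible by a power of p remain so; an approximation keeps its precision when a generator
      -- is dropped.
      record Eliminated {n} (gs : Vec V (suc n)) (bs : Vec ℚ (suc n)) : Set (c ⊔ ℓ ⊔ lsuc 0ℓ) where
        field
          pivot      : V
          rest       : Vec V n
          b          : ℚ
          comb≈pivot : ∀ t → combV bs gs t ≈ ι b * pivot t
          b≡0⇒       : b ≡ 0ℚ → VAll.All (_≡ 0ℚ) bs
          respan     : ∀ {I} → IsSubmodule O I → ∀ {cs} → VAll.All I cs →
                       ∃[ d ] ∃[ ds ] (I d × VAll.All I ds × (∀ t → combV cs gs t ≈ ι d * pivot t + combV ds rest t))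

      -- Euclid's algorithm, which over a valuation ring takes one step per generator: of two
      -- coefficients one divides the other, and b₀ g + b h is the dividing one times a new
      -- generator.
      eliminate : ∀ {n} (gs : Vec V (suc n)) bs → Eliminated gs bs
      eliminate (g ∷ []) (b ∷ []) = record
        { pivot = g ; rest = [] ; b = b
        ; comb≈pivot = λ t → +-identityʳ (ι b * g t)
        ; b≡0⇒ = λ e → e ∷ []
        ; respan = λ { _ (i ∷ []) → _ , [] , i , [] , λ t → ≈-refl }
        }
      eliminate (g ∷ gs@(_ ∷ _)) (b₀ ∷ bs) with eliminate gs bs
      ... | record { pivot = h ; rest = rest ; b = b ; comb≈pivot = eq ; b≡0⇒ = z ; respan = sp } with total b₀ b
      ... | inj₁ (q , Oq , b₀≡qb) = record
        { pivot = λ t → h t + ι q * g t ; rest = g ∷ rest ; b = b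
        ; comb≈pivot = λ t → begin
            ι b₀ * g t + combV bs gs t        ≈⟨ +-cong (*-congʳ (≈-trans (ι-cong b₀≡qb) (ι-* q b))) (eq t) ⟩
            ι q * ι b * g t + ι b * h t       ≈⟨ solve 4 (λ q b g h → q :* b :* g :+ b :* h := b :* (h :+ q :* g)) ≈-refl (ι q) (ι b) (g t) (h t) ⟩
            ι b * (h t + ι q * g t)           ∎
        ; b≡0⇒ = λ e → ≡.trans b₀≡qb (≡.trans (cong (q ℚ.*_) e) (ℚₚ.*-zeroʳ q)) ∷ z e
        ; respan = λ { sub {c₀ ∷ cs} (i ∷ is) → let open IsSubmodule sub ; d , ds , Id , Ids , e = sp sub is in
            d , (c₀ ℚ.+ (ℚ.- q) ℚ.* d) ∷ ds , Id , +-closed i (absorbs (neg-closed Oq) Id) ∷ Ids , λ t → begin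
              ι c₀ * g t + combV cs gs t                                               ≈⟨ +-congˡ (e t) ⟩
              ι c₀ * g t + (ι d * h t + combV ds rest t)                               ≈⟨ solve 6 (λ c g d h x q → c :* g :+ (d :* h :+ x) := d :* (h :+ q :* g) :+ ((c :+ (:- q) :* d) :* g :+ x)) ≈-refl (ι c₀) (g t) (ι d) (h t) (combV ds rest t) (ι q) ⟩
              ι d * (h t + ι q * g t) + ((ι c₀ + (- ι q) * ι d) * g t + combV ds rest t)  ≈⟨ +-congˡ (+-congʳ (*-congʳ (ι-+-* c₀ q d))) ⟨
              ι d * (h t + ι q * g t) + (ι (c₀ ℚ.+ (ℚ.- q) ℚ.* d) * g t + combV ds rest t) ∎ }
        }
      ... | inj₂ (q , Oq , b≡qb₀) = record
        { pivot = λ t → g t + ι q * h t ; rest = h ∷ rest ; b = b₀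
        ; comb≈pivot = λ t → begin
            ι b₀ * g t + combV bs gs t             ≈⟨ +-congˡ (≈-trans (eq t) (*-congʳ (≈-trans (ι-cong b≡qb₀) (ι-* q b₀)))) ⟩
            ι b₀ * g t + ι q * ι b₀ * h t          ≈⟨ solve 4 (λ q b g h → b :* g :+ q :* b :* h := b :* (g :+ q :* h)) ≈-refl (ι q) (ι b₀) (g t) (h t) ⟩
            ι b₀ * (g t + ι q * h t)               ∎
        ; b≡0⇒ = λ e → e ∷ z (≡.trans b≡qb₀ (≡.trans (cong (q ℚ.*_) e) (ℚₚ.*-zeroʳ q)))
        ; respan = λ { sub {c₀ ∷ cs} (i ∷ is) → let open IsSubmodule sub ; d , ds , Id , Ids , e = sp sub is in
            c₀ , (d ℚ.+ (ℚ.- q) ℚ.* c₀) ∷ ds , i , +-closed Id (absorbs (neg-closed Oq) i) ∷ Ids , λ t → begin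
              ι c₀ * g t + combV cs gs t                                               ≈⟨ +-congˡ (e t) ⟩
              ι c₀ * g t + (ι d * h t + combV ds rest t)                               ≈⟨ solve 6 (λ c g d h x q → c :* g :+ (d :* h :+ x) := c :* (g :+ q :* h) :+ ((d :+ (:- q) :* c) :* h :+ x)) ≈-refl (ι c₀) (g t) (ι d) (h t) (combV ds rest t) (ι q) ⟩
              ι c₀ * (g t + ι q * h t) + ((ι d + (- ι q) * ι c₀) * h t + combV ds rest t)  ≈⟨ +-congˡ (+-congʳ (*-congʳ (ι-+-* d q c₀))) ⟨
              ι c₀ * (g t + ι q * h t) + (ι (d ℚ.+ (ℚ.- q) ℚ.* c₀) * h t + combV ds rest t) ∎ }
        }

      module Separation {w} (W : Subspace w) (I : ℕ → Pred ℚ 0ℓ) (I-submodule : ∀ M → IsSubmodule O (I M))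
                        (I-separated : ∀ q → q ≢ 0ℚ → ∃[ M ] (¬ I M q)) where
        open Subspace W

        private
          -- The entries of `cs` are rational, so a first nonzero one can be found. It lies outside
          -- `I M` for some `M`, and no `ds` with entries in `I M` agrees with `cs` there.
          nonzero-difference : ∀ {n} (cs : Vec ℚ n) → VAll.All (_≡ 0ℚ) cs ⊎
            ∃[ M ] (∀ ds → VAll.All (I M) ds → ¬ VAll.All (_≡ 0ℚ) (Vec.zipWith ℚ._-_ cs ds))
          nonzero-difference [] = inj₁ []
          nonzero-difference (c ∷ cs) with c ℚₚ.≟ 0ℚ
          ... | no c≢0 = let M , c∉I = I-separated c c≢0 in
                inj₂ (M , λ { (d ∷ ds) (Id ∷ _) (c-d≡0 ∷ _) → c∉I (subst (I M) (≡.sym (p-q≡0⇒p≡q c d c-d≡0)) Id) })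
            where
            p-q≡0⇒p≡q : ∀ p q → p ℚ.- q ≡ 0ℚ → p ≡ q
            p-q≡0⇒p≡q p q = RingProperties.x∙y⁻¹≈ε⇒x≈y (CommutativeRing.ring ℚₚ.+-*-commutativeRing) p q
          ... | yes c≡0 with nonzero-difference cs
          ...   | inj₁ cs≡0 = inj₁ (c≡0 ∷ cs≡0)
          ...   | inj₂ (M , h) = inj₂ (M , λ { (d ∷ ds) (_ ∷ Ids) (_ ∷ zs) → h ds Ids zs })

        -- Comparing two approximations of x gives a nontrivial relation between the generators modulo W, which eliminates
        -- one of them; no decision about linear independence in V is needed.
        separation : ∀ {n} (gs : Vec V n) (x : V) →
          (∀ M → ∃[ cs ] (VAll.All (I M) cs × _∋_ (λ t → x t - combV cs gs t))) → _∋_ x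
        separation [] x approx with approx 0
        ... | [] , _ , h = resp (λ t → solve 1 (λ x → x :- con (+ 0) := x) ≈-refl (x t)) h
        separation gs@(_ ∷ _) x approx with approx 0
        ... | cs , _ , h with nonzero-difference cs
        ...   | inj₁ cs≡0 = resp (λ t → ≈-trans (+-congˡ (-‿cong (comb-zero _ cs≡0))) (solve 1 (λ x → x :- con (+ 0) := x) ≈-refl (x t))) h
        ...   | inj₂ (M , nz) = separation rest x approx′
          where
          ds = proj₁ (approx M)
          open Eliminated (eliminate gs (Vec.zipWith ℚ._-_ cs ds))
          W∋comb : _∋_ (combV (Vec.zipWith ℚ._-_ cs ds) gs)
          W∋comb = resp (λ t → begin
            (x t - combV ds gs t) + - (x t - combV cs gs t)   ≈⟨ solve 3 (λ x c d → (x :- d) :- (x :- c) := c :- d) ≈-refl (x t) (combV cs gs t) (combV ds gs t) ⟩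
            combV cs gs t - combV ds gs t                     ≈⟨ comb-sub cs ds _ ⟨
            combV (Vec.zipWith ℚ._-_ cs ds) gs t              ∎)
            (+-mem (proj₂ (proj₂ (approx M))) (neg-mem h))
          W∋pivot : _∋_ pivot
          W∋pivot = unscale b (λ b≡0 → nz ds (proj₁ (proj₂ (approx M))) (b≡0⇒ b≡0)) (resp comb≈pivot W∋comb)
          approx′ : ∀ M → ∃[ cs ] (VAll.All (I M) cs × _∋_ (λ t → x t - combV cs rest t))
          approx′ M = let cs , Ics , h = approx M ; d , ds , _ , Ids , e = respan (I-submodule M) Ics in
            ds , Ids , resp (λ t → begin
              (x t - combV cs gs t) + ι d * pivot t                          ≈⟨ +-congʳ (+-congˡ (-‿cong (e t))) ⟩
              (x t - (ι d * pivot t + combV ds rest t)) + ι d * pivot t      ≈⟨ solve 3 (λ x y z → (x :- (y :+ z)) :+ y := x :- z) ≈-refl (x t) (ι d * pivot t) (combV ds rest t) ⟩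
              x t - combV ds rest t                                          ∎)
              (+-mem h (scale d W∋pivot))

    module _ where
      private
        ℚ-isValuationRing : IsValuationRing (λ _ → ⊤)
        ℚ-isValuationRing = record
          { neg-closed = λ _ → tt ; total = ratio }
          where
          ratio : ∀ b c → _
          ratio b c with c ℚₚ.≟ 0ℚ
          ... | yes ≡.refl = inj₂ (0ℚ , tt , ≡.sym (ℚₚ.*-zeroˡ b))
          ... | no c≢0 = let c⁻¹ , inv = inverse c c≢0 in
            inj₁ (b ℚ.* c⁻¹ , tt , ≡.sym (≡.trans (ℚₚ.*-assoc b c⁻¹ c) (≡.trans (cong (b ℚ.*_) inv) (ℚₚ.*-identityʳ b))))

        ⊤-submodule : IsSubmodule (λ _ → ⊤) (λ _ → ⊤)
        ⊤-submodule = record { +-closed = λ _ _ → tt ; absorbs = λ _ _ → tt }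

      open Elimination ℚ-isValuationRing

      -- A strictly increasing chain of subspaces, in which v j witnesses W j ≠ W (j + 1), has length at most n.
      chain-stops : ∀ {w n} (gs : Vec V n) (W : ℕ → Subspace w) (v : ℕ → V) →
        let module W j = Subspace (W j) in
        (∀ j {u} → W._∋_ j u → W._∋_ (suc j) u) → (∀ j → W._∋_ (suc j) (v j)) →
        (∀ j → ∃[ cs ] W._∋_ 0 (λ t → v j t - combV cs gs t)) → ∃[ j ] (j ℕ.≤ n × W._∋_ j (v j))
      chain-stops [] W v mono mem span with span 0
      ... | [] , h = 0 , z≤n , Subspace.resp (W 0) (λ t → solve 1 (λ x → x :- con (+ 0) := x) ≈-refl (v 0 t)) h
      chain-stops {w} {suc n} gs@(_ ∷ _) W v mono mem span with VAll.all? (ℚₚ._≟ 0ℚ) (proj₁ (span 0))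
      ... | yes cs≡0 = 0 , z≤n , Subspace.resp (W 0) (λ t → ≈-trans (+-congˡ (-‿cong (comb-zero _ cs≡0))) (solve 1 (λ x → x :- con (+ 0) := x) ≈-refl (v 0 t))) (proj₂ (span 0))
      ... | no cs≢0 = let j , j≤n , h = chain-stops rest (W ∘ suc) (v ∘ suc) (mono ∘ suc) (mem ∘ suc) span′ in
            suc j , s≤s j≤n , h
        where
        open Eliminated (eliminate gs (proj₁ (span 0)))
        module W₁ = Subspace (W 1)
        -- `v 0` lies in `W 1`, and so does its difference from the combination; hence so do the
        -- combination and, after division by b ≠ 0, the pivot. The chain starting at `W 1` thus
        -- needs one generator fewer.
        W₁∋pivot : W₁._∋_ pivot
        W₁∋pivot = W₁.unscale b (cs≢0 ∘ b≡0⇒) (W₁.resp (λ t → ≈-trans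
          (solve 2 (λ v x → v :- (v :- x) := x) ≈-refl (v 0 t) (combV (proj₁ (span 0)) gs t)) (comb≈pivot t))
          (W₁.+-mem (mem 0) (W₁.neg-mem (mono 0 (proj₂ (span 0))))))
        span′ : ∀ j → ∃[ cs ] W₁._∋_ (λ t → v (suc j) t - combV cs rest t)
        span′ j = let cs , h = span (suc j) ; d , ds , _ , _ , e = respan ⊤-submodule {cs} (VAll.universal (λ _ → tt) cs) in
          ds , W₁.resp (λ t → begin
            (v (suc j) t - combV cs gs t) + ι d * pivot t                       ≈⟨ +-congʳ (+-congˡ (-‿cong (e t))) ⟩
            (v (suc j) t - (ι d * pivot t + combV ds rest t)) + ι d * pivot t   ≈⟨ solve 3 (λ x y z → (x :- (y :+ z)) :+ y := x :- z) ≈-refl (v (suc j) t) (ι d * pivot t) (combV ds rest t) ⟩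
            v (suc j) t - combV ds rest t                                       ∎)
            (W₁.+-mem (mono 0 h) (W₁.scale d W₁∋pivot))

  -- Powers, polynomials and finite sums in the field.

  ^-cong : ∀ {x y} n → x ≈ y → x ^ n ≈ y ^ n
  ^-cong zero    x≈y = ≈-refl
  ^-cong (suc n) x≈y = *-cong x≈y (^-cong n x≈y)

  ^-+ : ∀ x m n → x ^ (m ℕ.+ n) ≈ x ^ m * x ^ n
  ^-+ x zero    n = ≈-sym (*-identityˡ _)
  ^-+ x (suc m) n = ≈-trans (*-congˡ (^-+ x m n)) (≈-sym (*-assoc x _ _))

  *-^ : ∀ x y n → (x * y) ^ n ≈ x ^ n * y ^ n
  *-^ x y zero    = ≈-sym (*-identityˡ 1#)
  *-^ x y (suc n) = ≈-trans (*-congˡ (*-^ x y n))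
    (solve 4 (λ x y a b → (x :* y) :* (a :* b) := (x :* a) :* (y :* b)) ≈-refl x y (x ^ n) (y ^ n))

  ^-* : ∀ x m n → x ^ (m ℕ.* n) ≈ (x ^ n) ^ m
  ^-* x zero    n = ≈-refl
  ^-* x (suc m) n = ≈-trans (^-+ x n (m ℕ.* n)) (*-congˡ (^-* x m n))

  ^-*′ : ∀ x m n → x ^ (m ℕ.* n) ≈ (x ^ m) ^ n
  ^-*′ x m n = ≈-trans (≈-reflexive (cong (x ^_) (ℕₚ.*-comm m n))) (^-* x n m)

  1^ : ∀ n → 1# ^ n ≈ 1#
  1^ zero    = ≈-refl
  1^ (suc n) = ≈-trans (*-identityˡ _) (1^ n)

  ^-inverse : ∀ {x y} n → x * y ≈ 1# → x ^ n * y ^ n ≈ 1#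
  ^-inverse {x} {y} n xy≈1 = ≈-trans (≈-sym (*-^ x y n)) (≈-trans (^-cong n xy≈1) (1^ n))

  comb-scale : ∀ {n} z (cs : Vec ℚ n) gs → comb cs (Vec.map (z *_) gs) ≈ z * comb cs gs
  comb-scale z []       []       = ≈-sym (zeroʳ z)
  comb-scale z (c ∷ cs) (g ∷ gs) = ≈-trans (+-congˡ (comb-scale z cs gs))
    (solve 4 (λ c z g x → c :* (z :* g) :+ z :* x := z :* (c :* g :+ x)) ≈-refl (ι c) z g (comb cs gs))

  comb-++ : ∀ {m n} (cs : Vec ℚ m) (ds : Vec ℚ n) gs hs → comb (cs Vec.++ ds) (gs Vec.++ hs) ≈ comb cs gs + comb ds hs
  comb-++ []       ds []       hs = ≈-sym (+-identityˡ _)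
  comb-++ (c ∷ cs) ds (g ∷ gs) hs = ≈-trans (+-congˡ (comb-++ cs ds gs hs)) (≈-sym (+-assoc _ _ _))

  infixl 6 _⊕_
  infixl 7 _⊛_

  _⊕_ : List Carrier → List Carrier → List Carrier
  []      ⊕ G       = G
  (a ∷ F) ⊕ []      = a ∷ F
  (a ∷ F) ⊕ (b ∷ G) = (a + b) ∷ (F ⊕ G)

  _⊛_ : List Carrier → List Carrier → List Carrier
  []      ⊛ G = []
  (a ∷ F) ⊛ G = List.map (a *_) G ⊕ (0# ∷ (F ⊛ G))

  eval-⊕ : ∀ F G x → eval (F ⊕ G) x ≈ eval F x + eval G x
  eval-⊕ []      G       x = ≈-sym (+-identityˡ _)
  eval-⊕ (a ∷ F) []      x = ≈-sym (+-identityʳ _)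
  eval-⊕ (a ∷ F) (b ∷ G) x = ≈-trans (+-congˡ (*-congˡ (eval-⊕ F G x)))
    (solve 5 (λ a b x f g → a :+ b :+ x :* (f :+ g) := (a :+ x :* f) :+ (b :+ x :* g)) ≈-refl a b x (eval F x) (eval G x))

  eval-scale : ∀ r F x → eval (List.map (r *_) F) x ≈ r * eval F x
  eval-scale r []      x = ≈-sym (zeroʳ r)
  eval-scale r (a ∷ F) x = ≈-trans (+-congˡ (*-congˡ (eval-scale r F x)))
    (solve 4 (λ r a x f → r :* a :+ x :* (r :* f) := r :* (a :+ x :* f)) ≈-refl r a x (eval F x))

  eval-⊛ : ∀ F G x → eval (F ⊛ G) x ≈ eval F x * eval G x
  eval-⊛ []      G x = ≈-sym (zeroˡ _)
  eval-⊛ (a ∷ F) G x = begin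
    eval (List.map (a *_) G ⊕ (0# ∷ (F ⊛ G))) x              ≈⟨ eval-⊕ (List.map (a *_) G) (0# ∷ (F ⊛ G)) x ⟩
    eval (List.map (a *_) G) x + (0# + x * eval (F ⊛ G) x)   ≈⟨ +-cong (eval-scale a G x) (+-congˡ (*-congˡ (eval-⊛ F G x))) ⟩
    a * eval G x + (0# + x * (eval F x * eval G x))          ≈⟨ solve 4 (λ a x f g → a :* g :+ (con (+ 0) :+ x :* (f :* g)) := (a :+ x :* f) :* g) ≈-refl a x (eval F x) (eval G x) ⟩
    (a + x * eval F x) * eval G x                            ∎

  geometric : Carrier → ℕ → Carrier
  geometric x zero    = 0#
  geometric x (suc n) = 1# + x * geometric x n

  ^-geometric : ∀ x n → x ^ n - 1# ≈ (x - 1#) * geometric x n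
  ^-geometric x zero    = solve 1 (λ x → con (+ 1) :- con (+ 1) := (x :- con (+ 1)) :* con (+ 0)) ≈-refl x
  ^-geometric x (suc n) = begin
    x * x ^ n - 1#                                   ≈⟨ solve 2 (λ x y → x :* y :- con (+ 1) := x :* (y :- con (+ 1)) :+ (x :- con (+ 1))) ≈-refl x (x ^ n) ⟩
    x * (x ^ n - 1#) + (x - 1#)                      ≈⟨ +-congʳ (*-congˡ (^-geometric x n)) ⟩
    x * ((x - 1#) * geometric x n) + (x - 1#)        ≈⟨ solve 2 (λ x g → x :* ((x :- con (+ 1)) :* g) :+ (x :- con (+ 1)) := (x :- con (+ 1)) :* (con (+ 1) :+ x :* g)) ≈-refl x (geometric x n) ⟩
    (x - 1#) * (1# + x * geometric x n)              ∎

  ι-suc : ∀ n → ι (fromℤ (+ suc n)) ≈ 1# + ι (fromℤ (+ n))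
  ι-suc n = ≈-trans (ι-cong (fromℤ-+ (+ 1) (+ n))) (≈-trans (ι-+ _ _) (+-congʳ ι-1))

  ∑-cong : ∀ n {f g : Fin n → Carrier} → (∀ i → f i ≈ g i) → ∑ n f ≈ ∑ n g
  ∑-cong zero    f≈g = ≈-refl
  ∑-cong (suc n) f≈g = +-cong (f≈g zero) (∑-cong n (f≈g ∘ suc))

  ∑-*ˡ : ∀ n x (f : Fin n → Carrier) → ∑ n (λ i → x * f i) ≈ x * ∑ n f
  ∑-*ˡ zero    x f = ≈-sym (zeroʳ x)
  ∑-*ˡ (suc n) x f = ≈-trans (+-congˡ (∑-*ˡ n x (f ∘ suc))) (≈-sym (distribˡ x _ _))

  ∑-sub : ∀ n (f g : Fin n → Carrier) → ∑ n (λ i → f i - g i) ≈ ∑ n f - ∑ n g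
  ∑-sub zero    f g = ≈-sym (-‿inverseʳ 0#)
  ∑-sub (suc n) f g = ≈-trans (+-congˡ (∑-sub n (f ∘ suc) (g ∘ suc)))
    (solve 4 (λ a b x y → (a :- b) :+ (x :- y) := a :+ x :- (b :+ y)) ≈-refl (f zero) (g zero) (∑ n (f ∘ suc)) (∑ n (g ∘ suc)))

  ∑-+ : ∀ n (f g : Fin n → Carrier) → ∑ n (λ i → f i + g i) ≈ ∑ n f + ∑ n g
  ∑-+ zero    f g = ≈-sym (+-identityʳ 0#)
  ∑-+ (suc n) f g = ≈-trans (+-congˡ (∑-+ n (f ∘ suc) (g ∘ suc)))
    (solve 4 (λ a b x y → (a :+ b) :+ (x :+ y) := a :+ x :+ (b :+ y)) ≈-refl (f zero) (g zero) (∑ n (f ∘ suc)) (∑ n (g ∘ suc)))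

  ∏ : ∀ n → (Fin n → Carrier) → Carrier
  ∏ zero    f = 1#
  ∏ (suc n) f = f zero * ∏ n (f ∘ suc)

  ∏-cong : ∀ n {f g : Fin n → Carrier} → (∀ i → f i ≈ g i) → ∏ n f ≈ ∏ n g
  ∏-cong zero    f≈g = ≈-refl
  ∏-cong (suc n) f≈g = *-cong (f≈g zero) (∏-cong n (f≈g ∘ suc))

  ∑-↑ : ∀ m n (f : Fin (m ℕ.+ n) → Carrier) → ∑ (m ℕ.+ n) f ≈ ∑ m (λ i → f (i Fin.↑ˡ n)) + ∑ n (λ i → f (m Fin.↑ʳ i))
  ∑-↑ zero    n f = ≈-sym (+-identityˡ _)
  ∑-↑ (suc m) n f = ≈-trans (+-congˡ (∑-↑ m n (f ∘ suc))) (≈-sym (+-assoc _ _ _))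

  ∑-remQuot : ∀ m n (f : Fin m → Fin n → Carrier) →
    ∑ (m ℕ.* n) (λ i → f (Fin.quotient n i) (Fin.remainder {m} n i)) ≈ ∑ m (λ i → ∑ n (f i))
  ∑-remQuot zero    n f = ≈-refl
  ∑-remQuot (suc m) n f = ≈-trans (∑-↑ n (m ℕ.* n) _) (+-cong
    (∑-cong n (λ i → ≈-reflexive (cong (λ (q , r) → f q r) (Finₚ.remQuot-combine {suc m} {n} zero i))))
    (≈-trans (∑-cong (m ℕ.* n) (λ i → ≈-reflexive (cong (λ (q , r) → f q r) (remQuot-↑ʳ i)))) (∑-remQuot m n (f ∘ suc))))
    where
    remQuot-↑ʳ : ∀ i → Fin.remQuot {suc m} n (n Fin.↑ʳ i) ≡ (suc (Fin.quotient n i) , Fin.remainder {m} n i)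
    remQuot-↑ʳ i rewrite Finₚ.splitAt-↑ʳ n (m ℕ.* n) i = ≡.refl

  -- Distributivity, with `finToFun` reading `σ` as the tuple of its base-`m` digits; the induction
  -- splits off the leading digit.
  ∑∏-finToFun : ∀ m n (f : Fin n → Fin m → Carrier) →
    ∑ (m ℕ.^ n) (λ σ → ∏ n (λ i → f i (Fin.finToFun σ i))) ≈ ∏ n (λ i → ∑ m (f i))
  ∑∏-finToFun m zero    f = +-identityʳ 1#
  ∑∏-finToFun m (suc n) f = begin
    ∑ (m ℕ.^ suc n) (λ σ → f zero (Fin.quotient (m ℕ.^ n) σ) * rest (Fin.remainder {m} (m ℕ.^ n) σ))
      ≈⟨ ∑-remQuot m (m ℕ.^ n) (λ q r → f zero q * rest r) ⟩
    ∑ m (λ q → ∑ (m ℕ.^ n) (λ r → f zero q * rest r))   ≈⟨ ∑-cong m (λ q → ≈-trans (∑-*ˡ (m ℕ.^ n) (f zero q) rest) (*-comm _ _)) ⟩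
    ∑ m (λ q → ∑ (m ℕ.^ n) rest * f zero q)             ≈⟨ ∑-*ˡ m _ (f zero) ⟩
    ∑ (m ℕ.^ n) rest * ∑ m (f zero)                     ≈⟨ *-comm _ _ ⟩
    ∑ m (f zero) * ∑ (m ℕ.^ n) rest                     ≈⟨ *-congˡ (∑∏-finToFun m n (f ∘ suc)) ⟩
    ∑ m (f zero) * ∏ n (λ i → ∑ m (f (suc i)))          ∎
    where
    rest : Fin (m ℕ.^ n) → Carrier
    rest r = ∏ n (λ i → f (suc i) (Fin.finToFun r i))

  -- Splitting of monic polynomials

  -- The derivative in Horner form: (a + X F)′ = F + X F′.
  evalD : List Carrier → Carrier → Carrier
  evalD []      x = 0#
  evalD (a ∷ F) x = eval F x + x * evalD F x

  -- Horner's scheme: the coefficients of the quotient are the intermediate values at `r`.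
  -- Factorisations are compared only by their values, from which the formal derivative cannot be
  -- read off, so its product rule is proved alongside.
  divide-by-linear : ∀ a as r → ∃[ bs ] (length bs ≡ length as × (∀ x →
    (eval ((a ∷ as) List.++ [ 1# ]) x ≈ eval ((a ∷ as) List.++ [ 1# ]) r + (x - r) * eval (bs List.++ [ 1# ]) x) ×
    (evalD ((a ∷ as) List.++ [ 1# ]) x ≈ eval (bs List.++ [ 1# ]) x + (x - r) * evalD (bs List.++ [ 1# ]) x)))
  divide-by-linear a [] r = [] , ≡.refl , λ x →
    solve 3 (λ a r x → a :+ x :* (con (+ 1) :+ x :* con (+ 0)) := a :+ r :* (con (+ 1) :+ r :* con (+ 0)) :+ (x :- r) :* (con (+ 1) :+ x :* con (+ 0))) ≈-refl a r x ,
    solve 2 (λ r x → (con (+ 1) :+ x :* con (+ 0)) :+ x :* (con (+ 0) :+ x :* con (+ 0)) := (con (+ 1) :+ x :* con (+ 0)) :+ (x :- r) :* (con (+ 0) :+ x :* con (+ 0))) ≈-refl r x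
  divide-by-linear a (a′ ∷ as) r with divide-by-linear a′ as r
  ... | bs , len , eqs = G r ∷ bs , cong suc len , λ x →
    ≈-trans (+-congˡ (*-congˡ (proj₁ (eqs x))))
      (solve 5 (λ a x g r q → a :+ x :* (g :+ (x :- r) :* q) := a :+ r :* g :+ (x :- r) :* (g :+ x :* q)) ≈-refl a x (G r) r (Q x)) ,
    ≈-trans (+-cong (proj₁ (eqs x)) (*-congˡ (proj₂ (eqs x))))
      (solve 5 (λ x g r q q′ → g :+ (x :- r) :* q :+ x :* (q :+ (x :- r) :* q′) := g :+ x :* q :+ (x :- r) :* (q :+ x :* q′)) ≈-refl x (G r) r (Q x) (evalD (bs List.++ [ 1# ]) x))
    where
    G = eval ((a′ ∷ as) List.++ [ 1# ])
    Q = eval (bs List.++ [ 1# ])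

  linear-product : ∀ {n} → Vec Carrier n → Carrier → Carrier
  linear-product []       x = 1#
  linear-product (τ ∷ τs) x = (x - τ) * linear-product τs x

  cofactor : ∀ {n} → Vec Carrier n → Carrier → Fin n → Carrier
  cofactor (τ ∷ τs) x zero    = linear-product τs x
  cofactor (τ ∷ τs) x (suc j) = (x - τ) * cofactor τs x j

  cofactor-factor : ∀ {n} (τs : Vec Carrier n) x j → cofactor τs x j * (x - Vec.lookup τs j) ≈ linear-product τs x
  cofactor-factor (τ ∷ τs) x zero    = *-comm _ _
  cofactor-factor (τ ∷ τs) x (suc j) = ≈-trans (*-assoc _ _ _) (*-congˡ (cofactor-factor τs x j))

  splits : ∀ n as → length as ≡ n → ∃[ τs ] (∀ x →
    (eval (as List.++ [ 1# ]) x ≈ linear-product {n} τs x) × (evalD (as List.++ [ 1# ]) x ≈ ∑ n (cofactor τs x)))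
  splits zero    []       len = [] , λ x → solve 1 (λ x → con (+ 1) :+ x :* con (+ 0) := con (+ 1)) ≈-refl x ,
                                           solve 1 (λ x → con (+ 0) :+ x :* con (+ 0) := con (+ 0)) ≈-refl x
  splits (suc n) (a ∷ as) len =
    let r , root = algClosed (a ∷ as) (λ ())
        bs , len′ , eqs = divide-by-linear a as r
        τs , factored = splits n bs (≡.trans len′ (ℕₚ.suc-injective len))
    in r ∷ τs , λ x →
      ≈-trans (proj₁ (eqs x)) (≈-trans (+-cong root (*-congˡ (proj₁ (factored x)))) (+-identityˡ _)) ,
      ≈-trans (proj₂ (eqs x)) (+-cong (proj₁ (factored x)) (≈-trans (*-congˡ (proj₂ (factored x))) (≈-sym (∑-*ˡ n (x - r) (cofactor τs x)))))

  -- X^(e+1) - b without its leading coefficient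
  binomial : Carrier → ℕ → List Carrier
  binomial b e = (- b) ∷ List.replicate e 0#

  eval-power : ∀ e x → eval (List.replicate e 0# List.++ [ 1# ]) x ≈ x ^ e
  eval-power zero    x = solve 1 (λ x → con (+ 1) :+ x :* con (+ 0) := con (+ 1)) ≈-refl x
  eval-power (suc e) x = ≈-trans (+-identityˡ _) (*-congˡ (eval-power e x))

  -- Multiplied by `x` to avoid the exponent e - 1, which would be negative at e = 0.
  evalD-power : ∀ e x → x * evalD (List.replicate e 0# List.++ [ 1# ]) x ≈ ι (fromℤ (+ e)) * x ^ e
  evalD-power zero    x = ≈-trans (solve 1 (λ x → x :* (con (+ 0) :+ x :* con (+ 0)) := con (+ 0) :* con (+ 1)) ≈-refl x) (*-congʳ (≈-sym ι-0))
  evalD-power (suc e) x = begin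
    x * (eval (List.replicate e 0# List.++ [ 1# ]) x + x * evalD (List.replicate e 0# List.++ [ 1# ]) x)
                                                ≈⟨ *-congˡ (+-cong (eval-power e x) (evalD-power e x)) ⟩
    x * (x ^ e + ι (fromℤ (+ e)) * x ^ e)       ≈⟨ solve 3 (λ x y n → x :* (y :+ n :* y) := (con (+ 1) :+ n) :* (x :* y)) ≈-refl x (x ^ e) (ι (fromℤ (+ e))) ⟩
    (1# + ι (fromℤ (+ e))) * (x * x ^ e)        ≈⟨ *-congʳ (ι-suc e) ⟨
    ι (fromℤ (+ suc e)) * (x * x ^ e)           ∎

  eval-binomial : ∀ b e x → eval (binomial b e List.++ [ 1# ]) x ≈ x ^ suc e - b
  eval-binomial b e x = ≈-trans (+-congˡ (*-congˡ (eval-power e x))) (+-comm _ _)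

  x-y≈0⇒x≈y : ∀ {x y} → x - y ≈ 0# → x ≈ y
  x-y≈0⇒x≈y {x} {y} h = ≈-trans (solve 2 (λ x y → x := (x :- y) :+ y) ≈-refl x y) (≈-trans (+-congʳ h) (+-identityˡ y))

  x≈y⇒x-y≈0 : ∀ {x y} → x ≈ y → x - y ≈ 0#
  x≈y⇒x-y≈0 {x} {y} h = ≈-trans (+-congʳ h) (-‿inverseʳ y)

  root-extraction : ∀ b e → ∃[ μ ] (μ ^ suc e ≈ b)
  root-extraction b e = let μ , root = algClosed (binomial b e) (λ ()) in
    μ , x-y≈0⇒x≈y (≈-trans (≈-sym (eval-binomial b e μ)) root)

  roots-of-unity : ∀ e → ∃[ τs ]
    ((∀ x → linear-product {suc e} τs x ≈ x ^ suc e - 1#) ×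
     (∀ x → ∑ (suc e) (cofactor τs x) ≈ ι (fromℤ (+ suc e)) * x ^ e))
  roots-of-unity e = let τs , factored = splits (suc e) (binomial 1# e) (cong suc (Listₚ.length-replicate e)) in
    τs , (λ x → ≈-trans (≈-sym (proj₁ (factored x))) (eval-binomial 1# e x)) ,
    (λ x → ≈-trans (≈-sym (proj₂ (factored x))) (begin
      eval (List.replicate e 0# List.++ [ 1# ]) x + x * evalD (List.replicate e 0# List.++ [ 1# ]) x
                                              ≈⟨ +-cong (eval-power e x) (evalD-power e x) ⟩
      x ^ e + ι (fromℤ (+ e)) * x ^ e         ≈⟨ solve 2 (λ y n → y :+ n :* y := (con (+ 1) :+ n) :* y) ≈-refl (x ^ e) (ι (fromℤ (+ e))) ⟩
      (1# + ι (fromℤ (+ e))) * x ^ e          ≈⟨ *-congʳ (ι-suc e) ⟨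
      ι (fromℤ (+ suc e)) * x ^ e             ∎))

  -- Integer powers of units

  -- The inverse is passed explicitly: `_⁻¹` is not assumed to respect `_≈_`, and membership in a
  -- ring is proved for a particular inverse.
  zpow : Carrier → Carrier → ℤ → Carrier
  zpow x x′ (+ n)     = x ^ n
  zpow x x′ -[1+ n ]  = x′ ^ suc n

  ^ℤ≈zpow : ∀ x z → x ^ℤ z ≈ zpow x (x ⁻¹) z
  ^ℤ≈zpow x (+ n)    = ≈-refl
  ^ℤ≈zpow x -[1+ n ] = ≈-refl

  zpow-cong : ∀ {x x′ y y′} → x ≈ y → x′ ≈ y′ → ∀ z → zpow x x′ z ≈ zpow y y′ z
  zpow-cong x≈y x′≈y′ (+ n)    = ^-cong n x≈y
  zpow-cong x≈y x′≈y′ -[1+ n ] = ^-cong (suc n) x′≈y′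

  zpow-inverse : ∀ {x x′} → x * x′ ≈ 1# → ∀ z → zpow x x′ z * zpow x′ x z ≈ 1#
  zpow-inverse h (+ n)    = ^-inverse n h
  zpow-inverse h -[1+ n ] = ^-inverse (suc n) (≈-trans (*-comm _ _) h)

  zpow-⊖ : ∀ {x x′} → x * x′ ≈ 1# → ∀ m n → zpow x x′ (m ℤ.⊖ n) ≈ x ^ m * x′ ^ n
  zpow-⊖ h zero    zero    = ≈-sym (*-identityˡ 1#)
  zpow-⊖ h zero    (suc n) = ≈-sym (*-identityˡ _)
  zpow-⊖ h (suc m) zero    = ≈-sym (*-identityʳ _)
  zpow-⊖ {x} {x′} h (suc m) (suc n) = begin
    zpow x x′ (suc m ℤ.⊖ suc n)      ≈⟨ ≈-reflexive (cong (zpow x x′) (ℤₚ.[1+m]⊖[1+n]≡m⊖n m n)) ⟩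
    zpow x x′ (m ℤ.⊖ n)              ≈⟨ zpow-⊖ h m n ⟩
    x ^ m * x′ ^ n                   ≈⟨ *-identityˡ _ ⟨
    1# * (x ^ m * x′ ^ n)            ≈⟨ *-congʳ h ⟨
    x * x′ * (x ^ m * x′ ^ n)        ≈⟨ solve 4 (λ x y a b → x :* y :* (a :* b) := (x :* a) :* (y :* b)) ≈-refl x x′ (x ^ m) (x′ ^ n) ⟩
    x * x ^ m * (x′ * x′ ^ n)        ∎

  zpow-+ : ∀ {x x′} → x * x′ ≈ 1# → ∀ y z → zpow x x′ (y ℤ.+ z) ≈ zpow x x′ y * zpow x x′ z
  zpow-+ {x} h (+ m)    (+ n)    = ^-+ x m n
  zpow-+ h     (+ m)    -[1+ n ] = zpow-⊖ h m (suc n)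
  zpow-+ h     -[1+ m ] (+ n)    = ≈-trans (zpow-⊖ h n (suc m)) (*-comm _ _)
  zpow-+ {x} {x′} h -[1+ m ] -[1+ n ] = ≈-trans (≈-reflexive (cong (λ k → x′ ^ suc k) (≡.sym (ℕₚ.+-suc m n)))) (^-+ x′ (suc m) (suc n))

  zpow-* : ∀ x x′ n z → zpow x x′ (+ n ℤ.* z) ≈ zpow (x ^ n) (x′ ^ n) z
  zpow-* x x′ n (+ k)    = ≈-trans (≈-reflexive (cong (zpow x x′) (≡.sym (ℤₚ.pos-* n k)))) (^-*′ x n k)
  zpow-* x x′ n -[1+ k ] = begin
    zpow x x′ (+ n ℤ.* -[1+ k ])      ≈⟨ ≈-reflexive (cong (zpow x x′) (≡.trans (≡.sym (ℤₚ.neg-distribʳ-* (+ n) (+ suc k))) (cong ℤ.-_ (≡.sym (ℤₚ.pos-* n (suc k)))))) ⟩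
    zpow x x′ (ℤ.- (+ (n ℕ.* suc k))) ≈⟨ zpow-neg (n ℕ.* suc k) ⟩
    x′ ^ (n ℕ.* suc k)                ≈⟨ ^-*′ x′ n (suc k) ⟩
    (x′ ^ n) ^ suc k                  ∎
    where
    zpow-neg : ∀ k → zpow x x′ (ℤ.- (+ k)) ≈ x′ ^ k
    zpow-neg zero    = ≈-refl
    zpow-neg (suc k) = ≈-refl

  inverse-unique : ∀ {x y z} → x * y ≈ 1# → x * z ≈ 1# → y ≈ z
  inverse-unique {x} {y} {z} xy≈1 xz≈1 = begin
    y              ≈⟨ *-identityʳ y ⟨
    y * 1#         ≈⟨ *-congˡ xz≈1 ⟨
    y * (x * z)    ≈⟨ solve 3 (λ x y z → y :* (x :* z) := x :* y :* z) ≈-refl x y z ⟩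
    x * y * z      ≈⟨ *-congʳ xy≈1 ⟩
    1# * z         ≈⟨ *-identityˡ z ⟩
    z              ∎

  unit⇒≉0 : ∀ {x y} → x * y ≈ 1# → ¬ (x ≈ 0#)
  unit⇒≉0 {x} {y} xy≈1 x≈0 = 1≉0 (≈-trans (≈-sym xy≈1) (≈-trans (*-congʳ x≈0) (zeroˡ y)))

  ^ℤ-unit : ∀ {x y x′} → x ≈ y → y * x′ ≈ 1# → ∀ z → x ^ℤ z ≈ zpow y x′ z
  ^ℤ-unit {x} {y} {x′} x≈y yx′≈1 z = ≈-trans (^ℤ≈zpow x z) (zpow-cong x≈y (inverse-unique (⁻¹-inverse x (unit⇒≉0 xx′≈1)) xx′≈1) z)
    where
    xx′≈1 : x * x′ ≈ 1#
    xx′≈1 = ≈-trans (*-congʳ x≈y) yx′≈1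

  -- Cancellation, idempotents and nilpotents without decidable equality.

  cancel-≉0 : ∀ {x y} → ¬ (x ≈ 0#) → x * y ≈ 0# → y ≈ 0#
  cancel-≉0 {x} {y} x≉0 xy≈0 = begin
    y                      ≈⟨ *-identityˡ y ⟨
    1# * y                 ≈⟨ *-congʳ (⁻¹-inverse x x≉0) ⟨
    x * x ⁻¹ * y           ≈⟨ solve 3 (λ x i y → x :* i :* y := i :* (x :* y)) ≈-refl x (x ⁻¹) y ⟩
    (x ⁻¹) * (x * y)       ≈⟨ *-congˡ xy≈0 ⟩
    (x ⁻¹) * 0#            ≈⟨ zeroʳ _ ⟩
    0#                     ∎

  *-≉0 : ∀ {x y} → ¬ (x ≈ 0#) → ¬ (y ≈ 0#) → ¬ (x * y ≈ 0#)
  *-≉0 x≉0 y≉0 xy≈0 = y≉0 (cancel-≉0 x≉0 xy≈0)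

  ^-≉0 : ∀ {x} n → ¬ (x ≈ 0#) → ¬ (x ^ n ≈ 0#)
  ^-≉0 zero    x≉0 = 1≉0
  ^-≉0 (suc n) x≉0 = *-≉0 x≉0 (^-≉0 n x≉0)

  ι-≉0 : ∀ {q} → q ≢ 0ℚ → ¬ (ι q ≈ 0#)
  ι-≉0 {q} q≢0 = let r , rq≡1 = inverse q q≢0 in
    unit⇒≉0 (≈-trans (*-comm _ _) (≈-trans (≈-sym (ι-* r q)) (≈-trans (ι-cong rq≡1) ι-1)))

  -- Evaluation is componentwise along the splitting of the ring by `ε` and its complement: all
  -- cross terms carry the factor ε² - ε.
  eval-idempotent : ∀ F {ε} → ε * ε ≈ ε → ∀ x y → eval F (ε * x + (1# - ε) * y) ≈ ε * eval F x + (1# - ε) * eval F y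
  eval-idempotent []      {ε} ε²≈ε x y = solve 1 (λ ε → con (+ 0) := ε :* con (+ 0) :+ (con (+ 1) :- ε) :* con (+ 0)) ≈-refl ε
  eval-idempotent (a ∷ F) {ε} ε²≈ε x y = begin
    a + (ε * x + (1# - ε) * y) * eval F (ε * x + (1# - ε) * y)       ≈⟨ +-congˡ (*-congˡ (eval-idempotent F ε²≈ε x y)) ⟩
    a + (ε * x + (1# - ε) * y) * (ε * A + (1# - ε) * B)              ≈⟨ solve 6 (λ a ε x y A B →
         a :+ (ε :* x :+ (con (+ 1) :- ε) :* y) :* (ε :* A :+ (con (+ 1) :- ε) :* B) :=
         ε :* (a :+ x :* A) :+ (con (+ 1) :- ε) :* (a :+ y :* B) :+ (ε :* ε :- ε) :* ((x :- y) :* (A :- B))) ≈-refl a ε x y A B ⟩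
    ε * (a + x * A) + (1# - ε) * (a + y * B) + (ε * ε - ε) * ((x - y) * (A - B))
                                                                     ≈⟨ +-congˡ (≈-trans (*-congʳ (x≈y⇒x-y≈0 ε²≈ε)) (zeroˡ _)) ⟩
    ε * (a + x * A) + (1# - ε) * (a + y * B) + 0#                    ≈⟨ +-identityʳ _ ⟩
    ε * (a + x * A) + (1# - ε) * (a + y * B)                         ∎
    where
    A = eval F x
    B = eval F y

  -- The field operations only show that an idempotent cannot differ from both 0 and 1. The decision
  -- between the two is read off the index that `complete` returns for the mixed root.
  finite-root-set⇒connected : ∀ F {s} (lam : Fin (suc (suc s)) → Carrier) → (∀ i j → lam i ≈ lam j → i ≡ j) →
    (∀ i → eval F (lam i) ≈ 0#) → (∀ x → eval F x ≈ 0# → ∃[ i ] (x ≈ lam i)) → ∀ ε → ε * ε ≈ ε → (ε ≈ 0#) ⊎ (ε ≈ 1#)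
  finite-root-set⇒connected F lam distinct roots complete ε ε²≈ε = decide (complete x (≈-trans (eval-idempotent F ε²≈ε x₀ x₁)
      (≈-trans (+-cong (*-congˡ (roots zero)) (*-congˡ (roots (suc zero)))) (solve 1 (λ ε → ε :* con (+ 0) :+ (con (+ 1) :- ε) :* con (+ 0) := con (+ 0)) ≈-refl ε))))
    where
    x₀ = lam zero
    x₁ = lam (suc zero)
    x = ε * x₀ + (1# - ε) * x₁
    difference≉0 : ∀ {i j} → i ≢ j → ¬ (lam i - lam j ≈ 0#)
    difference≉0 i≢j h = i≢j (distinct _ _ (x-y≈0⇒x≈y h))
    vanishes : ∀ {z} → (ε * ε - ε) * z ≈ 0#
    vanishes = ≈-trans (*-congʳ (x≈y⇒x-y≈0 ε²≈ε)) (zeroˡ _)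
    decide : ∃[ i ] (x ≈ lam i) → (ε ≈ 0#) ⊎ (ε ≈ 1#)
    decide (zero , x≈x₀) = inj₂ (≈-sym (x-y≈0⇒x≈y (cancel-≉0 (difference≉0 {suc zero} {zero} (λ ())) (begin
      (x₁ - x₀) * (1# - ε)                                           ≈⟨ solve 3 (λ x y ε → (y :- x) :* (con (+ 1) :- ε) := (ε :* x :+ (con (+ 1) :- ε) :* y) :- x) ≈-refl x₀ x₁ ε ⟩
      x - x₀                                                         ≈⟨ x≈y⇒x-y≈0 x≈x₀ ⟩
      0#                                                             ∎))))
    -- Multiplication by `ε` removes the `x₁` part of `x`, so `x₁` and every further root are
    -- treated alike.
    decide (suc i , x≈xᵢ) = inj₁ (cancel-≉0 (difference≉0 {zero} {suc i} (λ ())) (begin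
      (x₀ - lam (suc i)) * ε                                         ≈⟨ solve 4 (λ x y z ε → (x :- z) :* ε := ε :* ((ε :* x :+ (con (+ 1) :- ε) :* y) :- z) :+ (ε :* ε :- ε) :* (y :- x)) ≈-refl x₀ x₁ (lam (suc i)) ε ⟩
      ε * (x - lam (suc i)) + (ε * ε - ε) * (x₁ - x₀)                ≈⟨ +-cong (≈-trans (*-congˡ (x≈y⇒x-y≈0 x≈xᵢ)) (zeroʳ ε)) vanishes ⟩
      0# + 0#                                                        ≈⟨ +-identityˡ 0# ⟩
      0#                                                             ∎))

  nonzero-summand : ∀ n {y : Fin n → Carrier} → (∀ i → (∃[ r ] (y i ^ r ≈ 0#)) ⊎ (¬ (y i ≈ 0#))) → ¬ (∑ n y ≈ 0#) → ∃[ i ] (¬ (y i ≈ 0#))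
  nonzero-summand zero    dichotomy ∑≉0 = ⊥-elim (∑≉0 ≈-refl)
  nonzero-summand (suc n) {y} dichotomy ∑≉0 with dichotomy zero
  ... | inj₂ y₀≉0 = zero , y₀≉0
  ... | inj₁ (r , y₀^r≈0) = let i , h = nonzero-summand n (dichotomy ∘ suc) rest≉0 in suc i , h
    where
    -- A nilpotent term is not known to be ≈ 0, so it cannot just be dropped. But if the other terms
    -- summed to 0, the r-th power of the whole sum would be that of the nilpotent term.
    rest≉0 : ¬ (∑ n (y ∘ suc) ≈ 0#)
    rest≉0 rest≈0 = ^-≉0 r ∑≉0 (≈-trans (^-cong r (≈-trans (+-congˡ rest≈0) (+-identityʳ _))) y₀^r≈0)

  ∏-≉0 : ∀ n {x} → ¬ (x ≈ 0#) → ¬ (∏ n (λ _ → x) ≈ 0#)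
  ∏-≉0 zero    x≉0 = 1≉0
  ∏-≉0 (suc n) x≉0 = *-≉0 x≉0 (∏-≉0 n x≉0)

  charPoly-monic : ∀ m coef → charPoly K E m coef ≡ List.tabulate (λ i → - ι (coef i)) List.++ [ 1# ]
  charPoly-monic zero    coef = ≡.refl
  charPoly-monic (suc m) coef = cong ((- ι (coef zero)) ∷_) (charPoly-monic m (coef ∘ suc))

  -- Subrings of the field finite over the p-integral rationals.

  module AtPrime {p} (pp : Prime p) where
    open PIntegral pp

    -- The generators may be dependent, as independence over ℚ could not be decided. Finiteness
    -- alone bounds the number of classes modulo `p` and, through elimination, gives p-adic
    -- separation.
    record FiniteRing : Set (lsuc (c ⊔ ℓ)) where
      field
        Mem      : Carrier → Set (c ⊔ ℓ)
        resp     : ∀ {x y} → x ≈ y → Mem x → Mem y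
        +-mem    : ∀ {x y} → Mem x → Mem y → Mem (x + y)
        *-mem    : ∀ {x y} → Mem x → Mem y → Mem (x * y)
        ι-mem    : ∀ {q} → Integral q → Mem (ι q)
        {size}   : ℕ
        gens     : Vec Carrier size
        gens-mem : VAll.All Mem gens
        span     : ∀ {x} → Mem x → ∃[ cs ] (VAll.All Integral cs × x ≈ comb cs gens)

      0-mem : Mem 0#
      0-mem = resp ι-0 (ι-mem (integral-fromℤ (+ 0)))

      1-mem : Mem 1#
      1-mem = resp ι-1 (ι-mem (integral-fromℤ (+ 1)))

      neg-mem : ∀ {x} → Mem x → Mem (- x)
      neg-mem {x} h = resp (begin
        ι (ℚ.- 1ℚ) * x    ≈⟨ *-congʳ (≈-trans (ι-neg 1ℚ) (-‿cong ι-1)) ⟩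
        (- 1#) * x        ≈⟨ solve 1 (λ x → (:- con (+ 1)) :* x := :- x) ≈-refl x ⟩
        - x               ∎) (*-mem (ι-mem (integral-fromℤ -[1+ 0 ])) h)

      ^-mem : ∀ {x} n → Mem x → Mem (x ^ n)
      ^-mem zero    h = 1-mem
      ^-mem (suc n) h = *-mem h (^-mem n h)

      ⊕-mem : ∀ {F G} → All Mem F → All Mem G → All Mem (F ⊕ G)
      ⊕-mem []       Gs       = Gs
      ⊕-mem (f ∷ Fs) []       = f ∷ Fs
      ⊕-mem (f ∷ Fs) (g ∷ Gs) = +-mem f g ∷ ⊕-mem Fs Gs

      scale-mem : ∀ {r F} → Mem r → All Mem F → All Mem (List.map (r *_) F)
      scale-mem h Fs = Allₚ.map⁺ (All.map (*-mem h) Fs)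

      ⊛-mem : ∀ {F G} → All Mem F → All Mem G → All Mem (F ⊛ G)
      ⊛-mem []       Gs = []
      ⊛-mem (f ∷ Fs) Gs = ⊕-mem (scale-mem f Gs) (0-mem ∷ ⊛-mem Fs Gs)

    open FiniteRing using (Mem)

    infix 4 _⊑_
    _⊑_ : FiniteRing → FiniteRing → Set (c ⊔ ℓ)
    A ⊑ A′ = ∀ {x} → Mem A x → Mem A′ x

    rationals : FiniteRing
    rationals = record
      { Mem      = λ x → Lift c (∃[ q ] (Integral q × x ≈ ι q))
      ; resp     = λ { x≈y (lift (q , Iq , e)) → lift (q , Iq , ≈-trans (≈-sym x≈y) e) }
      ; +-mem    = λ { (lift (q , Iq , e)) (lift (r , Ir , e′)) → lift (q ℚ.+ r , integral-+ Iq Ir , ≈-trans (+-cong e e′) (≈-sym (ι-+ q r))) }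
      ; *-mem    = λ { (lift (q , Iq , e)) (lift (r , Ir , e′)) → lift (q ℚ.* r , integral-* Iq Ir , ≈-trans (*-cong e e′) (≈-sym (ι-* q r))) }
      ; ι-mem    = λ Iq → lift (_ , Iq , ≈-refl)
      ; gens     = 1# ∷ []
      ; gens-mem = lift (1ℚ , integral-fromℤ (+ 1) , ≈-sym ι-1) ∷ []
      ; span     = λ { (lift (q , Iq , e)) → q ∷ [] , Iq ∷ [] , ≈-trans e (solve 1 (λ q → q := q :* con (+ 1) :+ con (+ 0)) ≈-refl (ι q)) }
      }

    module Adjoin (A : FiniteRing) (z : Carrier) (bs : List Carrier) (bs-mem : All (Mem A) bs)
                  (root : eval (bs List.++ [ 1# ]) z ≈ 0#) where
      open FiniteRing A renaming (Mem to MemA)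

      -- One step of division by the monic polynomial whose lower coefficients are bs.
      reduce-top : ∀ P bs → All MemA P → All MemA bs → length P ≡ suc (length bs) →
        ∃[ r ] ∃[ R ] (MemA r × All MemA R × length R ≡ length bs × (∀ z → eval P z ≈ eval R z + r * eval (bs List.++ [ 1# ]) z))
      reduce-top (a ∷ []) [] (Pa ∷ []) [] len = a , [] , Pa , [] , ≡.refl , λ z →
        solve 2 (λ a z → a :+ z :* con (+ 0) := con (+ 0) :+ a :* (con (+ 1) :+ z :* con (+ 0))) ≈-refl a z
      reduce-top (a ∷ P@(_ ∷ _)) (b ∷ bs) (Pa ∷ Ps) (Pb ∷ Pbs) len with reduce-top P bs Ps Pbs (ℕₚ.suc-injective len)
      ... | r , R , Mr , MR , len′ , eq = r , (a + - (r * b)) ∷ R , Mr , +-mem Pa (neg-mem (*-mem Mr Pb)) ∷ MR , cong suc len′ , λ z →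
        ≈-trans (+-congˡ (*-congˡ (eq z)))
          (solve 6 (λ a z R r b m → a :+ z :* (R :+ r :* m) := a :+ :- (r :* b) :+ z :* R :+ r :* (b :+ z :* m)) ≈-refl a z (eval R z) r b (eval (bs List.++ [ 1# ]) z))

      -- Horner's scheme again: each multiplication by `z` raises the degree by one and is followed
      -- by one reduction. The remainder has exactly `length bs` coefficients, with zeros as
      -- padding, to match a fixed list of generators.
      reduce : ∀ F → All MemA F → ∃[ R ] (All MemA R × length R ≡ length bs × eval F z ≈ eval R z)
      reduce [] [] = List.replicate (length bs) 0# , Allₚ.replicate⁺ (length bs) 0-mem , Listₚ.length-replicate (length bs) , eval-zeros (length bs)
        where
        eval-zeros : ∀ n → 0# ≈ eval (List.replicate n 0#) z
        eval-zeros zero    = ≈-refl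
        eval-zeros (suc n) = ≈-trans (solve 1 (λ z → con (+ 0) := con (+ 0) :+ z :* con (+ 0)) ≈-refl z) (+-congˡ (*-congˡ (eval-zeros n)))
      reduce (a ∷ F) (Ma ∷ MF) with reduce F MF
      ... | R , MR , len , eq with reduce-top (a ∷ R) bs (Ma ∷ MR) bs-mem (cong suc len)
      ...   | r , R′ , _ , MR′ , len′ , eq′ = R′ , MR′ , len′ , (begin
        a + z * eval F z                             ≈⟨ +-congˡ (*-congˡ eq) ⟩
        a + z * eval R z                             ≈⟨ eq′ z ⟩
        eval R′ z + r * eval (bs List.++ [ 1# ]) z   ≈⟨ +-congˡ (≈-trans (*-congˡ root) (zeroʳ r)) ⟩
        eval R′ z + 0#                               ≈⟨ +-identityʳ _ ⟩
        eval R′ z                                    ∎)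

      gens^ : ∀ n → Vec Carrier (n ℕ.* size)
      gens^ zero    = []
      gens^ (suc n) = gens Vec.++ Vec.map (z *_) (gens^ n)

      span^ : ∀ n R → All MemA R → length R ≡ n → ∃[ cs ] (VAll.All Integral cs × eval R z ≈ comb cs (gens^ n))
      span^ zero    []      _         _   = [] , [] , ≈-refl
      span^ (suc n) (r ∷ R) (Mr ∷ MR) len =
        let cs , Ics , e = span Mr ; ds , Ids , e′ = span^ n R MR (ℕₚ.suc-injective len) in
        cs Vec.++ ds , VAllₚ.++⁺ Ics Ids , (begin
          r + z * eval R z                                       ≈⟨ +-cong e (*-congˡ e′) ⟩
          comb cs gens + z * comb ds (gens^ n)                   ≈⟨ +-congˡ (comb-scale z ds (gens^ n)) ⟨
          comb cs gens + comb ds (Vec.map (z *_) (gens^ n))      ≈⟨ comb-++ cs ds gens _ ⟨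
          comb (cs Vec.++ ds) (gens Vec.++ Vec.map (z *_) (gens^ n)) ∎)

      Mem′ : Carrier → Set (c ⊔ ℓ)
      Mem′ x = ∃[ F ] (All MemA F × x ≈ eval F z)

      include : ∀ {x} → MemA x → Mem′ x
      include {x} h = [ x ] , h ∷ [] , solve 2 (λ x z → x := x :+ z :* con (+ 0)) ≈-refl x z

      *z-mem : ∀ {x} → Mem′ x → Mem′ (z * x)
      *z-mem {x} (F , MF , e) = 0# ∷ F , 0-mem ∷ MF , ≈-trans (*-congˡ e) (≈-sym (+-identityˡ _))

      gens^-mem : ∀ n → VAll.All Mem′ (gens^ n)
      gens^-mem zero    = []
      gens^-mem (suc n) = VAllₚ.++⁺ (VAll.map include gens-mem) (VAllₚ.map⁺ (VAll.map *z-mem (gens^-mem n)))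

      adjoin : FiniteRing
      adjoin = record
        { Mem      = Mem′
        ; resp     = λ { x≈y (F , MF , e) → F , MF , ≈-trans (≈-sym x≈y) e }
        ; +-mem    = λ { (F , MF , e) (G , MG , e′) → F ⊕ G , ⊕-mem MF MG , ≈-trans (+-cong e e′) (≈-sym (eval-⊕ F G z)) }
        ; *-mem    = λ { (F , MF , e) (G , MG , e′) → F ⊛ G , ⊛-mem MF MG , ≈-trans (*-cong e e′) (≈-sym (eval-⊛ F G z)) }
        ; ι-mem    = include ∘ ι-mem
        ; gens     = gens^ (length bs)
        ; gens-mem = gens^-mem (length bs)
        ; span     = λ { (F , MF , e) → let R , MR , len , e′ = reduce F MF ; cs , Ics , e″ = span^ (length bs) R MR len in
                         cs , Ics , ≈-trans e (≈-trans e′ e″) }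
        }

      z-mem : Mem′ z
      z-mem = 0# ∷ 1# ∷ [] , 0-mem ∷ 1-mem ∷ [] , solve 1 (λ z → z := con (+ 0) :+ z :* (con (+ 1) :+ z :* con (+ 0))) ≈-refl z

    MonicRoot : FiniteRing → Carrier → Set (c ⊔ ℓ)
    MonicRoot A z = ∃[ bs ] (All (Mem A) bs × eval (bs List.++ [ 1# ]) z ≈ 0#)

    adjoin-all : ∀ n A (z : Fin n → Carrier) → (∀ i → MonicRoot A (z i)) →
      ∃[ A′ ] (A ⊑ A′ × (∀ i → Mem A′ (z i)))
    adjoin-all zero    A z root = A , (λ h → h) , λ ()
    adjoin-all (suc n) A z root with root zero
    ... | bs , Mbs , e with adjoin-all n (Adjoin.adjoin A (z zero) bs Mbs e) (z ∘ suc)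
                            (λ i → let bs′ , Mbs′ , e′ = root (suc i) in bs′ , All.map (Adjoin.include A (z zero) bs Mbs e) Mbs′ , e′)
    ...   | A′ , A⊑A′ , mem = A′ , (λ {x} h → A⊑A′ {x} (Adjoin.include A (z zero) bs Mbs e h)) ,
      λ { zero → A⊑A′ (Adjoin.z-mem A (z zero) bs Mbs e) ; (suc i) → mem i }

    -- Congruences modulo powers of p.

    ιp^ : ℕ → Carrier
    ιp^ M = ι (pℚ p M)

    ιp^-+ : ∀ M N → ιp^ (M ℕ.+ N) ≈ ιp^ M * ιp^ N
    ιp^-+ M N = ≈-trans (ι-cong (≡.trans (cong fromℤ (≡.trans (cong +_ (ℕₚ.^-distribˡ-+-* p M N)) (ℤₚ.pos-* (p ℕ.^ M) (p ℕ.^ N)))) (fromℤ-* (+ (p ℕ.^ M)) (+ (p ℕ.^ N))))) (ι-* _ _)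

    ιp^1 : ιp^ 1 ≈ ι (fromℤ (+ p))
    ιp^1 = ι-cong (cong (λ n → fromℤ (+ n)) (ℕₚ.*-identityʳ p))

    module Congruence (A : FiniteRing) where
      open FiniteRing A using (+-mem; *-mem; ι-mem; 0-mem; 1-mem; ^-mem; gens; gens-mem; span; size)

      infix 4 p^_∣_
      -- The quotient has to lie in `A`: this is divisibility by the rational number p^M, at all
      -- primes above `p` together.
      record p^_∣_ (M : ℕ) (x : Carrier) : Set (c ⊔ ℓ) where
        constructor multiple
        field
          {quotient}   : Carrier
          quotient-mem : Mem A quotient
          factors      : x ≈ ιp^ M * quotient

      ∣-resp : ∀ {M x y} → x ≈ y → p^ M ∣ x → p^ M ∣ y
      ∣-resp x≈y (multiple Mz e) = multiple Mz (≈-trans (≈-sym x≈y) e)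

      ∣-+ : ∀ {M x y} → p^ M ∣ x → p^ M ∣ y → p^ M ∣ (x + y)
      ∣-+ (multiple Mu e) (multiple Mv e′) = multiple (+-mem Mu Mv) (≈-trans (+-cong e e′) (≈-sym (distribˡ _ _ _)))

      ∣-* : ∀ {M N x y} → p^ M ∣ x → p^ N ∣ y → p^ (M ℕ.+ N) ∣ (x * y)
      ∣-* {M} {N} (multiple {u} Mu e) (multiple {v} Mv e′) = multiple (*-mem Mu Mv) (≈-trans (*-cong e e′)
        (≈-trans (solve 4 (λ P u Q v → (P :* u) :* (Q :* v) := (P :* Q) :* (u :* v)) ≈-refl (ιp^ M) u (ιp^ N) v) (*-congʳ (≈-sym (ιp^-+ M N)))))

      ∣-*ʳ : ∀ {M x y} → p^ M ∣ x → Mem A y → p^ M ∣ (x * y)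
      ∣-*ʳ (multiple Mu e) My = multiple (*-mem Mu My) (≈-trans (*-congʳ e) (*-assoc _ _ _))

      ∣-*ˡ : ∀ {M x y} → Mem A x → p^ M ∣ y → p^ M ∣ (x * y)
      ∣-*ˡ Mx d = ∣-resp (*-comm _ _) (∣-*ʳ d Mx)

      ∣-weaken : ∀ M N {x} → p^ (M ℕ.+ N) ∣ x → p^ M ∣ x
      ∣-weaken M N (multiple Mu e) = multiple (*-mem (ι-mem (integral-fromℤ (+ (p ℕ.^ N)))) Mu) (≈-trans e (≈-trans (*-congʳ (ιp^-+ M N)) (*-assoc _ _ _)))

      geometric-mem : ∀ {x} n → Mem A x → Mem A (geometric x n)
      geometric-mem zero    Mx = 0-mem
      geometric-mem (suc n) Mx = +-mem 1-mem (*-mem Mx (geometric-mem n Mx))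

      geometric≡n : ∀ {M x} n → Mem A x → p^ M ∣ (x - 1#) → p^ M ∣ (geometric x n - ι (fromℤ (+ n)))
      geometric≡n {M} zero Mx d = multiple 0-mem (≈-trans (+-congˡ (-‿cong ι-0)) (solve 1 (λ P → con (+ 0) :- con (+ 0) := P :* con (+ 0)) ≈-refl (ιp^ M)))
      geometric≡n {x = x} (suc n) Mx d = ∣-resp (begin
        x * (geometric x n - n′) + (x - 1#) * n′     ≈⟨ solve 3 (λ x g n → x :* (g :- n) :+ (x :- con (+ 1)) :* n := (con (+ 1) :+ x :* g) :- (con (+ 1) :+ n)) ≈-refl x (geometric x n) n′ ⟩
        1# + x * geometric x n - (1# + n′)           ≈⟨ +-congˡ (-‿cong (ι-suc n)) ⟨
        1# + x * geometric x n - ι (fromℤ (+ suc n)) ∎)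
        (∣-+ (∣-*ˡ Mx (geometric≡n n Mx d)) (∣-*ʳ d (ι-mem (integral-fromℤ (+ n)))))
        where n′ = ι (fromℤ (+ n))

      ≡1-^ : ∀ {M x} n → Mem A x → p^ M ∣ (x - 1#) → p^ M ∣ (x ^ n - 1#)
      ≡1-^ {x = x} n Mx d = ∣-resp (≈-sym (^-geometric x n)) (∣-*ʳ d (geometric-mem n Mx))

      -- x^p - 1 is the product of x - 1 and 1 + x + ... + x^(p-1), and the second factor is ≡ p ≡ 0
      -- modulo p because x ≡ 1. No binomial coefficients enter, and p = 2 is not exceptional.
      ≡1-^p : ∀ {M x} → Mem A x → p^ suc M ∣ (x - 1#) → p^ suc (suc M) ∣ (x ^ p - 1#)
      ≡1-^p {M} {x} Mx d = ∣-resp (≈-trans (*-comm _ _) (≈-sym (^-geometric x p)))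
        (∣-* {1} (∣-resp (solve 2 (λ g p → (g :- p) :+ p := g) ≈-refl (geometric x p) (ι (fromℤ (+ p))))
          (∣-+ (geometric≡n p Mx (∣-weaken 1 M d)) (multiple 1-mem (≈-trans (≈-sym ιp^1) (≈-sym (*-identityʳ _)))))) d)

      ≡1-^p^ : ∀ {x} M → Mem A x → p^ 1 ∣ (x - 1#) → p^ suc M ∣ (x ^ (p ℕ.^ M) - 1#)
      ≡1-^p^ {x} zero Mx d = ∣-resp (+-congʳ (≈-sym (*-identityʳ x))) d
      ≡1-^p^ {x} (suc M) Mx d = ∣-resp (+-congʳ (≈-sym (^-* x p (p ℕ.^ M)))) (≡1-^p (^-mem (p ℕ.^ M) Mx) (≡1-^p^ M Mx d))

      residues : ∀ {n} {cs : Vec ℚ n} → VAll.All Integral cs → Fin n → Fin p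
      residues (Ic ∷ Ics) zero    = proj₁ (residue Ic)
      residues (Ic ∷ Ics) (suc i) = residues Ics i

      same-residues : ∀ {n} {cs ds : Vec ℚ n} (Ics : VAll.All Integral cs) (Ids : VAll.All Integral ds) →
        (∀ i → residues Ics i ≡ residues Ids i) → ∀ gs → VAll.All (Mem A) gs → p^ 1 ∣ (comb cs gs - comb ds gs)
      same-residues [] [] eq [] [] = multiple 0-mem (solve 1 (λ P → con (+ 0) :- con (+ 0) := P :* con (+ 0)) ≈-refl (ιp^ 1))
      same-residues {cs = c₀ ∷ cs} {ds = d₀ ∷ ds} (Ic ∷ Ics) (Id ∷ Ids) eq (g ∷ gs) (Mg ∷ Mgs) =
        let q , Iq , e = same-residue Ic Id (eq zero) in ∣-resp
          (solve 5 (λ c d g x y → (c :- d) :* g :+ (x :- y) := c :* g :+ x :- (d :* g :+ y)) ≈-refl (ι c₀) (ι d₀) g (comb cs gs) (comb ds gs))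
          (∣-+ (multiple (*-mem (ι-mem Iq) Mg) (begin
            (ι c₀ - ι d₀) * g             ≈⟨ *-congʳ (≈-trans (≈-sym (ι-sub c₀ d₀)) (≈-trans (ι-cong e) (ι-* (fromℤ (+ p)) q))) ⟩
            ι (fromℤ (+ p)) * ι q * g     ≈⟨ *-assoc _ _ _ ⟩
            ι (fromℤ (+ p)) * (ι q * g)   ≈⟨ *-congʳ ιp^1 ⟨
            ιp^ 1 * (ι q * g)             ∎))
          (same-residues Ics Ids (eq ∘ suc) gs Mgs))

      -- Coordinates modulo `p` distinguish at most p^size classes, so two of the first p^size + 1
      -- powers of `u` agree modulo `p`; the inverse cancels the lower one.
      unit-^≡1 : ∀ {u u′} → Mem A u → Mem A u′ → u * u′ ≈ 1# → ∃[ e ] (p^ 1 ∣ (u ^ suc e - 1#))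
      unit-^≡1 {u} {u′} Mu Mu′ uu′≈1 = e , ∣-resp (begin
          u′ ^ m * (u ^ n - u ^ m)                      ≈⟨ *-congˡ (+-congʳ (≈-trans (≈-reflexive (cong (u ^_) n≡)) (^-+ u m (suc e)))) ⟩
          u′ ^ m * (u ^ m * u ^ suc e - u ^ m)          ≈⟨ solve 3 (λ a b x → a :* (b :* x :- b) := (b :* a) :* (x :- con (+ 1))) ≈-refl (u′ ^ m) (u ^ m) (u ^ suc e) ⟩
          (u ^ m * u′ ^ m) * (u ^ suc e - 1#)           ≈⟨ *-congʳ (^-inverse m uu′≈1) ⟩
          1# * (u ^ suc e - 1#)                         ≈⟨ *-identityˡ _ ⟩
          u ^ suc e - 1#                                ∎)
          (∣-*ˡ (^-mem m Mu′) u^n≡u^m)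
        where
        coords : ∀ i → ∃[ cs ] (VAll.All Integral cs × u ^ i ≈ comb cs gens)
        coords i = span (^-mem i Mu)
        code : Fin (suc (p ℕ.^ size)) → Fin (p ℕ.^ size)
        code i = Fin.funToFin (residues (proj₁ (proj₂ (coords (toℕ i)))))
        collision = Finₚ.pigeonhole (ℕₚ.n<1+n _) code
        m = toℕ (proj₁ collision)
        n = toℕ (proj₁ (proj₂ collision))
        m<n : m ℕ.< n
        m<n = proj₁ (proj₂ (proj₂ collision))
        -- The exponent sought is n - m, which is positive; `e` is its predecessor.
        e = n ℕ.∸ suc m
        n≡ : n ≡ m ℕ.+ suc e
        n≡ = ≡.trans (≡.sym (ℕₚ.m+[n∸m]≡n m<n)) (≡.sym (ℕₚ.+-suc m e))
        same : ∀ i → residues (proj₁ (proj₂ (coords n))) i ≡ residues (proj₁ (proj₂ (coords m))) i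
        same i = ≡.trans (≡.sym (Finₚ.finToFun-funToFin _ i))
          (≡.trans (cong (λ k → Fin.finToFun k i) (≡.sym (proj₂ (proj₂ (proj₂ collision))))) (Finₚ.finToFun-funToFin _ i))
        u^n≡u^m : p^ 1 ∣ (u ^ n - u ^ m)
        u^n≡u^m = ∣-resp (+-cong (≈-sym (proj₂ (proj₂ (coords n)))) (-‿cong (≈-sym (proj₂ (proj₂ (coords m))))))
          (same-residues (proj₁ (proj₂ (coords n))) (proj₁ (proj₂ (coords m))) same gens gens-mem)

    -- A home for the coefficients of the fᵢ, which are given as bare elements of the field with no
    -- integrality known. Containing 1 makes the module contain `A`, so that U(n) and the κᵢ can be
    -- compared in it.
    record FiniteModule (A : FiniteRing) : Set (lsuc (c ⊔ ℓ)) where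
      field
        In      : Carrier → Set (c ⊔ ℓ)
        In-resp : ∀ {x y} → x ≈ y → In x → In y
        1-in    : In 1#
        +-in    : ∀ {x y} → In x → In y → In (x + y)
        act     : ∀ {x y} → Mem A x → In y → In (x * y)
        {rank}  : ℕ
        basis   : Vec Carrier rank
        In-span : ∀ {x} → In x → ∃[ cs ] (VAll.All Integral cs × x ≈ comb cs basis)

      0-in : In 0#
      0-in = In-resp (zeroˡ 1#) (act (FiniteRing.0-mem A) 1-in)

      eval-in : ∀ {F x} → All In F → Mem A x → In (eval F x)
      eval-in []       Mx = 0-in
      eval-in (f ∷ Fs) Mx = +-in f (act Mx (eval-in Fs Mx))

      eval-difference : ∀ {F x y} → All In F → Mem A x → Mem A y → ∃[ b ] (In b × eval F x - eval F y ≈ (x - y) * b)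
      eval-difference {x = x} {y} [] Mx My = 0# , 0-in , solve 2 (λ x y → con (+ 0) :- con (+ 0) := (x :- y) :* con (+ 0)) ≈-refl x y
      eval-difference {a ∷ F} {x} {y} (f ∷ Fs) Mx My = let b , Ib , e = eval-difference Fs Mx My in
        x * b + eval F y , +-in (act Mx Ib) (eval-in Fs My) , (begin
          a + x * eval F x - (a + y * eval F y)                      ≈⟨ solve 5 (λ a x y f g → a :+ x :* f :- (a :+ y :* g) := x :* (f :- g) :+ (x :- y) :* g) ≈-refl a x y (eval F x) (eval F y) ⟩
          x * (eval F x - eval F y) + (x - y) * eval F y             ≈⟨ +-congʳ (*-congˡ e) ⟩
          x * ((x - y) * b) + (x - y) * eval F y                     ≈⟨ solve 4 (λ x y b g → x :* ((x :- y) :* b) :+ (x :- y) :* g := (x :- y) :* (x :* b :+ g)) ≈-refl x y b (eval F y) ⟩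
          (x - y) * (x * b + eval F y)                               ∎)

    module _ (A : FiniteRing) where
      open FiniteRing A using (resp; +-mem; *-mem; 0-mem; 1-mem; ^-mem; gens; span; size)
      open Congruence A

      regular : FiniteModule A
      regular = record { In = Mem A ; In-resp = resp ; 1-in = 1-mem ; +-in = +-mem ; act = *-mem ; basis = gens ; In-span = span }

      extend : FiniteModule A → Carrier → FiniteModule A
      extend B z = record
        { In      = λ x → ∃[ b ] ∃[ a ] (In b × Mem A a × x ≈ b + z * a)
        ; In-resp = λ { x≈y (b , a , Ib , Ma , e) → b , a , Ib , Ma , ≈-trans (≈-sym x≈y) e }
        ; 1-in    = 1# , 0# , 1-in , 0-mem , solve 1 (λ z → con (+ 1) := con (+ 1) :+ z :* con (+ 0)) ≈-refl z
        ; +-in    = λ { (b , a , Ib , Ma , e) (b′ , a′ , Ib′ , Ma′ , e′) → b + b′ , a + a′ , +-in Ib Ib′ , +-mem Ma Ma′ ,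
                      ≈-trans (+-cong e e′) (solve 5 (λ b a b′ a′ z → (b :+ z :* a) :+ (b′ :+ z :* a′) := (b :+ b′) :+ z :* (a :+ a′)) ≈-refl b a b′ a′ z) }
        ; act     = λ { {x} Mx (b , a , Ib , Ma , e) → x * b , x * a , act Mx Ib , *-mem Mx Ma ,
                      ≈-trans (*-congˡ e) (solve 4 (λ x b a z → x :* (b :+ z :* a) := x :* b :+ z :* (x :* a)) ≈-refl x b a z) }
        ; basis   = basis Vec.++ Vec.map (z *_) gens
        ; In-span = λ { (b , a , Ib , Ma , e) → let cs , Ics , e₁ = In-span Ib ; ds , Ids , e₂ = span Ma in
                      cs Vec.++ ds , VAllₚ.++⁺ Ics Ids , ≈-trans e (≈-trans (+-cong e₁ (≈-trans (*-congˡ e₂) (≈-sym (comb-scale z ds gens))))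
                        (≈-sym (comb-++ cs ds basis _))) }
        }
        where open FiniteModule B

      generated-by : ∀ zs → ∃[ B ] All (FiniteModule.In B) zs
      generated-by []       = regular , []
      generated-by (z ∷ zs) = let B , Izs = generated-by zs in
        extend B z ,
        (0# , 1# , FiniteModule.0-in B , 1-mem , solve 1 (λ z → z := con (+ 0) :+ z :* con (+ 1)) ≈-refl z) ∷
        All.map (λ {x} Ix → x , 0# , Ix , 0-mem , solve 2 (λ x z → x := x :+ z :* con (+ 0)) ≈-refl x z) Izs

      -- The powers of x span a finite-dimensional space, so x^r = x^(r+1) y for some r, and then x^r y^r is idempotent.
      nilpotent-or-nonzero : (∀ e → e * e ≈ e → (e ≈ 0#) ⊎ (e ≈ 1#)) → ∀ {x} → Mem A x → (∃[ r ] (x ^ r ≈ 0#)) ⊎ (¬ (x ≈ 0#))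
      nilpotent-or-nonzero connected {x} Mx = conclude (chain-stops (Vec.map const gens) W v W-mono W∋v in-span)
        where
        open Functions ⊤
        -- The exponents run downwards so that the spaces of multiples increase with j. The stopping
        -- index is at most `size`, so the truncated subtraction is exact where it matters.
        v : ℕ → V
        v j _ = x ^ (size ℕ.∸ j)
        W : ℕ → Subspace (c ⊔ ℓ)
        W j = record
          { _∋_   = λ u → ∃[ y ] (u tt ≈ x ^ (suc size ℕ.∸ j) * y)
          ; resp  = λ { u≈v (y , e) → y , ≈-trans (≈-sym (u≈v tt)) e }
          ; +-mem = λ { (y , e) (y′ , e′) → y + y′ , ≈-trans (+-cong e e′) (≈-sym (distribˡ _ _ _)) }
          ; scale = λ { q (y , e) → ι q * y , ≈-trans (*-congˡ e) (solve 3 (λ q X y → q :* (X :* y) := X :* (q :* y)) ≈-refl (ι q) (x ^ (suc size ℕ.∸ j)) y) }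
          }
        W-mono : ∀ j {u} → Subspace._∋_ (W j) u → Subspace._∋_ (W (suc j)) u
        W-mono j (y , e) = x ^ d * y , ≈-trans e (begin
          x ^ (suc size ℕ.∸ j) * y                 ≈⟨ *-congʳ (≈-reflexive (cong (x ^_) (≡.sym (ℕₚ.m+[n∸m]≡n (ℕₚ.∸-monoˡ-≤ j (ℕₚ.n≤1+n size)))))) ⟩
          x ^ ((size ℕ.∸ j) ℕ.+ d) * y             ≈⟨ *-congʳ (^-+ x (size ℕ.∸ j) d) ⟩
          x ^ (size ℕ.∸ j) * x ^ d * y             ≈⟨ *-assoc _ _ _ ⟩
          x ^ (size ℕ.∸ j) * (x ^ d * y)           ∎)
          where d = (suc size ℕ.∸ j) ℕ.∸ (size ℕ.∸ j)
        W∋v : ∀ j → Subspace._∋_ (W (suc j)) (v j)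
        W∋v j = 1# , ≈-sym (*-identityʳ _)
        in-span : ∀ j → ∃[ cs ] (Subspace._∋_ (W 0) (λ t → v j t - combV cs (Vec.map const gens) t))
        in-span j = let cs , _ , e = span (^-mem (size ℕ.∸ j) Mx) in cs , 0# , (begin
          x ^ (size ℕ.∸ j) - comb cs (Vec.map (λ g → g tt) (Vec.map const gens))   ≈⟨ +-congˡ (-‿cong (≈-reflexive (cong (comb cs) (≡.trans (≡.sym (Vecₚ.map-∘ _ const gens)) (Vecₚ.map-id gens))))) ⟩
          x ^ (size ℕ.∸ j) - comb cs gens                                          ≈⟨ x≈y⇒x-y≈0 e ⟩
          0#                                                                       ≈⟨ zeroʳ _ ⟨
          x ^ suc size * 0#                                                        ∎)
        conclude : ∃[ j ] (j ℕ.≤ size × Subspace._∋_ (W j) (v j)) → (∃[ r ] (x ^ r ≈ 0#)) ⊎ (¬ (x ≈ 0#))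
        conclude (j , j≤size , y , e) = [ (λ ε≈0 → inj₁ (r , ≈-trans x^r≈x^rε (≈-trans (*-congˡ ε≈0) (zeroʳ _)))) ,
                                          (λ ε≈1 → inj₂ (λ x≈0 → 1≉0 (≈-trans (≈-sym ε≈1) (ε≈0 x≈0)))) ]′ (connected ε ε²≈ε)
          where
          r = size ℕ.∸ j
          ε = x ^ r * y ^ r
          step : x ^ r ≈ x ^ r * (x * y)
          step = ≈-trans e (≈-trans (*-congʳ (≈-reflexive (cong (x ^_) (ℕₚ.+-∸-assoc 1 j≤size))))
            (solve 3 (λ x X y → (x :* X) :* y := X :* (x :* y)) ≈-refl x (x ^ r) y))
          steps : ∀ k → x ^ r ≈ x ^ r * (x * y) ^ k
          steps zero    = ≈-sym (*-identityʳ _)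
          steps (suc k) = ≈-trans step (≈-trans (*-congʳ (steps k)) (solve 3 (λ X z Z → X :* Z :* z := X :* (z :* Z)) ≈-refl (x ^ r) (x * y) ((x * y) ^ k)))
          x^r≈x^rε : x ^ r ≈ x ^ r * ε
          x^r≈x^rε = ≈-trans (steps r) (*-congˡ (*-^ x y r))
          ε²≈ε : ε * ε ≈ ε
          ε²≈ε = ≈-trans (solve 2 (λ X Y → X :* Y :* (X :* Y) := (X :* (X :* Y)) :* Y) ≈-refl (x ^ r) (y ^ r)) (*-congʳ (≈-sym x^r≈x^rε))
          -- This goes through `step` because r may be 0, in which case x ≈ 0 does not by itself
          -- make x^r vanish.
          ε≈0 : x ≈ 0# → ε ≈ 0#
          ε≈0 x≈0 = ≈-trans (*-congʳ (≈-trans step (≈-trans (*-congˡ (≈-trans (*-congʳ x≈0) (zeroˡ y))) (zeroʳ _)))) (zeroˡ _)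

    -- Vectors over a finite module with entries divisible by powers of p.

    Divisible : ℕ → Pred ℚ 0ℓ
    Divisible M q = ∃[ r ] (Integral r × q ≡ pℚ p (suc M) ℚ.* r)

    divisible-submodule : ∀ M → IsSubmodule Integral (Divisible M)
    divisible-submodule M = record
      { +-closed = λ { (r , Ir , e) (s , Is , e′) → r ℚ.+ s , integral-+ Ir Is , ≡.trans (cong₂ ℚ._+_ e e′) (≡.sym (ℚₚ.*-distribˡ-+ P r s)) }
      ; absorbs  = λ { {q} Iq (r , Ir , e) → q ℚ.* r , integral-* Iq Ir , ≡.trans (cong (q ℚ.*_) e)
                     (≡.trans (≡.sym (ℚₚ.*-assoc q P r)) (≡.trans (cong (ℚ._* r) (ℚₚ.*-comm q P)) (ℚₚ.*-assoc P q r))) }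
      }
      where P = pℚ p (suc M)

    divisible-separated : ∀ q → q ≢ 0ℚ → ∃[ M ] (¬ Divisible M q)
    divisible-separated q q≢0 = let M , h = not-infinitely-divisible q q≢0 in M , λ { (r , Ir , e) → h r Ir e }

    integral-isValuationRing : IsValuationRing Integral
    integral-isValuationRing = record { neg-closed = integral-neg ; total = integral-total }

    divisible-scale : ∀ M {n} {cs : Vec ℚ n} gs → VAll.All Integral cs →
      ∃[ ds ] (VAll.All (Divisible M) ds × comb ds gs ≈ ιp^ (suc M) * comb cs gs)
    divisible-scale M [] [] = [] , [] , ≈-sym (zeroʳ _)
    divisible-scale M {cs = q ∷ cs} (g ∷ gs) (Iq ∷ Ics) = let ds , Dds , e = divisible-scale M gs Ics in
      pℚ p (suc M) ℚ.* q ∷ ds , (q , Iq , ≡.refl) ∷ Dds , ≈-trans (+-cong (*-congʳ (ι-* (pℚ p (suc M)) q)) e)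
        (solve 4 (λ P q g x → P :* q :* g :+ P :* x := P :* (q :* g :+ x)) ≈-refl (ιp^ (suc M)) (ι q) g (comb cs gs))

    module ModuleCongruence {A : FiniteRing} (B : FiniteModule A) where
      open FiniteModule B
      open Congruence A

      infix 4 p^_∣ᴮ_
      record p^_∣ᴮ_ (M : ℕ) (x : Carrier) : Set (c ⊔ ℓ) where
        constructor multiple
        field
          {quotient}  : Carrier
          quotient-in : In quotient
          factors     : x ≈ ιp^ M * quotient

      ∣ᴮ-resp : ∀ {M x y} → x ≈ y → p^ M ∣ᴮ x → p^ M ∣ᴮ y
      ∣ᴮ-resp x≈y (multiple Ib e) = multiple Ib (≈-trans (≈-sym x≈y) e)

      ∣ᴮ-+ : ∀ {M x y} → p^ M ∣ᴮ x → p^ M ∣ᴮ y → p^ M ∣ᴮ x + y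
      ∣ᴮ-+ (multiple Ib e) (multiple Ib′ e′) = multiple (+-in Ib Ib′) (≈-trans (+-cong e e′) (≈-sym (distribˡ _ _ _)))

      ∣ᴮ-act : ∀ {M x y} → Mem A x → p^ M ∣ᴮ y → p^ M ∣ᴮ x * y
      ∣ᴮ-act {M} {x} Mx (multiple {b} Ib e) = multiple (act Mx Ib)
        (≈-trans (*-congˡ e) (solve 3 (λ x P b → x :* (P :* b) := P :* (x :* b)) ≈-refl x (ιp^ M) b))

      ∣-∣ᴮ : ∀ {M x y} → p^ M ∣ x → In y → p^ M ∣ᴮ x * y
      ∣-∣ᴮ (multiple Ma e) Iy = multiple (act Ma Iy) (≈-trans (*-congʳ e) (*-assoc _ _ _))

      ∣ᴮ-neg : ∀ {M x} → p^ M ∣ᴮ x → p^ M ∣ᴮ - x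
      ∣ᴮ-neg {x = x} d = ∣ᴮ-resp (solve 1 (λ x → (:- con (+ 1)) :* x := :- x) ≈-refl x)
        (∣ᴮ-act (FiniteRing.neg-mem A (FiniteRing.1-mem A)) d)

      ∣ᴮ-∑ : ∀ {M} n {f : Fin n → Carrier} → (∀ i → p^ M ∣ᴮ f i) → p^ M ∣ᴮ ∑ n f
      ∣ᴮ-∑ zero    ds = multiple 0-in (≈-sym (zeroʳ _))
      ∣ᴮ-∑ (suc n) ds = ∣ᴮ-+ (ds zero) (∣ᴮ-∑ n (ds ∘ suc))

      cons-with : ∀ {t} → Carrier → (Fin t → Carrier) → Fin (suc t) → Carrier
      cons-with x v zero    = x
      cons-with x v (suc σ) = v σ

      -- Generators of the direct sum of t copies of the module. Separation is applied to whole
      -- vectors rather than coordinate by coordinate, because the condition on the sum of the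
      -- weights ties the coordinates together.
      function-basis : ∀ t → Vec (Fin t → Carrier) (t ℕ.* rank)
      function-basis zero    = []
      function-basis (suc t) = Vec.map (λ g → cons-with g (const 0#)) basis Vec.++ Vec.map (cons-with 0#) (function-basis t)

      comb-0s : ∀ {n} (cs : Vec ℚ n) → comb cs (Vec.replicate n 0#) ≈ 0#
      comb-0s []       = ≈-refl
      comb-0s (q ∷ cs) = ≈-trans (+-cong (zeroʳ _) (comb-0s cs)) (+-identityˡ 0#)

      function-span : ∀ t {M} (v : Fin t → Carrier) → (∀ σ → p^ suc M ∣ᴮ v σ) →
        ∃[ cs ] (VAll.All (Divisible M) cs × (∀ σ → v σ ≈ Functions.combV (Fin t) cs (function-basis t) σ))
      function-span zero v d = [] , [] , λ ()
      function-span (suc t) {M} v d with d zero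
      ... | multiple Ib e =
        let cs , Ics , e₁ = In-span Ib
            ds , Dds , e₂ = divisible-scale M basis Ics
            ds′ , Dds′ , e₃ = function-span t (v ∘ suc) (d ∘ suc)
        in ds Vec.++ ds′ , VAllₚ.++⁺ Dds Dds′ , λ
          { zero → begin
              v zero                                              ≈⟨ ≈-trans e (≈-trans (*-congˡ e₁) (≈-sym e₂)) ⟩
              comb ds basis                                       ≈⟨ +-identityʳ _ ⟨
              comb ds basis + 0#                                  ≈⟨ +-congˡ (comb-0s ds′) ⟨
              comb ds basis + comb ds′ (Vec.replicate _ 0#)       ≈⟨ comb-++ ds ds′ basis _ ⟨
              comb (ds Vec.++ ds′) (basis Vec.++ Vec.replicate _ 0#) ≈⟨ ≈-reflexive (cong (comb (ds Vec.++ ds′)) (components zero basis (function-basis t) (≡.trans (≡.sym (Vecₚ.map-∘ _ _ basis)) (Vecₚ.map-id basis)) (≡.trans (≡.sym (Vecₚ.map-∘ _ _ (function-basis t))) (Vecₚ.map-const (function-basis t) 0#)))) ⟨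
              _                                                   ∎
          ; (suc σ) → begin
              v (suc σ)                                           ≈⟨ e₃ σ ⟩
              comb ds′ (Vec.map (λ g → g σ) (function-basis t))   ≈⟨ +-identityˡ _ ⟨
              0# + comb ds′ (Vec.map (λ g → g σ) (function-basis t))  ≈⟨ +-congʳ (comb-0s ds) ⟨
              comb ds (Vec.replicate _ 0#) + comb ds′ (Vec.map (λ g → g σ) (function-basis t))  ≈⟨ comb-++ ds ds′ _ _ ⟨
              comb (ds Vec.++ ds′) (Vec.replicate _ 0# Vec.++ Vec.map (λ g → g σ) (function-basis t)) ≈⟨ ≈-reflexive (cong (comb (ds Vec.++ ds′)) (components (suc σ) basis (function-basis t) (≡.trans (≡.sym (Vecₚ.map-∘ _ _ basis)) (Vecₚ.map-const basis 0#)) (≡.sym (Vecₚ.map-∘ _ _ (function-basis t))))) ⟨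
              _                                                   ∎ }
        where
        components : ∀ σ (gs : Vec Carrier rank) (hs : Vec (Fin t → Carrier) (t ℕ.* rank)) {gs′ hs′} →
          Vec.map (λ g → g σ) (Vec.map (λ g → cons-with g (const 0#)) gs) ≡ gs′ → Vec.map (λ g → g σ) (Vec.map (cons-with 0#) hs) ≡ hs′ →
          Vec.map (λ g → g σ) (Vec.map (λ g → cons-with g (const 0#)) gs Vec.++ Vec.map (cons-with 0#) hs) ≡ gs′ Vec.++ hs′
        components σ gs hs ≡.refl ≡.refl = Vecₚ.map-++ (λ g → g σ) (Vec.map (λ g → cons-with g (const 0#)) gs) (Vec.map (cons-with 0#) hs)

    -- The ℚ-span of `A`. Separation works modulo a ℚ-subspace, so its solutions have denominators;
    -- recording an integer denominator takes the question of nilpotency back to `A`.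
    record Algebraic (A : FiniteRing) (y : Carrier) : Set (c ⊔ ℓ) where
      constructor algebraic
      field
        denominator  : ℤ
        nonzero      : denominator ≢ + 0
        numerator-mem : Mem A (ι (fromℤ denominator) * y)

    module _ {A : FiniteRing} where
      open FiniteRing A using (resp; +-mem; *-mem; ι-mem)

      algebraic-mem : ∀ {y} → Mem A y → Algebraic A y
      algebraic-mem {y} My = algebraic (+ 1) (λ ()) (*-mem (ι-mem (integral-fromℤ (+ 1))) My)

      private
        nonzero-* : ∀ {i j} → i ≢ + 0 → j ≢ + 0 → i ℤ.* j ≢ + 0
        nonzero-* {i} i≢0 j≢0 ij≡0 = [ i≢0 , j≢0 ]′ (ℤₚ.i*j≡0⇒i≡0∨j≡0 i ij≡0)

        ι-fromℤ-* : ∀ i j → ι (fromℤ (i ℤ.* j)) ≈ ι (fromℤ i) * ι (fromℤ j)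
        ι-fromℤ-* i j = ≈-trans (ι-cong (fromℤ-* i j)) (ι-* _ _)

      algebraic-resp : ∀ {x y} → x ≈ y → Algebraic A x → Algebraic A y
      algebraic-resp x≈y (algebraic i i≢0 Mx) = algebraic i i≢0 (resp (*-congˡ x≈y) Mx)

      algebraic-+ : ∀ {x y} → Algebraic A x → Algebraic A y → Algebraic A (x + y)
      algebraic-+ {x} {y} (algebraic i i≢0 Mx) (algebraic j j≢0 My) = algebraic (i ℤ.* j) (nonzero-* i≢0 j≢0)
        (resp (≈-trans (solve 4 (λ i j x y → j :* (i :* x) :+ i :* (j :* y) := i :* j :* (x :+ y)) ≈-refl (ι (fromℤ i)) (ι (fromℤ j)) x y) (*-congʳ (≈-sym (ι-fromℤ-* i j))))
          (+-mem (*-mem (ι-mem (integral-fromℤ j)) Mx) (*-mem (ι-mem (integral-fromℤ i)) My)))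

      algebraic-scale : ∀ {x} q → Algebraic A x → Algebraic A (ι q * x)
      algebraic-scale {x} q (algebraic i i≢0 Mx) = algebraic (↧ q ℤ.* i) (nonzero-* {↧ q} (λ ()) i≢0)
        (resp (begin
          ι (fromℤ (↥ q)) * (ι (fromℤ i) * x)              ≈⟨ *-congʳ (≈-trans (≈-sym (ι-* _ q)) (ι-cong (clear-denominator q))) ⟨
          ι (fromℤ (↧ q)) * ι q * (ι (fromℤ i) * x)        ≈⟨ solve 4 (λ d q i x → d :* q :* (i :* x) := d :* i :* (q :* x)) ≈-refl (ι (fromℤ (↧ q))) (ι q) (ι (fromℤ i)) x ⟩
          ι (fromℤ (↧ q)) * ι (fromℤ i) * (ι q * x)        ≈⟨ *-congʳ (ι-fromℤ-* (↧ q) i) ⟨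
          ι (fromℤ (↧ q ℤ.* i)) * (ι q * x)                ∎) (*-mem (ι-mem (integral-fromℤ (↥ q))) Mx))

      algebraic-sub : ∀ {x y} → Algebraic A x → Algebraic A y → Algebraic A (x - y)
      algebraic-sub {x} {y} ax ay = algebraic-resp
        (+-congˡ (≈-trans (*-congʳ (≈-trans (ι-neg 1ℚ) (-‿cong ι-1))) (solve 1 (λ y → (:- con (+ 1)) :* y := :- y) ≈-refl y)))
        (algebraic-+ ax (algebraic-scale (ℚ.- 1ℚ) ay))

      algebraic-nilpotent-or-nonzero : (∀ e → e * e ≈ e → (e ≈ 0#) ⊎ (e ≈ 1#)) → ∀ {y} → Algebraic A y → (∃[ r ] (y ^ r ≈ 0#)) ⊎ (¬ (y ≈ 0#))
      algebraic-nilpotent-or-nonzero connected {y} (algebraic i i≢0 My) = [ inj₁ ∘ nilpotent , (λ h → inj₂ (λ y≈0 → h (≈-trans (*-congˡ y≈0) (zeroʳ _)))) ]′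
          (nilpotent-or-nonzero A connected My)
        where
        d = ι (fromℤ i)
        d≉0 : ¬ (d ≈ 0#)
        d≉0 = ι-≉0 (i≢0 ∘ fromℤ-nonZero {i})
        nilpotent : ∃[ r ] ((d * y) ^ r ≈ 0#) → ∃[ r ] (y ^ r ≈ 0#)
        nilpotent (r , e) = r , cancel-≉0 (^-≉0 r d≉0) (≈-trans (≈-sym (*-^ d y r)) e)

    -- Weights of the tuples of roots of unity, approximate and exact.

    module Core (A : FiniteRing) (B : FiniteModule A) {s} (κ : Fin s → Carrier) (κ-in : ∀ i → FiniteModule.In B (κ i))
                {e} (τs : Vec Carrier (suc e)) (τs-mem : ∀ j → Mem A (Vec.lookup τs j))
                (τs-product : ∀ x → linear-product τs x ≈ x ^ suc e - 1#)
                (τs-cofactors : ∀ x → ∑ (suc e) (cofactor τs x) ≈ ι (fromℤ (+ suc e)) * x ^ e) where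
      open FiniteRing A using (resp; +-mem; *-mem; neg-mem; 1-mem; ^-mem)
      open Congruence A
      open ModuleCongruence B

      -- κᵢ wᵢ stands for fᵢ(a) λᵢ^n, where n is an integer close to a.
      record Approximation (M : ℕ) : Set (c ⊔ ℓ) where
        field
          w w⁻       : Fin s → Carrier
          w-mem      : ∀ i → Mem A (w i)
          w⁻-mem     : ∀ i → Mem A (w⁻ i)
          w-unit     : ∀ i → w i * w⁻ i ≈ 1#
          w-torsion  : ∀ i → p^ M ∣ w i ^ suc e - 1#
          relation   : p^ M ∣ᴮ ∑ s (λ i → κ i * w i)

      Σκ : Fin (suc e ℕ.^ s) → Carrier
      Σκ σ = ∑ s (λ i → κ i * Vec.lookup τs (Fin.finToFun σ i))

      linear-product-mem : ∀ {n} (τs : Vec Carrier n) {x} → (∀ j → Mem A (Vec.lookup τs j)) → Mem A x → Mem A (linear-product τs x)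
      linear-product-mem []       h Mx = 1-mem
      linear-product-mem (τ ∷ τs) h Mx = *-mem (+-mem Mx (neg-mem (h zero))) (linear-product-mem τs (h ∘ suc) Mx)

      cofactor-mem : ∀ {n} (τs : Vec Carrier n) {x} → (∀ j → Mem A (Vec.lookup τs j)) → Mem A x → ∀ j → Mem A (cofactor τs x j)
      cofactor-mem (τ ∷ τs) h Mx zero    = linear-product-mem τs (h ∘ suc) Mx
      cofactor-mem (τ ∷ τs) h Mx (suc j) = *-mem (+-mem Mx (neg-mem (h zero))) (cofactor-mem τs (h ∘ suc) Mx j)

      ∏-mem : ∀ n {f : Fin n → Carrier} → (∀ i → Mem A (f i)) → Mem A (∏ n f)
      ∏-mem zero    h = 1-mem
      ∏-mem (suc n) h = *-mem (h zero) (∏-mem n (h ∘ suc))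

      ∏-∣ : ∀ n {M} {f : Fin n → Carrier} → (∀ i → Mem A (f i)) → ∀ i {z} → p^ M ∣ f i * z → p^ M ∣ ∏ n f * z
      ∏-∣ (suc n) {f = f} h zero {z} d = ∣-resp (solve 3 (λ a b z → (a :* z) :* b := a :* b :* z) ≈-refl (f zero) (∏ n (f ∘ suc)) z) (∣-*ʳ d (∏-mem n (h ∘ suc)))
      ∏-∣ (suc n) {f = f} h (suc i) {z} d = ∣-resp (≈-sym (*-assoc _ _ _)) (∣-*ˡ (h zero) (∏-∣ n (h ∘ suc) i d))

      module Weights {M} (approx : Approximation M) where
        open Approximation approx

        factor : Fin s → Fin (suc e) → Carrier
        factor i j = w⁻ i ^ e * cofactor τs (w i) j

        factor-mem : ∀ i j → Mem A (factor i j)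
        factor-mem i j = *-mem (^-mem e (w⁻-mem i)) (cofactor-mem τs τs-mem (w-mem i) j)

        weight : Fin (suc e ℕ.^ s) → Carrier
        weight σ = ∏ s (λ i → factor i (Fin.finToFun σ i))

        weight-mem : ∀ σ → Mem A (weight σ)
        weight-mem σ = ∏-mem s (λ i → factor-mem i (Fin.finToFun σ i))

        -- The power of `w⁻` in each factor makes the sum independent of `w`, and therefore of `M`.
        -- Weights of different precision thus have differences of sum 0.
        ∑-weight : ∑ (suc e ℕ.^ s) weight ≈ ∏ s (λ _ → ι (fromℤ (+ suc e)))
        ∑-weight = ≈-trans (∑∏-finToFun (suc e) s factor) (∏-cong s (λ i → begin
          ∑ (suc e) (factor i)                                    ≈⟨ ∑-*ˡ (suc e) (w⁻ i ^ e) (cofactor τs (w i)) ⟩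
          w⁻ i ^ e * ∑ (suc e) (cofactor τs (w i))                ≈⟨ *-congˡ (τs-cofactors (w i)) ⟩
          w⁻ i ^ e * (ι (fromℤ (+ suc e)) * w i ^ e)              ≈⟨ solve 3 (λ a n b → a :* (n :* b) := n :* (b :* a)) ≈-refl (w⁻ i ^ e) (ι (fromℤ (+ suc e))) (w i ^ e) ⟩
          ι (fromℤ (+ suc e)) * (w i ^ e * w⁻ i ^ e)              ≈⟨ *-congˡ (^-inverse e (w-unit i)) ⟩
          ι (fromℤ (+ suc e)) * 1#                                ≈⟨ *-identityʳ _ ⟩
          ι (fromℤ (+ suc e))                                     ∎))

        factor-∣ : ∀ i j → p^ M ∣ factor i j * (w i - Vec.lookup τs j)
        factor-∣ i j = ∣-resp (≈-trans (*-congˡ (≈-sym (≈-trans (cofactor-factor τs (w i) j) (τs-product (w i))))) (≈-sym (*-assoc _ _ _)))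
          (∣-*ˡ (^-mem e (w⁻-mem i)) (w-torsion i))

        weight-∣ : ∀ σ → p^ M ∣ᴮ weight σ * Σκ σ
        weight-∣ σ = ∣ᴮ-resp (begin
          y * D - ∑ s (λ i → (y * (w i - τ i)) * κ i)        ≈⟨ +-congˡ (-‿cong (begin
            ∑ s (λ i → (y * (w i - τ i)) * κ i)                  ≈⟨ ∑-cong s (λ i → solve 4 (λ y w t k → (y :* (w :- t)) :* k := y :* (k :* w :- k :* t)) ≈-refl y (w i) (τ i) (κ i)) ⟩
            ∑ s (λ i → y * (κ i * w i - κ i * τ i))              ≈⟨ ∑-*ˡ s y _ ⟩
            y * ∑ s (λ i → κ i * w i - κ i * τ i)                ≈⟨ *-congˡ (∑-sub s _ _) ⟩
            y * (D - Σκ σ)                                       ∎)) ⟩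
          y * D - y * (D - Σκ σ)                             ≈⟨ solve 3 (λ y D S → y :* D :- y :* (D :- S) := y :* S) ≈-refl y D (Σκ σ) ⟩
          y * Σκ σ                                           ∎)
          (∣ᴮ-+ (∣ᴮ-act (weight-mem σ) relation) (∣ᴮ-neg (∣ᴮ-∑ s (λ i → ∣-∣ᴮ (∏-∣ s (λ i → factor-mem i (Fin.finToFun σ i)) i (factor-∣ i (Fin.finToFun σ i))) (κ-in i)))))
          where
          y = weight σ
          D = ∑ s (λ i → κ i * w i)
          τ : Fin s → Carrier
          τ i = Vec.lookup τs (Fin.finToFun σ i)

      private T = Fin (suc e ℕ.^ s)
      open Functions T

      -- Weights for different M have the same sum.  So modulo the space W of all y · Σκ with Σ y = 0, the vector target
      -- coincides with weight M · Σκ for every M, and separation applies.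
      exact-weights : (∀ M → Approximation (suc M)) →
        ∃[ y ] ((∀ σ → Algebraic A (y σ)) × ∑ (suc e ℕ.^ s) y ≈ ∏ s (λ _ → ι (fromℤ (+ suc e))) × (∀ σ → y σ * Σκ σ ≈ 0#))
      exact-weights approx = exact
          (Elimination.Separation.separation integral-isValuationRing W Divisible divisible-submodule divisible-separated (function-basis _) target approximate)
        where
        module Y M = Weights (approx M)
        W : Subspace (c ⊔ ℓ)
        W = record
          { _∋_   = λ v → ∃[ z ] ((∀ σ → Algebraic A (z σ)) × ∑ (suc e ℕ.^ s) z ≈ 0# × (∀ σ → v σ ≈ z σ * Σκ σ))
          ; resp  = λ { u≈v (z , az , ∑z , eq) → z , az , ∑z , λ σ → ≈-trans (≈-sym (u≈v σ)) (eq σ) }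
          ; +-mem = λ { (z , az , ∑z , eq) (z′ , az′ , ∑z′ , eq′) → (λ σ → z σ + z′ σ) , (λ σ → algebraic-+ (az σ) (az′ σ)) ,
                      ≈-trans (∑-+ _ z z′) (≈-trans (+-cong ∑z ∑z′) (+-identityˡ 0#)) , λ σ → ≈-trans (+-cong (eq σ) (eq′ σ)) (≈-sym (distribʳ _ _ _)) }
          ; scale = λ { q (z , az , ∑z , eq) → (λ σ → ι q * z σ) , (λ σ → algebraic-scale q (az σ)) ,
                      ≈-trans (∑-*ˡ _ (ι q) z) (≈-trans (*-congˡ ∑z) (zeroʳ _)) , λ σ → ≈-trans (*-congˡ (eq σ)) (≈-sym (*-assoc _ _ _)) }
          }
        open Subspace W using (_∋_)
        target : V
        target σ = Y.weight 0 σ * Σκ σ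
        approximate : ∀ M → ∃[ cs ] (VAll.All (Divisible M) cs × _∋_ (λ σ → target σ - combV cs (function-basis (suc e ℕ.^ s)) σ))
        approximate M = let cs , Dcs , eq = function-span (suc e ℕ.^ s) (λ σ → Y.weight M σ * Σκ σ) (Y.weight-∣ M) in
          cs , Dcs , (λ σ → Y.weight 0 σ - Y.weight M σ) ,
          (λ σ → algebraic-sub (algebraic-mem (Y.weight-mem 0 σ)) (algebraic-mem (Y.weight-mem M σ))) ,
          ≈-trans (∑-sub _ (Y.weight 0) (Y.weight M)) (x≈y⇒x-y≈0 (≈-trans (Y.∑-weight 0) (≈-sym (Y.∑-weight M)))) ,
          (λ σ → ≈-trans (+-congˡ (-‿cong (≈-sym (eq σ)))) (solve 3 (λ a b S → a :* S :- b :* S := (a :- b) :* S) ≈-refl (Y.weight 0 σ) (Y.weight M σ) (Σκ σ)))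
        exact : _∋_ target → ∃[ y ] ((∀ σ → Algebraic A (y σ)) × ∑ (suc e ℕ.^ s) y ≈ ∏ s (λ _ → ι (fromℤ (+ suc e))) × (∀ σ → y σ * Σκ σ ≈ 0#))
        exact (z , az , ∑z≈0 , eq) = (λ σ → Y.weight 0 σ - z σ) , (λ σ → algebraic-sub (algebraic-mem (Y.weight-mem 0 σ)) (az σ)) ,
          ≈-trans (∑-sub _ (Y.weight 0) z) (≈-trans (+-cong (Y.∑-weight 0) (-‿cong ∑z≈0)) (solve 1 (λ x → x :- con (+ 0) := x) ≈-refl _)) ,
          λ σ → ≈-trans (solve 3 (λ a b S → (a :- b) :* S := a :* S :- b :* S) ≈-refl (Y.weight 0 σ) (z σ) (Σκ σ)) (x≈y⇒x-y≈0 (eq σ))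

    -- Choice of the ring: the λᵢ, their inverses and d-th roots, and roots of unity.

    charPoly-mem : ∀ A m {coef : Fin m → ℚ} → (∀ i → Integral (coef i)) → All (Mem A) (List.tabulate (λ i → - ι (coef i)))
    charPoly-mem A m Ic = Allₚ.tabulate⁺ (λ i → FiniteRing.neg-mem A (FiniteRing.ι-mem A (Ic i)))

    -- The characteristic equation reads x G(x) = a₀ with `G` built from the remaining coefficients.
    -- Regularity makes 1/a₀ p-integral, so G(x)/a₀ is an inverse in `A`. At order 0 the polynomial
    -- is the constant 1 and has no root.
    root-inverse : ∀ A m {coef} → RegularPrime p m coef → ∀ {x} → Mem A x → eval (charPoly K E m coef) x ≈ 0# → ∃[ x′ ] (Mem A x′ × x * x′ ≈ 1#)
    root-inverse A zero    regular {x} Mx root = ⊥-elim (1≉0 (≈-trans (solve 1 (λ x → con (+ 1) := con (+ 1) :+ x :* con (+ 0)) ≈-refl x) root))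
    root-inverse A (suc m) {coef} (p∤den , p∤num) {x} Mx root =
      let r , Ir , ra₀≡1 = integral-recip (coef zero) p∤num
          G = eval (charPoly K E m (coef ∘ suc)) x
      in G * ι r , *-mem (subst (λ F → Mem A (eval F x)) (≡.sym (charPoly-monic m (coef ∘ suc)))
           (FiniteModule.eval-in (regular A) (Allₚ.++⁺ (charPoly-mem A m (λ i → integral-denominator _ (p∤den (suc i)))) (1-mem ∷ [])) Mx)) (ι-mem Ir) , (begin
        x * (G * ι r)           ≈⟨ *-assoc _ _ _ ⟨
        x * G * ι r             ≈⟨ *-congʳ (x-y≈0⇒x≈y (≈-trans (+-comm _ _) root)) ⟩
        ι (coef zero) * ι r     ≈⟨ ≈-trans (*-comm _ _) (≈-sym (ι-* r (coef zero))) ⟩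
        ι (r ℚ.* coef zero)     ≈⟨ ≈-trans (ι-cong ra₀≡1) ι-1 ⟩
        1#                      ∎)
      where open FiniteRing A hiding (Mem)

    binomial-mem : ∀ A e {b} → Mem A b → All (Mem A) (binomial b e)
    binomial-mem A e Mb = FiniteRing.neg-mem A Mb ∷ Allₚ.replicate⁺ e (FiniteRing.0-mem A)

    binomial-root : ∀ A e {b x} → Mem A b → x ^ suc e ≈ b → MonicRoot A x
    binomial-root A e {b} {x} Mb eq = binomial b e , binomial-mem A e Mb , ≈-trans (eval-binomial b e x) (x≈y⇒x-y≈0 eq)

    ∣-⊑ : ∀ {A A′} → A ⊑ A′ → ∀ {M x} → Congruence.p^_∣_ A M x → Congruence.p^_∣_ A′ M x
    ∣-⊑ sub (Congruence.multiple My e) = Congruence.multiple (sub My) e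

    module _ (A : FiniteRing) where
      open FiniteRing A using (neg-mem; ^-mem)
      open Congruence A

      zpow-mem : ∀ {x x′} → Mem A x → Mem A x′ → ∀ z → Mem A (zpow x x′ z)
      zpow-mem Mx Mx′ (+ n)    = ^-mem n Mx
      zpow-mem Mx Mx′ -[1+ n ] = ^-mem (suc n) Mx′

      ≡1-^-multiple : ∀ {x M} E k → Mem A x → p^ M ∣ x ^ E - 1# → p^ M ∣ (x ^ k) ^ E - 1#
      ≡1-^-multiple {x} E k Mx d = ∣-resp (+-congʳ (≈-trans (≈-sym (^-*′ x E k)) (^-* x E k))) (≡1-^ k (^-mem E Mx) d)

      zpow-≡1 : ∀ {x x′ M} E → Mem A x → Mem A x′ → p^ M ∣ x ^ E - 1# → p^ M ∣ x′ ^ E - 1# → ∀ z → p^ M ∣ zpow x x′ z ^ E - 1#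
      zpow-≡1 E Mx Mx′ d d′ (+ n)    = ≡1-^-multiple E n Mx d
      zpow-≡1 E Mx Mx′ d d′ -[1+ n ] = ≡1-^-multiple E (suc n) Mx′ d′

      inverse-≡1 : ∀ {x x′ M} E → Mem A x′ → x * x′ ≈ 1# → p^ M ∣ x ^ E - 1# → p^ M ∣ x′ ^ E - 1#
      inverse-≡1 {x} {x′} E Mx′ xx′≈1 d = ∣-resp (begin
        (- (x′ ^ E)) * (x ^ E - 1#)      ≈⟨ solve 2 (λ y x → (:- y) :* (x :- con (+ 1)) := y :- x :* y) ≈-refl (x′ ^ E) (x ^ E) ⟩
        x′ ^ E - x ^ E * x′ ^ E          ≈⟨ +-congˡ (-‿cong (^-inverse E xx′≈1)) ⟩
        x′ ^ E - 1#                      ∎) (∣-*ˡ (neg-mem (^-mem E Mx′)) d)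

      common-exponent : ∀ n {x : Fin n → Carrier} → (∀ i → Mem A (x i)) → (∀ i → ∃[ e ] (p^ 1 ∣ x i ^ suc e - 1#)) →
        ∃[ e ] (∀ i → p^ 1 ∣ x i ^ suc e - 1#)
      common-exponent zero    Mx h = 0 , λ ()
      common-exponent (suc n) {x} Mx h =
        let e , d = common-exponent n (Mx ∘ suc) (h ∘ suc)
            e₀ , d₀ = h zero
        -- One less than the product of the exponents `suc e` and `suc e₀`.
        in e ℕ.+ e₀ ℕ.* suc e , λ
          { zero    → ∣-resp (+-congʳ (≈-sym (^-*′ (x zero) (suc e₀) (suc e)))) (≡1-^ (suc e) (^-mem (suc e₀) (Mx zero)) d₀)
          ; (suc i) → ∣-resp (+-congʳ (≈-sym (^-* (x (suc i)) (suc e₀) (suc e)))) (≡1-^ (suc e₀) (^-mem (suc e) (Mx (suc i))) (d i)) }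

    -- Everything that is chosen before the precision `M`. In particular the exponent `suc e` is
    -- fixed, so the tuples of roots of unity form one finite index set for all `M`.
    record Setting {s} (lam : Fin s → Carrier) (f : Fin s → List Carrier) (d : ℕ) : Set (lsuc (c ⊔ ℓ)) where
      field
        A             : FiniteRing
        μ μ⁻          : Fin s → Carrier
        μ∈A           : ∀ i → Mem A (μ i)
        μ⁻∈A          : ∀ i → Mem A (μ⁻ i)
        μ-unit        : ∀ i → μ i * μ⁻ i ≈ 1#
        μ^≈lam        : ∀ i → μ i ^ d ≈ lam i
        e             : ℕ
        μ-torsion     : ∀ i → Congruence.p^_∣_ A 1 (μ i ^ suc e - 1#)
        τs            : Vec Carrier (suc e)
        τs∈A          : ∀ j → Mem A (Vec.lookup τs j)
        τ^≈1          : ∀ j → Vec.lookup τs j ^ suc e ≈ 1#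
        τs-product    : ∀ x → linear-product τs x ≈ x ^ suc e - 1#
        τs-cofactors  : ∀ x → ∑ (suc e) (cofactor τs x) ≈ ι (fromℤ (+ suc e)) * x ^ e
        B             : FiniteModule A
        f∈B           : ∀ i → All (FiniteModule.In B) (f i)

    linear-product-root : ∀ {n k} (τs : Vec Carrier n) → (∀ x → linear-product τs x ≈ x ^ k - 1#) → ∀ j → Vec.lookup τs j ^ k ≈ 1#
    linear-product-root τs product j = x-y≈0⇒x≈y (≈-trans (≈-sym (product τ)) (≈-trans (≈-sym (cofactor-factor τs τ j))
      (≈-trans (*-congˡ (-‿inverseʳ τ)) (zeroʳ _))))
      where τ = Vec.lookup τs j

    module AdjoinRootsOfUnity (A₂ : FiniteRing) {s} {lam μ μ⁻ : Fin s → Carrier} {d}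
                              (μ∈A₂ : ∀ i → Mem A₂ (μ i)) (μ⁻∈A₂ : ∀ i → Mem A₂ (μ⁻ i))
                              (μ-unit : ∀ i → μ i * μ⁻ i ≈ 1#) (μ^≈lam : ∀ i → μ i ^ d ≈ lam i) (f : Fin s → List Carrier) where

      setting : Setting lam f d
      -- The exponent comes from the pigeonhole principle in `A₂`, so the roots of unity can be
      -- adjoined only afterwards; congruences in `A₂` persist in the larger ring.
      setting = with-exponent (common-exponent A₂ s μ∈A₂ (λ i → Congruence.unit-^≡1 A₂ (μ∈A₂ i) (μ⁻∈A₂ i) (μ-unit i)))
        where
        module _ {e} (torsion : ∀ i → Congruence.p^_∣_ A₂ 1 (μ i ^ suc e - 1#)) {τs : Vec Carrier (suc e)}
                 (product : ∀ x → linear-product τs x ≈ x ^ suc e - 1#)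
                 (cofactors : ∀ x → ∑ (suc e) (cofactor τs x) ≈ ι (fromℤ (+ suc e)) * x ^ e)
                 (τ^≈1 : ∀ j → Vec.lookup τs j ^ suc e ≈ 1#) where
          with-ring : (A : FiniteRing) → A₂ ⊑ A → (∀ j → Mem A (Vec.lookup τs j)) →
            ∃[ B ] All (FiniteModule.In {A} B) (List.concat (List.tabulate f)) → Setting lam f d
          with-ring A A₂⊑A τs∈A (B , f∈B) = record
            { A = A ; μ = μ ; μ⁻ = μ⁻
            ; μ∈A = λ i → A₂⊑A (μ∈A₂ i) ; μ⁻∈A = λ i → A₂⊑A (μ⁻∈A₂ i) ; μ-unit = μ-unit ; μ^≈lam = μ^≈lam
            ; e = e ; μ-torsion = λ i → ∣-⊑ {A₂} {A} A₂⊑A (torsion i)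
            ; τs = τs ; τs∈A = τs∈A ; τ^≈1 = τ^≈1 ; τs-product = product ; τs-cofactors = cofactors
            ; B = B ; f∈B = Allₚ.tabulate⁻ (Allₚ.concat⁻ f∈B)
            }
        with-exponent : ∃[ e ] (∀ i → Congruence.p^_∣_ A₂ 1 (μ i ^ suc e - 1#)) → Setting lam f d
        with-exponent (e , torsion) =
          let τs , product , cofactors = roots-of-unity e
              τ^≈1 = linear-product-root {k = suc e} τs product
              A , A₂⊑A , τs∈A = adjoin-all (suc e) A₂ (Vec.lookup τs) (λ j → binomial-root A₂ e (FiniteRing.1-mem A₂) (τ^≈1 j))
          in with-ring torsion {τs} product cofactors τ^≈1 A (λ {x} → A₂⊑A {x}) τs∈A (generated-by A (List.concat (List.tabulate f)))

    module AdjoinRoots (A₁ : FiniteRing) {s} {lam : Fin s → Carrier} (lam∈A₁ : ∀ i → Mem A₁ (lam i))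
                       (lam⁻ : ∀ i → ∃[ x ] (Mem A₁ x × lam i * x ≈ 1#)) (f : Fin s → List Carrier) (d-1 : ℕ) where

      setting : Setting lam f (suc d-1)
      setting = with-roots (λ i → proj₁ (root-extraction (lam i) d-1)) (λ i → proj₂ (root-extraction (lam i) d-1))
        where
        with-roots : (μ : Fin s → Carrier) → (∀ i → μ i ^ suc d-1 ≈ lam i) → Setting lam f (suc d-1)
        with-roots μ μ^≈lam = with-ring (adjoin-all s A₁ μ (λ i → binomial-root A₁ d-1 (lam∈A₁ i) (μ^≈lam i)))
          where
          with-ring : ∃[ A₂ ] (A₁ ⊑ A₂ × (∀ i → Mem A₂ (μ i))) → Setting lam f (suc d-1)
          with-ring (A₂ , A₁⊑A₂ , μ∈A₂) = AdjoinRootsOfUnity.setting A₂ μ∈A₂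
            -- The inverse of μᵢ is taken to be μᵢ^(d-1) λᵢ⁻¹, which visibly lies in `A₂`.
            (λ i → FiniteRing.*-mem A₂ (FiniteRing.^-mem A₂ d-1 (μ∈A₂ i)) (A₁⊑A₂ (proj₁ (proj₂ (lam⁻ i)))))
            (λ i → ≈-trans (≈-sym (*-assoc _ _ _)) (≈-trans (*-congʳ (μ^≈lam i)) (proj₂ (proj₂ (lam⁻ i))))) μ^≈lam f

    setting : ∀ {m} {coef : Fin m → ℚ} → RegularPrime p m coef → ∀ {s} {lam : Fin s → Carrier} →
      (∀ i → eval (charPoly K E m coef) (lam i) ≈ 0#) → ∀ f d-1 → Setting lam f (suc d-1)
    setting {m} {coef} prime-regular {s} {lam} roots f d-1 = with-ring (adjoin-all s rationals lam (λ i →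
        List.tabulate (λ i → - ι (coef i)) ,
        charPoly-mem rationals m (λ i → integral-denominator _ (proj₁ prime-regular i)) ,
        subst (λ F → eval F (lam i) ≈ 0#) (charPoly-monic m coef) (roots i)))
      where
      with-ring : ∃[ A₁ ] (rationals ⊑ A₁ × (∀ i → Mem A₁ (lam i))) → Setting lam f (suc d-1)
      with-ring (A₁ , _ , lam∈A₁) = AdjoinRoots.setting A₁ lam∈A₁ (λ i → root-inverse A₁ m prime-regular (lam∈A₁ i) (roots i)) f d-1

    -- Approximations obtained from close integers, and the conclusion.

    module Solve {U : ℤ → ℚ} {m} {coef : Fin m → ℚ} {s} {lam : Fin s → Carrier} {f : Fin s → List Carrier}
                 (binet : IsBinetExpansion K E U m coef s lam f) {a : ℚ}
                 (close : ∀ M → CloseInteger pp U a (suc M)) (S : Setting lam f (↧ₙ a)) where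
      open Setting S public
      open FiniteRing A hiding (Mem)
      open Congruence A
      open FiniteModule B
      open ModuleCongruence B

      ιa∈A : Mem A (ι a)
      ιa∈A = ι-mem (CloseInteger.a-integral (close 0))

      κ : Fin s → Carrier
      κ i = eval (f i) (ι a) * μ i ^ℤ (↥ a)

      μ^ℤ : ∀ i z → μ i ^ℤ z ≈ zpow (μ i) (μ⁻ i) z
      μ^ℤ i = ^ℤ-unit ≈-refl (μ-unit i)

      κ∈B : ∀ i → In (κ i)
      κ∈B i = In-resp (*-comm _ _) (act (resp (≈-sym (μ^ℤ i (↥ a))) (zpow-mem A (μ∈A i) (μ⁻∈A i) (↥ a))) (eval-in (f∈B i) ιa∈A))

      module C = Core A B κ κ∈B τs τs∈A τs-product τs-cofactors

      -- From d N = k + p^(M+1) t follows λᵢ^N = μᵢ^(d N) = μᵢ^k wᵢ with wᵢ = (μᵢ^(p^(M+1)))^t. The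
      -- sum of the κᵢ wᵢ differs from U(N) by the terms λᵢ^N (fᵢ(N) - fᵢ(a)), which are divisible
      -- because N - a is.
      approximation : ∀ M → C.Approximation (suc M)
      approximation M = record
        { w         = λ i → zpow (u i) (u⁻ i) t
        ; w⁻        = λ i → zpow (u⁻ i) (u i) t
        ; w-mem     = λ i → zpow-mem A (u∈A i) (u⁻∈A i) t
        ; w⁻-mem    = λ i → zpow-mem A (u⁻∈A i) (u∈A i) t
        ; w-unit    = λ i → zpow-inverse (^-inverse P (μ-unit i)) t
        ; w-torsion = λ i → zpow-≡1 A (suc e) (u∈A i) (u⁻∈A i) (u-torsion i) (inverse-≡1 A (suc e) (u⁻∈A i) (^-inverse P (μ-unit i)) (u-torsion i)) t
        ; relation  = ∣ᴮ-resp (≈-sym ∑κw) (∣ᴮ-+ U∣ (∣ᴮ-neg (∣ᴮ-∑ s difference∣)))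
        }
        where
        open CloseInteger (close M) renaming (u to υ)
        t = proj₁ exponent-difference
        P = p ℕ.^ suc M
        u u⁻ : Fin s → Carrier
        u i = μ i ^ P
        u⁻ i = μ⁻ i ^ P
        u∈A : ∀ i → Mem A (u i)
        u∈A i = ^-mem P (μ∈A i)
        u⁻∈A : ∀ i → Mem A (u⁻ i)
        u⁻∈A i = ^-mem P (μ⁻∈A i)
        -- `≡1-^p^` yields the exponent M + 2, one more than is asked for.
        u-torsion : ∀ i → p^ suc M ∣ u i ^ suc e - 1#
        u-torsion i = ∣-weaken (suc M) 1 (subst (λ N → p^ N ∣ u i ^ suc e - 1#) (ℕₚ.+-comm 1 (suc M))
          (∣-resp (+-congʳ (≈-trans (≈-sym (^-*′ (μ i) (suc e) P)) (^-* (μ i) (suc e) P)))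
            (≡1-^p^ (suc M) (^-mem (suc e) (μ∈A i)) (μ-torsion i))))
        lam^N : ∀ i → μ i ^ℤ (↥ a) * zpow (u i) (u⁻ i) t ≈ lam i ^ℤ N
        lam^N i = begin
          μ i ^ℤ (↥ a) * zpow (u i) (u⁻ i) t                              ≈⟨ *-cong (μ^ℤ i (↥ a)) (≈-sym (zpow-* (μ i) (μ⁻ i) P t)) ⟩
          zpow (μ i) (μ⁻ i) (↥ a) * zpow (μ i) (μ⁻ i) (+ P ℤ.* t)       ≈⟨ zpow-+ (μ-unit i) (↥ a) (+ P ℤ.* t) ⟨
          zpow (μ i) (μ⁻ i) (↥ a ℤ.+ + P ℤ.* t)                         ≈⟨ ≈-reflexive (cong (zpow (μ i) (μ⁻ i)) (≡.sym (proj₂ exponent-difference))) ⟩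
          zpow (μ i) (μ⁻ i) (↧ a ℤ.* N)                                 ≈⟨ zpow-* (μ i) (μ⁻ i) (↧ₙ a) N ⟩
          zpow (μ i ^ (↧ₙ a)) (μ⁻ i ^ (↧ₙ a)) N                       ≈⟨ ^ℤ-unit (≈-sym (μ^≈lam i)) (^-inverse (↧ₙ a) (μ-unit i)) N ⟨
          lam i ^ℤ N                                                    ∎
        lam^N∈A : ∀ i → Mem A (lam i ^ℤ N)
        lam^N∈A i = resp (lam^N i) (*-mem (resp (≈-sym (μ^ℤ i (↥ a))) (zpow-mem A (μ∈A i) (μ⁻∈A i) (↥ a))) (zpow-mem A (u∈A i) (u⁻∈A i) t))
        difference : Fin s → Carrier
        difference i = lam i ^ℤ N * (eval (f i) (ι (fromℤ N)) - eval (f i) (ι a))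
        difference∣ : ∀ i → p^ suc M ∣ᴮ difference i
        difference∣ i = let b , Ib , eq = eval-difference (f∈B i) (ι-mem (integral-fromℤ N)) ιa∈A in
          ∣ᴮ-act (lam^N∈A i) (∣ᴮ-resp (≈-sym eq) (∣-∣ᴮ (Congruence.multiple (ι-mem d-integral)
            (≈-trans (≈-sym (ι-sub (fromℤ N) a)) (≈-trans (ι-cong N-a≡) (ι-* _ _)))) Ib))
        U∣ : p^ suc M ∣ᴮ ι (U N)
        U∣ = ∣ᴮ-resp (*-identityʳ _) (∣-∣ᴮ (Congruence.multiple (ι-mem u-integral) (≈-trans (ι-cong UN≡) (ι-* _ _))) 1-in)
        ∑κw : ∑ s (λ i → κ i * zpow (u i) (u⁻ i) t) ≈ ι (U N) - ∑ s difference
        ∑κw = begin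
          ∑ s (λ i → κ i * zpow (u i) (u⁻ i) t)     ≈⟨ ∑-cong s (λ i → ≈-trans (*-assoc _ _ _) (≈-trans (*-congˡ (lam^N i))
            (solve 3 (λ x y z → x :* z := y :* z :- z :* (y :- x)) ≈-refl (eval (f i) (ι a)) (eval (f i) (ι (fromℤ N))) (lam i ^ℤ N)))) ⟩
          ∑ s (λ i → eval (f i) (ι (fromℤ N)) * lam i ^ℤ N - difference i)   ≈⟨ ∑-sub s _ difference ⟩
          ∑ s (λ i → eval (f i) (ι (fromℤ N)) * lam i ^ℤ N) - ∑ s difference ≈⟨ +-congʳ (proj₂ (proj₂ (proj₂ (proj₂ binet))) N) ⟨
          ι (U N) - ∑ s difference                  ∎

      weights = C.exact-weights approximation
      y = proj₁ weights
      y-algebraic = proj₁ (proj₂ weights)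
      ∑y≉0 : ¬ (∑ (suc e ℕ.^ s) y ≈ 0#)
      ∑y≉0 = ∏-≉0 s (ι-≉0 {fromℤ (+ suc e)} (λ eq → suc≢0 (fromℤ-nonZero {+ suc e} eq))) ∘ ≈-trans (≈-sym (proj₁ (proj₂ (proj₂ weights))))
        where
        suc≢0 : + suc e ≢ + 0
        suc≢0 ()
      yΣκ≈0 = proj₂ (proj₂ (proj₂ weights))

      trz-from : (ξ : Fin s → Carrier) → (∀ i → IsRootOfUnity (ξ i)) → ∑ s (λ i → ξ i * κ i) ≈ 0# → IsTRZ K E s lam f a
      trz-from ξ ξ-root ∑≈0 = μ , ξ , μ^≈lam , ξ-root , ∑≈0

      trz-connected : (∀ ε → ε * ε ≈ ε → (ε ≈ 0#) ⊎ (ε ≈ 1#)) → IsTRZ K E s lam f a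
      trz-connected connected =
        let σ , y≉0 = nonzero-summand (suc e ℕ.^ s) (λ σ → algebraic-nilpotent-or-nonzero {A} connected (y-algebraic σ)) ∑y≉0
            τ = λ i → Vec.lookup τs (Fin.finToFun σ i)
        in trz-from τ (λ i → suc e , (λ ()) , τ^≈1 (Fin.finToFun σ i))
             (≈-trans (∑-cong s (λ i → *-comm (τ i) (κ i))) (cancel-≉0 y≉0 (yΣκ≈0 σ)))

    module Single {U : ℤ → ℚ} {m} {coef : Fin m → ℚ} {lam : Fin 1 → Carrier} {f : Fin 1 → List Carrier}
                  (binet : IsBinetExpansion K E U m coef 1 lam f) {a : ℚ}
                  (close : ∀ M → CloseInteger pp U a (suc M)) (S : Setting lam f (↧ₙ a)) where
      open Solve {coef = coef} binet close S

      κ₀ = κ zero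

      -- With one summand the root of unity can be removed from the relation: τ^e is an inverse of
      -- τ, since τ^(e+1) = 1.
      yκ≈0 : ∀ (σ : Fin (suc e ℕ.^ 1)) → κ₀ * y σ ≈ 0#
      yκ≈0 σ = begin
        κ₀ * y σ                                  ≈⟨ *-identityʳ _ ⟨
        κ₀ * y σ * 1#                             ≈⟨ *-congˡ (τ^≈1 j) ⟨
        κ₀ * y σ * (τ * τ ^ e)                    ≈⟨ solve 4 (λ k y t x → k :* y :* (t :* x) := (y :* (k :* t :+ con (+ 0))) :* x) ≈-refl κ₀ (y σ) τ (τ ^ e) ⟩
        y σ * (κ₀ * τ + 0#) * τ ^ e               ≈⟨ *-congʳ (yΣκ≈0 σ) ⟩
        0# * τ ^ e                                ≈⟨ zeroˡ _ ⟩
        0#                                        ∎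
        where
        j = Fin.finToFun {suc e} {1} σ zero
        τ = Vec.lookup τs j

      ∑-0 : ∀ n {g : Fin n → Carrier} → (∀ i → g i ≈ 0#) → ∑ n g ≈ 0#
      ∑-0 zero    h = ≈-refl
      ∑-0 (suc n) h = ≈-trans (+-cong (h zero) (∑-0 n (h ∘ suc))) (+-identityˡ 0#)

      ∑yκ≈0 : ∑ (suc e ℕ.^ 1) y * κ₀ ≈ 0#
      ∑yκ≈0 = ≈-trans (*-comm _ _) (≈-trans (≈-sym (∑-*ˡ (suc e ℕ.^ 1) κ₀ y)) (∑-0 (suc e ℕ.^ 1) yκ≈0))

      trz-single : IsTRZ K E 1 lam f a
      trz-single = trz-from (const 1#) (λ _ → 1 , (λ ()) , *-identityˡ 1#)
        (≈-trans (+-identityʳ _) (≈-trans (*-identityˡ _) (cancel-≉0 ∑y≉0 ∑yκ≈0)))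

    trz : ∀ {U m coef} s {lam f} → IsBinetExpansion K E U m coef s lam f → ∀ {a} → RegularPrime p m coef →
      (∀ M → CloseInteger pp U a (suc M)) → IsTRZ K E s lam f a
    trz zero binet regular close = (λ ()) , (λ ()) , (λ ()) , (λ ()) , ≈-refl
    -- There is no second root for an idempotent to interpolate with. The denominator `↧ₙ a` is by
    -- definition the successor of `denominator-1 a`, the form in which d-th roots are extracted.
    trz {coef = coef} (suc zero) {f = f} binet@(_ , roots , _) {a} regular close =
      Single.trz-single {coef = coef} binet close (setting {coef = coef} regular roots f (ℚ.denominator-1 a))
    trz {m = m} {coef} (suc (suc s)) {lam} {f} binet@(distinct , roots , complete , _) {a} regular close =
      Solve.trz-connected {coef = coef} binet close (setting {coef = coef} regular roots f (ℚ.denominator-1 a))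
        (finite-root-set⇒connected (charPoly K E m coef) lam distinct roots complete)

open import Data.Rational using (_-_)

theorem1p5 : ∀ {c ℓ} (K : AlgClosedField c ℓ) (E : QEmbedding K)
    (U : ℤ → ℚ) (m : ℕ) (coef : Fin m → ℚ) → IsMinimalRec U m coef →
    (s : ℕ) (lam : Fin s → AlgClosedField.Carrier K)
    (f : Fin s → List (AlgClosedField.Carrier K)) →
    IsBinetExpansion K E U m coef s lam f →
    (a : ℚ) (p : ℕ) → Prime p → RegularPrime p m coef →
    (n : ℕ → ℤ) →
    TendsTo∞ (λ k → νₚ p (U (n k))) →
    TendsTo∞ (λ k → νₚ p (fromℤ (n k) - a)) →
    IsTRZ K E s lam f a
theorem1p5 K E U m coef _ s lam f binet a p pp regular n U→0 n→a =
  Theory.AtPrime.trz K E pp {coef = coef} s binet regular (close-integers pp n U→0 n→a)
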